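{- The collection $\{\mathcal{B}_w\}_{w\in W}$ is an LKTS$(q^n+2)$ on $X=W\cup\{\infty_1,\infty_2\}$, i.e. every 3-subset of $X$ is a block of exactly one $\mathcal{B}_w$, and each $\mathcal{B}_w$ is a KTS$(q^n+2)$.
   Context: Let $q=6t+1$ be a prime power, $n\geq2$, $W=\mathbb{F}_q^n$, $X=W\cup\{\infty_1,\infty_2\}$. A KTS$(v)$ is a Steiner triple system whose blocks are partitioned into parallel classes; an LKTS$(v)$ is a set of $v-2$ pairwise block-disjoint KTS$(v)$ on a common $v$-set. Let $Y=\mathbb{F}_q\cup\{\infty_1,\infty_2\}$ and $\{\mathcal{D}_i\}_{i\in\mathbb{F}_q}$ an LKTS$(q+2)$ on $Y$ with $\{\infty_1,\infty_2,i\}\in\mathcal{D}_i$; let $Q_{i,0},\dots,Q_{i,(q-1)/2}$ be the parallel classes of $\mathcal{D}_i$, with $\{\infty_1,\infty_2,i\}\in Q_{i,0}$. For $A\subseteq Y$, $x\in W$: $Ax=\{ax:a\in A\}$ with $\infty_jx=\infty_j$; for $z\in W$, $S\subseteq X$: $z+S=\{z+s:s\in S\}$ with $z+\infty_j=\infty_j$. For each 2-dimensional subspace $L\subseteq W$ fix a nonzero skew-symmetric bilinear form $f_L$ on $L$. Let $g$ generate $\mathbb{F}_q^*$, $\omega=g^{2t}$, $T(u,v)=\{u+v,\omega u+\omega^2v,\omega^2u+\omega v\}$, $-S=\{ -x:x\in S\}$. For a 1-dimensional subspace $K$, nonzero $u\in K$, $c\in\mathbb{F}_q^*$: $P_{u,L,c}=\{\pm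 T(u,v): v\in L,\ f_L(u,v)=g^mc\text{ for some }0\leq m<t\}$ for 2-dimensional $L\supset K$, and $P_{u,c}=\bigcup_{L\supset K}P_{u,L,c}$. Let $K_1,\dots,K_N$, $N=(q^n-1)/(q-1)$, be the 1-dimensional subspaces, $u_i\in K_i$ nonzero, $R_i$ a system of coset representatives of $K_i$, and $p_i:W\to\mathbb{F}_q$ with $x-p_i(x)u_i\in R_i$. For $w\in W$, $\mathcal{B}_w$ is the set of all triples in the classes $P_{w,u_i,a+bt+1}=(w+P_{g^au_i,\omega^b})\cup\{(w-p_i(w)u_i)+Au_i: A\in Q_{p_i(w),a+bt+1}\}$ ($1\leq i\leq N$, $0\leq a<t$, $b\in\{0,1,2\}$) and $P_{w,*}=\bigcup_{i=1}^N\{(w-p_i(w)u_i)+Au_i: A\in Q_{p_i(w),0}\}$, these classes forming its resolution. -}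

module Defs where

open import Data.Nat using (ℕ; zero; suc; _<_; _≤_) renaming (_+_ to _+ℕ_; _*_ to _*ℕ_)
open import Data.Fin using (Fin; toℕ)
open import Data.Vec using (Vec; zipWith; map; replicate)
open import Data.Product using (Σ; ∃; ∃₂; _×_; _,_)
open import Data.Sum using (_⊎_; inj₁; inj₂)
open import Data.Unit using (⊤; tt)
open import Relation.Binary.PropositionalEquality using (_≡_; _≢_)
open import Algebra.Core using (Op₁; Op₂)
open import Algebra.Structures using (IsCommutativeRing)
open import Function.Bundles using (_↔_)

-- Finite fields with q elements (q is then automatically a prime power)

record FiniteField (q : ℕ) : Set₁ where
  field
    Carrier           : Set
    _+_ _*_           : Op₂ Carrier
    -_                : Op₁ Carrier
    0# 1#             : Carrier
    isCommutativeRing : IsCommutativeRing _≡_ _+_ _*_ -_ 0# 1#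
    0≢1               : 0# ≢ 1#
    inverse           : ∀ x → x ≢ 0# → ∃ λ y → x * y ≡ 1#
    enum              : Fin q ↔ Carrier

-- Generic design-theoretic notions.
-- A triple ⟨ x , y , z ⟩ represents the set {x,y,z}; a collection of
-- blocks is a predicate on triples, and membership of a set in a
-- collection is always taken up to equality of the underlying sets.

record Tri (A : Set) : Set where
  constructor ⟨_,_,_⟩
  field
    x₁ x₂ x₃ : A

mapTri : {A B : Set} → (A → B) → Tri A → Tri B
mapTri h ⟨ x , y , z ⟩ = ⟨ h x , h y , h z ⟩

_∈ₜ_ : {A : Set} → A → Tri A → Set
a ∈ₜ ⟨ x , y , z ⟩ = a ≡ x ⊎ a ≡ y ⊎ a ≡ z

Proper : {A : Set} → Tri A → Set
Proper ⟨ x , y , z ⟩ = x ≢ y × x ≢ z × y ≢ z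

SameSet : {A : Set} → Tri A → Tri A → Set
SameSet s t = ∀ a → (a ∈ₜ s → a ∈ₜ t) × (a ∈ₜ t → a ∈ₜ s)

Coll : Set → Set₁
Coll A = Tri A → Set

_∈ᵇ_ : {A : Set} → Tri A → Coll A → Set
t ∈ᵇ C = ∃ λ s → C s × SameSet s t

AllProper : {A : Set} → Coll A → Set
AllProper C = ∀ s → C s → Proper s

IsSTS : {A : Set} → Coll A → Set
IsSTS {A} C =
  AllProper C
  × (∀ (a b : A) → a ≢ b → ∃ λ t → t ∈ᵇ C × a ∈ₜ t × b ∈ₜ t)
  × (∀ (a b : A) t t' → a ≢ b → t ∈ᵇ C → a ∈ₜ t → b ∈ₜ t
       → t' ∈ᵇ C → a ∈ₜ t' → b ∈ₜ t' → SameSet t t')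

IsParallelClass : {A : Set} → Coll A → Set
IsParallelClass {A} C =
  AllProper C
  × (∀ (a : A) → ∃ λ t → t ∈ᵇ C × a ∈ₜ t)
  × (∀ (a : A) t t' → t ∈ᵇ C → a ∈ₜ t → t' ∈ᵇ C → a ∈ₜ t' → SameSet t t')

Union : {A I : Set} → (I → Coll A) → Coll A
Union Cls s = ∃ λ i → Cls i s

IsResolvedKTS : {A I : Set} → (I → Coll A) → Set
IsResolvedKTS {A} {I} Cls =
  IsSTS (Union Cls)
  × (∀ i → IsParallelClass (Cls i))
  × (∀ (i j : I) t → t ∈ᵇ Cls i → t ∈ᵇ Cls j → i ≡ j)

data Pt (A : Set) : Set where
  fin    : A → Pt A
  ∞₁ ∞₂ : Pt A

module Construction {q : ℕ} (𝔽 : FiniteField q) (n : ℕ) where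
  open FiniteField 𝔽

  pow : Carrier → ℕ → Carrier
  pow x zero    = 1#
  pow x (suc k) = x * pow x k

  W : Set
  W = Vec Carrier n

  0v : W
  0v = replicate n 0#

  infixl 6 _⊕_ _⊖_
  infixr 7 _•_

  _⊕_ : W → W → W
  _⊕_ = zipWith _+_

  neg : W → W
  neg = map -_

  _⊖_ : W → W → W
  x ⊖ y = x ⊕ neg y

  _•_ : Carrier → W → W
  c • x = map (c *_) x

  InSpan1 : W → W → Set
  InSpan1 x y = ∃ λ c → y ≡ c • x

  InSpan2 : W → W → W → Set
  InSpan2 x y z = ∃₂ λ α β → z ≡ α • x ⊕ β • y

  Independent : W → W → Set
  Independent x y = ∀ α β → α • x ⊕ β • y ≡ 0v → α ≡ 0# × β ≡ 0#

  SameSpan : W → W → W → W → Set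
  SameSpan x y x' y' = ∀ z → (InSpan2 x y z → InSpan2 x' y' z) × (InSpan2 x' y' z → InSpan2 x y z)

  extPt : W → W → Pt Carrier → Pt W
  extPt base u (fin a) = fin (base ⊕ a • u)
  extPt base u ∞₁      = ∞₁
  extPt base u ∞₂      = ∞₂

  record ConstructionData (t : ℕ) : Set₁ where
    field
      -- K₁ … K_N : the 1-dimensional subspaces, K_i = span{u i}
      N          : ℕ
      u          : Fin N → W
      u≢0        : ∀ i → u i ≢ 0v
      K-cover    : ∀ x → x ≢ 0v → ∃ λ i → InSpan1 (u i) x
      K-distinct : ∀ i j → InSpan1 (u j) (u i) → i ≡ j
      -- R i : a system of coset representatives of K_i, and p i
      R          : Fin N → W → Set
      R-exists   : ∀ i x → ∃ λ r → R i r × InSpan1 (u i) (x ⊖ r)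
      R-unique   : ∀ i x r r' → R i r → InSpan1 (u i) (x ⊖ r)
                     → R i r' → InSpan1 (u i) (x ⊖ r') → r ≡ r'
      p          : Fin N → W → Carrier
      p-spec     : ∀ i x → R i (x ⊖ p i x • u i)
      -- L₁ … L_M : the 2-dimensional subspaces, L_l = span{b₁ l, b₂ l}
      M          : ℕ
      b₁ b₂      : Fin M → W
      b-indep    : ∀ l → Independent (b₁ l) (b₂ l)
      L-cover    : ∀ x y → Independent x y → ∃ λ l → SameSpan (b₁ l) (b₂ l) x y
      L-distinct : ∀ l l' → SameSpan (b₁ l) (b₂ l) (b₁ l') (b₂ l') → l ≡ l'
      f          : Fin M → W → W → Carrier
      f-addˡ     : ∀ l x y z → InSpan2 (b₁ l) (b₂ l) x → InSpan2 (b₁ l) (b₂ l) y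
                     → InSpan2 (b₁ l) (b₂ l) z → f l (x ⊕ y) z ≡ f l x z + f l y z
      f-addʳ     : ∀ l x y z → InSpan2 (b₁ l) (b₂ l) x → InSpan2 (b₁ l) (b₂ l) y
                     → InSpan2 (b₁ l) (b₂ l) z → f l x (y ⊕ z) ≡ f l x y + f l x z
      f-scaleˡ   : ∀ l c x y → InSpan2 (b₁ l) (b₂ l) x → InSpan2 (b₁ l) (b₂ l) y
                     → f l (c • x) y ≡ c * f l x y
      f-scaleʳ   : ∀ l c x y → InSpan2 (b₁ l) (b₂ l) x → InSpan2 (b₁ l) (b₂ l) y
                     → f l x (c • y) ≡ c * f l x y
      f-skew     : ∀ l x y → InSpan2 (b₁ l) (b₂ l) x → InSpan2 (b₁ l) (b₂ l) y
                     → f l x y ≡ - f l y x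
      f-nonzero  : ∀ l → ∃₂ λ x y → InSpan2 (b₁ l) (b₂ l) x × InSpan2 (b₁ l) (b₂ l) y
                     × f l x y ≢ 0#
      g          : Carrier
      g-gen      : ∀ x → x ≢ 0# → ∃ λ k → x ≡ pow g k
      -- {D_i} an LKTS(q+2) on Y = 𝔽 ∪ {∞₁,∞₂}; Q i j (j ≤ 3t = (q-1)/2)
      -- the parallel classes of D_i
      Q          : Carrier → ℕ → Coll (Pt Carrier)
      Q-KTS      : ∀ i → IsResolvedKTS (λ (j : Fin (suc (3 *ℕ t))) → Q i (toℕ j))
      Q-disjoint : ∀ i i' s → s ∈ᵇ Union (λ (j : Fin (suc (3 *ℕ t))) → Q i (toℕ j))
                     → s ∈ᵇ Union (λ (j : Fin (suc (3 *ℕ t))) → Q i' (toℕ j)) → i ≡ i'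
      Q-∞        : ∀ i → ⟨ ∞₁ , ∞₂ , fin i ⟩ ∈ᵇ Q i 0

  module _ {t : ℕ} (D : ConstructionData t) where
    open ConstructionData D

    ω : Carrier
    ω = pow g (2 *ℕ t)

    T : W → W → Tri W
    T x y = ⟨ x ⊕ y , ω • x ⊕ (ω * ω) • y , (ω * ω) • x ⊕ ω • y ⟩

    P : W → Carrier → Coll W
    P x c s = ∃ λ l → InSpan2 (b₁ l) (b₂ l) x
               × ∃ λ v → InSpan2 (b₁ l) (b₂ l) v
               × ∃ λ m → m < t × f l x v ≡ pow g m * c
               × (s ≡ T x v ⊎ s ≡ mapTri neg (T x v))

    Idx : Set
    Idx = (Fin N × Fin t × Fin 3) ⊎ ⊤

    QPart : W → Fin N → ℕ → Coll (Pt W)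
    QPart w i j s = ∃ λ A → Q (p i w) j A × s ≡ mapTri (extPt (w ⊖ p i w • u i) (u i)) A

    BClass : W → Idx → Coll (Pt W)
    BClass w (inj₁ (i , a , b)) s =
      (∃ λ s' → P (pow g (toℕ a) • u i) (pow ω (toℕ b)) s' × s ≡ mapTri (λ y → fin (w ⊕ y)) s')
      ⊎ QPart w i (toℕ a +ℕ toℕ b *ℕ t +ℕ 1) s
    BClass w (inj₂ tt) s = ∃ λ i → QPart w i 0 s

    B : W → Coll (Pt W)
    B w = Union (BClass w)

    IsLKTS : Set
    IsLKTS =
      (∀ s → Proper s → (∃ λ w → s ∈ᵇ B w) × (∀ w w' → s ∈ᵇ B w → s ∈ᵇ B w' → w ≡ w'))
      × (∀ w → IsResolvedKTS (BClass w))

{-# OPTIONS --safe #-}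
module Submission where

{-
Translate by w, so that w = 0.  If x, y span a plane, put z = −(x + y); the triples {x, y, z} obtained in this way
are exactly the triples ± T(u, v) that occur in 𝓑_0.  Indeed {x, y, z} = T(u, v), where 3u and 3v are the Fourier
coefficients x + ω²y + ωz and x + ωy + ω²z, and the six orderings of the triple give the pairs (ωᵏu, ω⁻ᵏv) and
(ωᵏv, ω⁻ᵏu).  Since g has order 6t, − 1 = g³ᵗ and ω = g²ᵗ, every nonzero scalar is uniquely ± ωᵏgᵐ with k < 3 and m < t.
Applied to f(u, v) = − f(v, u) this selects the order of u and v as well as b, and applied to the coordinate of u
on its line K_i it selects the sign, the exponent k and a: the triple is in exactly one class.  In a given class the
block through y is found from f(x, y) = ± ω⁻ʲ f(x, v) for y = ± (ωʲx + ω⁻ʲv).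
Two points of X not spanning a plane with w are on a line w + K_i with ∞₁, ∞₂, where 𝓑_w is a copy of 𝒟_{p_i(w)},
and all these copies share the block {∞₁, ∞₂, w}.

A triple of points not on a line is in 𝓑_w only for its centroid w (note 3 ≠ 0).  On a line with origin in R_i the
systems 𝓑_w with w on the line induce each 𝒟_c exactly once, and the 𝒟_c cover each triple exactly once.
-}

open import Defs
open import Algebra.Bundles using (CommutativeRing; RawRing)
import Algebra.Properties.Ring
import Algebra.Properties.Semiring.Mult.TCOptimised
import Algebra.Solver.Ring
open import Algebra.Solver.Ring.AlmostCommutativeRing
  using (AlmostCommutativeRing; fromCommutativeRing; _-Raw-AlmostCommutative⟶_)
open import Data.Bool using (Bool; true; false)
open import Data.Empty using (⊥; ⊥-elim)
open import Data.Fin using (Fin; zero; suc; toℕ; fromℕ<; punchOut; punchIn; combine; remQuot; _↑ˡ_; _↑ʳ_)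
open import Data.Fin.Patterns
open import Data.Fin.Properties
  using (any?; <⇒notInjective; pigeonhole; injective⇒≤; punchOut-injective; punchIn-injective; punchInᵢ≢i;
         toℕ<n; toℕ-fromℕ<; toℕ-injective; toℕ-combine; combine-injective; combine-surjective; combine-remQuot;
         fromℕ<-injective; suc-injective)
  renaming (_≟_ to _≟ᶠⁱⁿ_)
open import Data.Integer as ℤ using (ℤ; -[1+_])
import Data.Integer.Properties as ℤₚ
open import Data.Maybe as Maybe using (just; is-just)
open import Data.Nat as ℕ using (ℕ; zero; suc; NonZero) renaming (_+_ to _+ℕ_; _*_ to _*ℕ_)
import Data.Nat.DivMod as ℕ
import Data.Nat.Properties as ℕₚ
open import Data.Product using (∃; _×_; _,_; proj₁; proj₂)
import Data.Product.Properties as Productₚ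
open import Data.Sum using (_⊎_; inj₁; inj₂)
open import Data.Unit using (tt)
open import Data.Vec using (Vec; []; _∷_; lookup; map; _++_; tabulate; replicate)
open import Data.Vec.Functional using () renaming (_∷_ to _◂_)
open import Data.Vec.N-ary using (N-ary; _$ⁿ_)
open import Data.Vec.Properties as Vecₚ
  using (lookup-map; lookup-zipWith; lookup-replicate; lookup-++ˡ; lookup-++ʳ; tabulate∘lookup; tabulate-cong)
open import Function using (_∘_; id)
open import Function.Bundles using (Inverse; Injection; mk↣)
open import Function.Definitions using (Injective)
open import Function.Properties.Inverse using (↔⇒↣; ↔-sym)
open import Level using (0ℓ)
open import Relation.Binary.Definitions using (DecidableEquality; tri<; tri≈; tri>)
open import Relation.Binary.PropositionalEquality
open import Relation.Nullary using (Dec; yes; no; contradiction)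
open import Relation.Nullary.Decidable using (via-injection; dec⇒maybe)

-- Two representations of a triple as ± T(u, v) differ by a rotation (ωᵏu, ω⁻ᵏv), by negating u, v
-- and the sign together, or by exchanging u and v. Rotation and negation have determinant 1 and
-- preserve the value of an alternating form, whereas the exchange negates it. Hence normalising the
-- value of the form and normalising u on its line do not interfere, which is what the skew form
-- contributes. Blocks are sets stored as ordered triples, so showing that two classes share no
-- block means comparing all six orders. On Fourier coefficients a reordering becomes one of the
-- changes above, and a comparison of points turns into a comparison of scalars. Existence and
-- uniqueness of blocks are proved separately, without counting blocks. Cardinality is used for the
-- powers of `g` and for the fact that the given systems on `Y` exhaust its triples.

◂-injective : ∀ {A : Set} {n} {x : A} {f : Fin n → A} → (∀ i → f i ≢ x)
  → Injective _≡_ _≡_ f → Injective _≡_ _≡_ (x ◂ f)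
◂-injective x∉f f-inj {zero}  {zero}  _  = refl
◂-injective x∉f f-inj {zero}  {suc j} eq = contradiction (sym eq) (x∉f j)
◂-injective x∉f f-inj {suc i} {zero}  eq = contradiction eq (x∉f i)
◂-injective x∉f f-inj {suc i} {suc j} eq = cong suc (f-inj eq)

-- Triples as sets and as ordered triples

module _ {A : Set} where

  same-refl : {s : Tri A} → SameSet s s
  same-refl a = (λ z → z) , (λ z → z)

  same-sym : {s t : Tri A} → SameSet s t → SameSet t s
  same-sym st a = proj₂ (st a) , proj₁ (st a)

  same-trans : {s t r : Tri A} → SameSet s t → SameSet t r → SameSet s r
  same-trans st tr a = proj₁ (tr a) ∘ proj₁ (st a) , proj₂ (st a) ∘ proj₂ (tr a)

  pattern 1st = inj₁ refl
  pattern 2nd = inj₂ (inj₁ refl)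
  pattern 3rd = inj₂ (inj₂ refl)

  -- Blocks are compared as sets, but sums and Fourier coefficients depend on an ordered triple. For
  -- proper triples these six cases translate between the two.
  data Perm : Tri A → Tri A → Set where
    p123 : ∀ {x y z} → Perm ⟨ x , y , z ⟩ ⟨ x , y , z ⟩
    p231 : ∀ {x y z} → Perm ⟨ x , y , z ⟩ ⟨ y , z , x ⟩
    p312 : ∀ {x y z} → Perm ⟨ x , y , z ⟩ ⟨ z , x , y ⟩
    p132 : ∀ {x y z} → Perm ⟨ x , y , z ⟩ ⟨ x , z , y ⟩
    p213 : ∀ {x y z} → Perm ⟨ x , y , z ⟩ ⟨ y , x , z ⟩
    p321 : ∀ {x y z} → Perm ⟨ x , y , z ⟩ ⟨ z , y , x ⟩

  perm⇒same : {s t : Tri A} → Perm s t → SameSet s t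
  perm⇒same p123 a = (λ z → z) , (λ z → z)
  perm⇒same p231 a = (λ { (inj₁ e) → inj₂ (inj₂ e) ; (inj₂ (inj₁ e)) → inj₁ e ; (inj₂ (inj₂ e)) → inj₂ (inj₁ e) })
                   , (λ { (inj₁ e) → inj₂ (inj₁ e) ; (inj₂ (inj₁ e)) → inj₂ (inj₂ e) ; (inj₂ (inj₂ e)) → inj₁ e })
  perm⇒same p312 a = (λ { (inj₁ e) → inj₂ (inj₁ e) ; (inj₂ (inj₁ e)) → inj₂ (inj₂ e) ; (inj₂ (inj₂ e)) → inj₁ e })
                   , (λ { (inj₁ e) → inj₂ (inj₂ e) ; (inj₂ (inj₁ e)) → inj₁ e ; (inj₂ (inj₂ e)) → inj₂ (inj₁ e) })
  perm⇒same p132 a = (λ { (inj₁ e) → inj₁ e ; (inj₂ (inj₁ e)) → inj₂ (inj₂ e) ; (inj₂ (inj₂ e)) → inj₂ (inj₁ e) })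
                   , (λ { (inj₁ e) → inj₁ e ; (inj₂ (inj₁ e)) → inj₂ (inj₂ e) ; (inj₂ (inj₂ e)) → inj₂ (inj₁ e) })
  perm⇒same p213 a = (λ { (inj₁ e) → inj₂ (inj₁ e) ; (inj₂ (inj₁ e)) → inj₁ e ; (inj₂ (inj₂ e)) → inj₂ (inj₂ e) })
                   , (λ { (inj₁ e) → inj₂ (inj₁ e) ; (inj₂ (inj₁ e)) → inj₁ e ; (inj₂ (inj₂ e)) → inj₂ (inj₂ e) })
  perm⇒same p321 a = (λ { (inj₁ e) → inj₂ (inj₂ e) ; (inj₂ (inj₁ e)) → inj₂ (inj₁ e) ; (inj₂ (inj₂ e)) → inj₁ e })
                   , (λ { (inj₁ e) → inj₂ (inj₂ e) ; (inj₂ (inj₁ e)) → inj₂ (inj₁ e) ; (inj₂ (inj₂ e)) → inj₁ e })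

  -- Moves two chosen points to the front, so that blocks through the same pair can be compared by
  -- their third points.
  third-point : {a b : A} (t : Tri A) → a ≢ b → a ∈ₜ t → b ∈ₜ t → ∃ λ c → Perm t ⟨ a , b , c ⟩
  third-point ⟨ x , y , z ⟩ a≢b 1st 1st = contradiction refl a≢b
  third-point ⟨ x , y , z ⟩ a≢b 1st 2nd = z , p123
  third-point ⟨ x , y , z ⟩ a≢b 1st 3rd = y , p132
  third-point ⟨ x , y , z ⟩ a≢b 2nd 1st = z , p213
  third-point ⟨ x , y , z ⟩ a≢b 2nd 2nd = contradiction refl a≢b
  third-point ⟨ x , y , z ⟩ a≢b 2nd 3rd = x , p231
  third-point ⟨ x , y , z ⟩ a≢b 3rd 1st = y , p312
  third-point ⟨ x , y , z ⟩ a≢b 3rd 2nd = x , p321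
  third-point ⟨ x , y , z ⟩ a≢b 3rd 3rd = contradiction refl a≢b

  perm-proper : {s t : Tri A} → Perm s t → Proper s → Proper t
  perm-proper p123 (a , b , c) = a , b , c
  perm-proper p231 (a , b , c) = c , a ∘ sym , b ∘ sym
  perm-proper p312 (a , b , c) = b ∘ sym , c ∘ sym , a
  perm-proper p132 (a , b , c) = b , a , c ∘ sym
  perm-proper p213 (a , b , c) = a ∘ sym , c , b
  perm-proper p321 (a , b , c) = c ∘ sym , b ∘ sym , a ∘ sym

  in-1 : {x y z : A} → x ∈ₜ ⟨ x , y , z ⟩
  in-1 = inj₁ refl

  in-2 : {x y z : A} → y ∈ₜ ⟨ x , y , z ⟩
  in-2 = inj₂ (inj₁ refl)

  in-3 : {x y z : A} → z ∈ₜ ⟨ x , y , z ⟩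
  in-3 = inj₂ (inj₂ refl)

  same⇒perm : {s t : Tri A} → Proper s → Proper t → SameSet s t → Perm s t
  same⇒perm {s} {⟨ x , y , z ⟩} ps (x≢y , x≢z , y≢z) st
    with third-point s x≢y (proj₂ (st x) in-1) (proj₂ (st y) in-2)
  -- By `π` the points of `s` are `x`, `y` and `c`; since `z` lies in `s` and differs from `x` and
  -- `y`, it is `c`.
  ... | c , π with proj₁ (perm⇒same π z) (proj₂ (st z) in-3)
  ...   | inj₁ z≡x        = contradiction (sym z≡x) x≢z
  ...   | inj₂ (inj₁ z≡y) = contradiction (sym z≡y) y≢z
  ...   | inj₂ (inj₂ refl) = π

module _ {A B : Set} (h : A → B) where

  ∈-map : ∀ {a} (s : Tri A) → a ∈ₜ s → h a ∈ₜ mapTri h s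
  ∈-map s 1st = in-1
  ∈-map s 2nd = in-2
  ∈-map s 3rd = in-3

  ∈-map⁻ : ∀ {b} (s : Tri A) → b ∈ₜ mapTri h s → ∃ λ a → a ∈ₜ s × b ≡ h a
  ∈-map⁻ ⟨ x , y , z ⟩ (inj₁ e) = x , in-1 , e
  ∈-map⁻ ⟨ x , y , z ⟩ (inj₂ (inj₁ e)) = y , in-2 , e
  ∈-map⁻ ⟨ x , y , z ⟩ (inj₂ (inj₂ e)) = z , in-3 , e

  same-map : {s t : Tri A} → SameSet s t → SameSet (mapTri h s) (mapTri h t)
  same-map {s} {t} st b =
      (λ b∈ → let (a , a∈ , e) = ∈-map⁻ s b∈ in subst (_∈ₜ mapTri h t) (sym e) (∈-map t (proj₁ (st a) a∈)))
    , (λ b∈ → let (a , a∈ , e) = ∈-map⁻ t b∈ in subst (_∈ₜ mapTri h s) (sym e) (∈-map s (proj₂ (st a) a∈)))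

  module _ (h-inj : ∀ {x y} → h x ≡ h y → x ≡ y) where

    ∈-unmap : ∀ {a} (s : Tri A) → h a ∈ₜ mapTri h s → a ∈ₜ s
    ∈-unmap s ha∈ with ∈-map⁻ s ha∈
    ... | a' , a'∈ , e = subst (_∈ₜ s) (sym (h-inj e)) a'∈

    same-unmap : {s t : Tri A} → SameSet (mapTri h s) (mapTri h t) → SameSet s t
    same-unmap {s} {t} st a =
      ∈-unmap t ∘ proj₁ (st (h a)) ∘ ∈-map s , ∈-unmap s ∘ proj₂ (st (h a)) ∘ ∈-map t

    proper-map : (s : Tri A) → Proper s → Proper (mapTri h s)
    proper-map s (a , b , c) = a ∘ h-inj , b ∘ h-inj , c ∘ h-inj

  proper-unmap : (s : Tri A) → Proper (mapTri h s) → Proper s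
  proper-unmap s (a , b , c) = a ∘ cong h , b ∘ cong h , c ∘ cong h

fin-injective : {A : Set} {x y : A} → fin x ≡ fin y → x ≡ y
fin-injective refl = refl

module _ {A : Set} {C : Coll A} where

  -- `IsSTS` speaks of all triples that equal a member of `C` as sets. Existence and uniqueness are
  -- invariant under that change, so they need checking only on the members themselves.
  sts-intro : AllProper C
    → (∀ {a b} → a ≢ b → ∃ λ s → C s × a ∈ₜ s × b ∈ₜ s)
    → (∀ {a b s s'} → a ≢ b → C s → a ∈ₜ s → b ∈ₜ s → C s' → a ∈ₜ s' → b ∈ₜ s' → SameSet s s')
    → IsSTS C
  sts-intro proper exists unique = proper
    , (λ a b a≢b → let s , Cs , a∈ , b∈ = exists a≢b in s , (s , Cs , same-refl) , a∈ , b∈)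
    , λ a b t t' a≢b (s , Cs , st) a∈ b∈ (s' , Cs' , st') a∈' b∈' →
        same-trans (same-sym st) (same-trans
          (unique a≢b Cs (proj₂ (st a) a∈) (proj₂ (st b) b∈) Cs' (proj₂ (st' a) a∈') (proj₂ (st' b) b∈')) st')

  sts-exists : IsSTS C → ∀ {a b} → a ≢ b → ∃ λ s → C s × a ∈ₜ s × b ∈ₜ s
  sts-exists (_ , exists , _) {a} {b} a≢b =
    let t , (s , Cs , st) , a∈ , b∈ = exists a b a≢b in s , Cs , proj₂ (st a) a∈ , proj₂ (st b) b∈

  sts-unique : IsSTS C → ∀ {a b s s'} → a ≢ b → s ∈ᵇ C → a ∈ₜ s → b ∈ₜ s → s' ∈ᵇ C → a ∈ₜ s' → b ∈ₜ s' → SameSet s s'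
  sts-unique (_ , _ , unique) {a} {b} {s} {s'} = unique a b s s'

  parallel-intro : AllProper C
    → (∀ a → ∃ λ s → C s × a ∈ₜ s)
    → (∀ {a s s'} → C s → a ∈ₜ s → C s' → a ∈ₜ s' → SameSet s s')
    → IsParallelClass C
  parallel-intro proper exists unique = proper
    , (λ a → let s , Cs , a∈ = exists a in s , (s , Cs , same-refl) , a∈)
    , λ a t t' (s , Cs , st) a∈ (s' , Cs' , st') a∈' →
        same-trans (same-sym st) (same-trans (unique Cs (proj₂ (st a) a∈) Cs' (proj₂ (st' a) a∈')) st')

  parallel-exists : IsParallelClass C → ∀ a → ∃ λ s → C s × a ∈ₜ s
  parallel-exists (_ , exists , _) a = let t , (s , Cs , st) , a∈ = exists a in s , Cs , proj₂ (st a) a∈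

  parallel-unique : IsParallelClass C → ∀ {a s s'} → s ∈ᵇ C → a ∈ₜ s → s' ∈ᵇ C → a ∈ₜ s' → SameSet s s'
  parallel-unique (_ , _ , unique) {a} {s} {s'} = unique a s s'

  ∈ᵇ-refl : ∀ {s} → C s → s ∈ᵇ C
  ∈ᵇ-refl {s} Cs = s , Cs , same-refl

  ∈ᵇ-resp : ∀ {s s'} → SameSet s s' → s ∈ᵇ C → s' ∈ᵇ C
  ∈ᵇ-resp ss' (r , Cr , rs) = r , Cr , same-trans rs ss'

-- Arithmetic in the finite field

module Field {q : ℕ} (𝔽 : FiniteField q) where
  open FiniteField 𝔽 renaming (_+_ to infixl 6 _+_; _*_ to infixl 7 _*_; -_ to infix 8 -_)

  commutativeRing : CommutativeRing 0ℓ 0ℓ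
  commutativeRing = record { isCommutativeRing = isCommutativeRing }

  open CommutativeRing commutativeRing using
    (semiring; ring; +-comm; +-assoc; +-identityˡ; +-identityʳ; -‿inverseʳ; *-identityˡ; zeroʳ)
  open Algebra.Properties.Semiring.Mult.TCOptimised semiring using (1+×; ×-homo-+; ×1-homo-*) renaming (_×_ to _×ₙ_)
  open Algebra.Properties.Ring ring using (-‿distribˡ-*; -‿distribʳ-*; -‿involutive; -‿+-comm; -0#≈0#)

  almostCommutativeRing : AlmostCommutativeRing 0ℓ 0ℓ
  almostCommutativeRing = fromCommutativeRing commutativeRing

  -- Constants of an abstract field do not compute, so the ring solver takes integer coefficients,
  -- whose equality does; this homomorphism interprets them.
  fromℤ : ℤ → Carrier
  fromℤ (ℤ.+ k)    = k ×ₙ 1#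
  fromℤ -[1+ k ] = - (suc k ×ₙ 1#)

  fromℤ-⊖ : ∀ k l → fromℤ (k ℤ.⊖ l) ≡ (k ×ₙ 1#) + (- (l ×ₙ 1#))
  fromℤ-⊖ k       zero    = sym (trans (cong ((k ×ₙ 1#) +_) -0#≈0#) (+-identityʳ _))
  fromℤ-⊖ zero    (suc l) = sym (+-identityˡ _)
  fromℤ-⊖ (suc k) (suc l) = begin
    fromℤ (suc k ℤ.⊖ suc l)                       ≡⟨ cong fromℤ (ℤₚ.[1+m]⊖[1+n]≡m⊖n k l) ⟩
    fromℤ (k ℤ.⊖ l)                               ≡⟨ fromℤ-⊖ k l ⟩
    κ + (- λ')                                  ≡⟨ cong (_+ (- λ')) (sym (+-identityʳ κ)) ⟩
    (κ + 0#) + (- λ')                           ≡⟨ cong (λ z → (κ + z) + (- λ')) (sym (-‿inverseʳ 1#)) ⟩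
    (κ + (1# + (- 1#))) + (- λ')                ≡⟨ cong (_+ (- λ')) (sym (+-assoc κ 1# _)) ⟩
    ((κ + 1#) + (- 1#)) + (- λ')                ≡⟨ +-assoc _ _ _ ⟩
    (κ + 1#) + ((- 1#) + (- λ'))                ≡⟨ cong₂ _+_ (+-comm κ 1#) (-‿+-comm 1# λ') ⟩
    (1# + κ) + (- (1# + λ'))                    ≡⟨ sym (cong₂ (λ x y → x + (- y)) (1+× k 1#) (1+× l 1#)) ⟩
    (suc k ×ₙ 1#) + (- (suc l ×ₙ 1#))           ∎
    where
    open ≡-Reasoning
    κ = k ×ₙ 1#
    λ' = l ×ₙ 1#

  fromℤ-neg : ∀ k → fromℤ (ℤ.- k) ≡ - fromℤ k
  fromℤ-neg (ℤ.+ zero)  = sym -0#≈0#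
  fromℤ-neg (ℤ.+ suc k) = refl
  fromℤ-neg -[1+ k ]  = sym (-‿involutive _)

  fromℤ-+ : ∀ k l → fromℤ (k ℤ.+ l) ≡ fromℤ k + fromℤ l
  fromℤ-+ (ℤ.+ k)    (ℤ.+ l)    = ×-homo-+ 1# k l
  fromℤ-+ (ℤ.+ k)    -[1+ l ] = fromℤ-⊖ k (suc l)
  fromℤ-+ -[1+ k ] (ℤ.+ l)    = trans (fromℤ-⊖ l (suc k)) (+-comm _ _)
  fromℤ-+ -[1+ k ] -[1+ l ] = begin
    - (suc (suc (k +ℕ l)) ×ₙ 1#)                ≡⟨ cong (λ z → - (suc z ×ₙ 1#)) (sym (ℕₚ.+-suc k l)) ⟩
    - ((suc k +ℕ suc l) ×ₙ 1#)                  ≡⟨ cong -_ (×-homo-+ 1# (suc k) (suc l)) ⟩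
    - ((suc k ×ₙ 1#) + (suc l ×ₙ 1#))           ≡⟨ sym (-‿+-comm _ _) ⟩
    (- (suc k ×ₙ 1#)) + (- (suc l ×ₙ 1#))       ∎
    where open ≡-Reasoning

  private
    fromℤ-*⁺ : ∀ k l → fromℤ (ℤ.+ k ℤ.* ℤ.+ l) ≡ fromℤ (ℤ.+ k) * fromℤ (ℤ.+ l)
    fromℤ-*⁺ k l = trans (cong fromℤ (sym (ℤₚ.pos-* k l))) (×1-homo-* k l)

  fromℤ-* : ∀ k l → fromℤ (k ℤ.* l) ≡ fromℤ k * fromℤ l
  fromℤ-* (ℤ.+ k)    (ℤ.+ l)    = fromℤ-*⁺ k l
  fromℤ-* (ℤ.+ k)    -[1+ l ] = begin
    fromℤ (ℤ.+ k ℤ.* -[1+ l ])                    ≡⟨ cong fromℤ (sym (ℤₚ.neg-distribʳ-* (ℤ.+ k) (ℤ.+ suc l))) ⟩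
    fromℤ (ℤ.- (ℤ.+ k ℤ.* ℤ.+ suc l))               ≡⟨ fromℤ-neg (ℤ.+ k ℤ.* ℤ.+ suc l) ⟩
    - fromℤ (ℤ.+ k ℤ.* ℤ.+ suc l)                   ≡⟨ cong -_ (fromℤ-*⁺ k (suc l)) ⟩
    - (fromℤ (ℤ.+ k) * fromℤ (ℤ.+ suc l))           ≡⟨ -‿distribʳ-* _ _ ⟩
    fromℤ (ℤ.+ k) * (- fromℤ (ℤ.+ suc l))           ∎
    where open ≡-Reasoning
  fromℤ-* -[1+ k ] (ℤ.+ l)    = begin
    fromℤ (-[1+ k ] ℤ.* ℤ.+ l)                    ≡⟨ cong fromℤ (sym (ℤₚ.neg-distribˡ-* (ℤ.+ suc k) (ℤ.+ l))) ⟩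
    fromℤ (ℤ.- (ℤ.+ suc k ℤ.* ℤ.+ l))               ≡⟨ fromℤ-neg (ℤ.+ suc k ℤ.* ℤ.+ l) ⟩
    - fromℤ (ℤ.+ suc k ℤ.* ℤ.+ l)                   ≡⟨ cong -_ (fromℤ-*⁺ (suc k) l) ⟩
    - (fromℤ (ℤ.+ suc k) * fromℤ (ℤ.+ l))           ≡⟨ -‿distribˡ-* _ _ ⟩
    (- fromℤ (ℤ.+ suc k)) * fromℤ (ℤ.+ l)           ∎
    where open ≡-Reasoning
  fromℤ-* -[1+ k ] -[1+ l ] = begin
    fromℤ (ℤ.+ suc k ℤ.* ℤ.+ suc l)                 ≡⟨ fromℤ-*⁺ (suc k) (suc l) ⟩
    κ * λ'                                      ≡⟨ sym (-‿involutive _) ⟩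
    - (- (κ * λ'))                              ≡⟨ cong -_ (-‿distribˡ-* κ λ') ⟩
    - ((- κ) * λ')                              ≡⟨ -‿distribʳ-* _ _ ⟩
    (- κ) * (- λ')                              ∎
    where
    open ≡-Reasoning
    κ = suc k ×ₙ 1#
    λ' = suc l ×ₙ 1#

  ℤ-morphism : ℤ.+-*-rawRing -Raw-AlmostCommutative⟶ almostCommutativeRing
  ℤ-morphism = record
    { ⟦_⟧    = fromℤ
    ; +-homo = fromℤ-+
    ; *-homo = fromℤ-*
    ; -‿homo = fromℤ-neg
    ; 0-homo = refl
    ; 1-homo = refl
    }

  module ℤSolver = Algebra.Solver.Ring ℤ.+-*-rawRing almostCommutativeRing ℤ-morphism
    (λ k l → Maybe.map (cong fromℤ) (dec⇒maybe (k ℤₚ.≟ l)))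

  _≟ᶠ_ : DecidableEquality Carrier
  _≟ᶠ_ = via-injection (↔⇒↣ (↔-sym enum)) _≟ᶠⁱⁿ_

  no-zero-divisors : ∀ {x y} → x * y ≡ 0# → x ≢ 0# → y ≡ 0#
  no-zero-divisors {x} {y} xy≡0 x≢0 with inverse x x≢0
  ... | x' , xx'≡1 = begin
    y               ≡⟨ sym (*-identityˡ y) ⟩
    1# * y          ≡⟨ cong (_* y) (sym xx'≡1) ⟩
    (x * x') * y    ≡⟨ ℤSolver.solve 3 (λ x x' y → (x :* x') :* y := x' :* (x :* y)) refl x x' y ⟩
    x' * (x * y)    ≡⟨ cong (x' *_) xy≡0 ⟩
    x' * 0#         ≡⟨ zeroʳ x' ⟩
    0#              ∎
    where open ≡-Reasoning
          open ℤSolver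

  nonzero-* : ∀ {x y} → x ≢ 0# → y ≢ 0# → x * y ≢ 0#
  nonzero-* x≢0 y≢0 xy≡0 = y≢0 (no-zero-divisors xy≡0 x≢0)

  difference-zero : ∀ {x y} → x + (- y) ≡ 0# → x ≡ y
  difference-zero {x} {y} eq = begin
    x                 ≡⟨ solve 2 (λ x y → x := (x :- y) :+ y) refl x y ⟩
    (x + (- y)) + y   ≡⟨ cong (_+ y) eq ⟩
    0# + y            ≡⟨ +-identityˡ y ⟩
    y                 ∎
    where open ≡-Reasoning
          open ℤSolver

  *-cancelˡ : ∀ {x y z} → x ≢ 0# → x * y ≡ x * z → y ≡ z
  *-cancelˡ {x} {y} {z} x≢0 eq = difference-zero (no-zero-divisors (begin
    x * (y + (- z))         ≡⟨ solve 3 (λ x y z → x :* (y :- z) := x :* y :- x :* z) refl x y z ⟩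
    (x * y) + (- (x * z))   ≡⟨ cong (λ s → s + (- (x * z))) eq ⟩
    (x * z) + (- (x * z))   ≡⟨ -‿inverseʳ _ ⟩
    0#                      ∎) x≢0)
    where open ≡-Reasoning
          open ℤSolver

-- Powers of a generator of the multiplicative group

module Generator {t : ℕ} (𝔽 : FiniteField (suc (6 *ℕ t))) (n : ℕ) where
  open FiniteField 𝔽 renaming (_+_ to infixl 6 _+_; _*_ to infixl 7 _*_; -_ to infix 8 -_)
  open Field 𝔽
  open CommutativeRing commutativeRing using
    (-‿inverseʳ; *-assoc; *-comm; *-identityˡ; *-identityʳ; zeroˡ)
  open Algebra.Properties.Ring (CommutativeRing.ring commutativeRing) using (-‿involutive)
  open Construction 𝔽 n using (pow)

  pow-+ : ∀ x k l → pow x (k +ℕ l) ≡ pow x k * pow x l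
  pow-+ x zero    l = sym (*-identityˡ _)
  pow-+ x (suc k) l = trans (cong (x *_) (pow-+ x k l)) (sym (*-assoc _ _ _))

  pow-1 : ∀ k → pow 1# k ≡ 1#
  pow-1 zero    = refl
  pow-1 (suc k) = trans (*-identityˡ _) (pow-1 k)

  pow-* : ∀ x k l → pow x (k *ℕ l) ≡ pow (pow x l) k
  pow-* x zero    l = refl
  pow-* x (suc k) l = trans (pow-+ x l (k *ℕ l)) (cong (pow x l *_) (pow-* x k l))

  pow-% : ∀ {x} d → pow x (suc d) ≡ 1# → ∀ k → pow x k ≡ pow x (k ℕ.% suc d)
  pow-% {x} d x^d≡1 k = begin
    pow x k                                                   ≡⟨ cong (pow x) (ℕ.m≡m%n+[m/n]*n k (suc d)) ⟩
    pow x (k ℕ.% suc d +ℕ k ℕ./ suc d *ℕ suc d)               ≡⟨ pow-+ x (k ℕ.% suc d) _ ⟩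
    pow x (k ℕ.% suc d) * pow x (k ℕ./ suc d *ℕ suc d)        ≡⟨ cong (pow x (k ℕ.% suc d) *_) (pow-* x (k ℕ./ suc d) (suc d)) ⟩
    pow x (k ℕ.% suc d) * pow (pow x (suc d)) (k ℕ./ suc d)   ≡⟨ cong (λ z → pow x (k ℕ.% suc d) * pow z (k ℕ./ suc d)) x^d≡1 ⟩
    pow x (k ℕ.% suc d) * pow 1# (k ℕ./ suc d)                ≡⟨ cong (pow x (k ℕ.% suc d) *_) (pow-1 (k ℕ./ suc d)) ⟩
    pow x (k ℕ.% suc d) * 1#                                  ≡⟨ *-identityʳ _ ⟩
    pow x (k ℕ.% suc d)                                       ∎
    where open ≡-Reasoning

  code : Carrier → Fin (suc (6 *ℕ t))
  code = Inverse.from enum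

  code-injective : ∀ {x y} → code x ≡ code y → x ≡ y
  code-injective = Injection.injective (↔⇒↣ (↔-sym enum))

  -- Deleting the code of zero leaves 6t places; the order of the field is written as a successor so
  -- that `punchOut` applies.
  nonzero-code : ∀ x → x ≢ 0# → Fin (6 *ℕ t)
  nonzero-code x x≢0 = punchOut {i = code 0#} {j = code x} (x≢0 ∘ sym ∘ code-injective)

  nonzero-code-injective : ∀ {x y} x≢0 y≢0 → nonzero-code x x≢0 ≡ nonzero-code y y≢0 → x ≡ y
  nonzero-code-injective x≢0 y≢0 eq =
    code-injective (punchOut-injective (x≢0 ∘ sym ∘ code-injective) (y≢0 ∘ sym ∘ code-injective) eq)

  nonzero : Fin (6 *ℕ t) → Carrier
  nonzero i = Inverse.to enum (punchIn (code 0#) i)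

  nonzero-injective : ∀ {i j} → nonzero i ≡ nonzero j → i ≡ j
  nonzero-injective eq = punchIn-injective (code 0#) _ _ (Injection.injective (↔⇒↣ enum) eq)

  nonzero≢0 : ∀ i → nonzero i ≢ 0#
  nonzero≢0 i eq = punchInᵢ≢i (code 0#) i (begin
    punchIn (code 0#) i       ≡⟨ sym (Inverse.strictlyInverseʳ enum _) ⟩
    code (nonzero i)          ≡⟨ cong code eq ⟩
    code 0#                   ∎)
    where open ≡-Reasoning

  private
    Fin1-prop : ∀ {k} → k ≡ 0 → (i j : Fin (suc k)) → i ≡ j
    Fin1-prop refl 0F 0F = refl

  -- For t = 0 the field would have a single element.
  t≢0 : t ≢ 0
  t≢0 t≡0 = 0≢1 (code-injective (Fin1-prop (cong (6 *ℕ_) t≡0) (code 0#) (code 1#)))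

  instance
    t-nonZero : NonZero t
    t-nonZero = ℕ.≢-nonZero t≢0

  module Powers (g : Carrier) (g-gen : ∀ x → x ≢ 0# → ∃ λ k → x ≡ pow g k) where

    -- The only nonzero power of zero is the empty one, so all nonzero elements would equal 1,
    -- although there are at least six of them.
    g≢0 : g ≢ 0#
    g≢0 g≡0 = ℕₚ.<⇒≱ 1<6t (injective⇒≤ {f = λ (_ : Fin (6 *ℕ t)) → zero {n = 0}}
      λ {i} {j} _ → nonzero-injective (trans (all-one i) (sym (all-one j))))
      where
      1<6t : 1 ℕ.< 6 *ℕ t
      1<6t = ℕₚ.≤-trans (ℕ.s≤s (ℕ.s≤s ℕ.z≤n)) (ℕₚ.*-monoʳ-≤ 6 (ℕ.>-nonZero⁻¹ t))
      all-one : ∀ i → nonzero i ≡ 1#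
      all-one i with g-gen (nonzero i) (nonzero≢0 i)
      ... | zero  , eq = eq
      ... | suc k , eq = contradiction
        (trans eq (trans (cong (_* pow g k) g≡0) (zeroˡ _))) (nonzero≢0 i)

    pow≢0 : ∀ k → pow g k ≢ 0#
    pow≢0 zero    = 0≢1 ∘ sym
    pow≢0 (suc k) = nonzero-* g≢0 (pow≢0 k)

    -- Exponents may be reduced modulo `suc d`, and every nonzero element is a power of `g`; so the
    -- 6t nonzero elements inject into the residues.
    order-bound : ∀ d → pow g (suc d) ≡ 1# → 6 *ℕ t ℕ.≤ suc d
    order-bound d g^d≡1 = injective⇒≤ {f = λ i → fromℕ< (ℕ.m%n<n (log i) (suc d))}
      λ {i} {j} eq → nonzero-injective (begin
        nonzero i                       ≡⟨ proj₂ (g-gen _ (nonzero≢0 i)) ⟩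
        pow g (log i)                   ≡⟨ pow-% d g^d≡1 (log i) ⟩
        pow g (log i ℕ.% suc d)         ≡⟨ cong (pow g) (fromℕ<-injective _ _ (ℕ.m%n<n (log i) (suc d)) (ℕ.m%n<n (log j) (suc d)) eq) ⟩
        pow g (log j ℕ.% suc d)         ≡⟨ sym (pow-% d g^d≡1 (log j)) ⟩
        pow g (log j)                   ≡⟨ sym (proj₂ (g-gen _ (nonzero≢0 j))) ⟩
        nonzero j                       ∎)
      where
      open ≡-Reasoning
      log : Fin (6 *ℕ t) → ℕ
      log i = proj₁ (g-gen (nonzero i) (nonzero≢0 i))

    pow-collision : ∀ {i j} → i ℕ.< j → pow g i ≡ pow g j → ∃ λ d → suc (i +ℕ d) ≡ j × pow g (suc d) ≡ 1#
    pow-collision {i} {j} i<j eq = d , i+d , *-cancelˡ (pow≢0 i) (begin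
      pow g i * pow g (suc d)     ≡⟨ sym (pow-+ g i (suc d)) ⟩
      pow g (i +ℕ suc d)          ≡⟨ cong (pow g) (trans (ℕₚ.+-suc i d) i+d) ⟩
      pow g j                     ≡⟨ sym eq ⟩
      pow g i                     ≡⟨ sym (*-identityʳ _) ⟩
      pow g i * 1#                ∎)
      where
      open ≡-Reasoning
      d = j ℕ.∸ suc i
      i+d : suc (i +ℕ d) ≡ j
      i+d = ℕₚ.m+[n∸m]≡n i<j

    abstract
      -- Two of the 6t + 1 exponents 0, ..., 6t give the same nonzero element, so some positive
      -- exponent up to 6t gives 1, and `order-bound` excludes smaller ones. The successor form
      -- provides a nonzero modulus for `pow-%`.
      order : ∃ λ d → suc d ≡ 6 *ℕ t × pow g (suc d) ≡ 1#
      order =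
        let i , j , i<j , eq = pigeonhole (ℕₚ.n<1+n (6 *ℕ t)) (λ k → nonzero-code (pow g (toℕ k)) (pow≢0 (toℕ k)))
            d , i+d , g^d≡1 = pow-collision i<j (nonzero-code-injective (pow≢0 (toℕ i)) (pow≢0 (toℕ j)) eq)
        in d , ℕₚ.≤-antisym
             (ℕₚ.≤-trans (ℕ.s≤s (ℕₚ.m≤n+m d (toℕ i))) (subst (ℕ._≤ 6 *ℕ t) (sym i+d) (ℕ.s≤s⁻¹ (toℕ<n j))))
             (order-bound d g^d≡1) , g^d≡1

    pow-order : pow g (6 *ℕ t) ≡ 1#
    pow-order = let d , d≡ , g^d≡1 = order in subst (λ k → pow g k ≡ 1#) d≡ g^d≡1

    log : ∀ x → x ≢ 0# → ∃ λ (e : Fin (6 *ℕ t)) → x ≡ pow g (toℕ e)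
    log x x≢0 =
      let (d , d≡ , g^d≡1) = order
          (k , x≡) = g-gen x x≢0
      in fromℕ< (subst (k ℕ.% suc d ℕ.<_) d≡ (ℕ.m%n<n k (suc d))) ,
         trans x≡ (trans (pow-% d g^d≡1 k) (cong (pow g) (sym (toℕ-fromℕ< (subst (k ℕ.% suc d ℕ.<_) d≡ (ℕ.m%n<n k (suc d)))))))

    private
      pow-<-distinct : ∀ {i j} → i ℕ.< j → j ℕ.< 6 *ℕ t → pow g i ≢ pow g j
      pow-<-distinct {i} i<j j<6t eq =
        let d , i+d , g^d≡1 = pow-collision i<j eq
        in ℕₚ.<⇒≱ j<6t (ℕₚ.≤-trans (order-bound d g^d≡1) (subst (suc d ℕ.≤_) i+d (ℕ.s≤s (ℕₚ.m≤n+m d i))))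

    pow-injective : ∀ (i j : Fin (6 *ℕ t)) → pow g (toℕ i) ≡ pow g (toℕ j) → i ≡ j
    pow-injective i j eq with ℕₚ.<-cmp (toℕ i) (toℕ j)
    ... | tri< i<j _ _ = contradiction eq (pow-<-distinct i<j (toℕ<n j))
    ... | tri≈ _ i≡j _ = toℕ-injective i≡j
    ... | tri> _ _ j<i = contradiction (sym eq) (pow-<-distinct j<i (toℕ<n i))

    ζ : Carrier
    ζ = pow g t

    private
      ω : Carrier
      ω = pow g (2 *ℕ t)

    ω≡ζ² : ω ≡ pow ζ 2
    ω≡ζ² = pow-* g 2 t

    pow-k·t≢1 : ∀ k → 0 ℕ.< k → k ℕ.< 6 → pow g (k *ℕ t) ≢ 1#
    pow-k·t≢1 k 0<k k<6 eq = pow-<-distinct {0} {k *ℕ t}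
      (ℕₚ.*-mono-< 0<k (ℕ.>-nonZero⁻¹ t)) (ℕₚ.*-monoˡ-< t k<6) (sym eq)

    private
      h : Carrier
      h = pow g (3 *ℕ t)

    -- Its square is 1 but it is not 1 itself, so in (h - 1)(h + 1) = 0 the second factor vanishes.
    pow-3t≡-1 : pow g (3 *ℕ t) ≡ - 1#
    pow-3t≡-1 = difference-zero (trans (cong (h +_) (-‿involutive 1#)) (no-zero-divisors product h-1≢0))
      where
      open ≡-Reasoning
      open ℤSolver
      h-1≢0 : h + - 1# ≢ 0#
      h-1≢0 = pow-k·t≢1 3 (ℕ.s≤s ℕ.z≤n) (ℕ.s≤s (ℕ.s≤s (ℕ.s≤s (ℕ.s≤s ℕ.z≤n)))) ∘ difference-zero
      h²≡1 : h * h ≡ 1#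
      h²≡1 = trans (sym (pow-+ g (3 *ℕ t) (3 *ℕ t)))
               (trans (cong (pow g) (sym (ℕₚ.*-distribʳ-+ t 3 3))) pow-order)
      product : (h + - 1#) * (h + 1#) ≡ 0#
      product = begin
        (h + - 1#) * (h + 1#)     ≡⟨ solve 1 (λ h → (h :- con ℤ.1ℤ) :* (h :+ con ℤ.1ℤ) := h :* h :- con ℤ.1ℤ) refl h ⟩
        h * h + - 1#              ≡⟨ cong (_+ - 1#) h²≡1 ⟩
        1# + - 1#                 ≡⟨ -‿inverseʳ 1# ⟩
        0#                        ∎

    ζ³≡-1 : pow ζ 3 ≡ - 1#
    ζ³≡-1 = trans (sym (pow-* g 3 t)) pow-3t≡-1

    1≢-1 : 1# ≢ - 1#
    1≢-1 eq = pow-k·t≢1 3 (ℕ.s≤s ℕ.z≤n) (ℕ.s≤s (ℕ.s≤s (ℕ.s≤s (ℕ.s≤s ℕ.z≤n)))) (trans pow-3t≡-1 (sym eq))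

    ω≢1 : ω ≢ 1#
    ω≢1 = pow-k·t≢1 2 (ℕ.s≤s ℕ.z≤n) (ℕ.s≤s (ℕ.s≤s (ℕ.s≤s ℕ.z≤n)))

    -- The cofactor of ω - 1 in ω³ - 1 = 0, where ω ≠ 1.
    1+ω+ω²≡0 : 1# + ω + ω * ω ≡ 0#
    1+ω+ω²≡0 = no-zero-divisors product (ω≢1 ∘ difference-zero)
      where
      open ≡-Reasoning
      open ℤSolver
      ω³≡1 : ω * (ω * (ω * 1#)) ≡ 1#
      ω³≡1 = trans (sym (pow-* g 3 (2 *ℕ t))) (trans (cong (pow g) (sym (ℕₚ.*-assoc 3 2 t))) pow-order)
      product : (ω + - 1#) * (1# + ω + ω * ω) ≡ 0#
      product = begin
        (ω + - 1#) * (1# + ω + ω * ω)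
          ≡⟨ solve 1 (λ w → (w :- con ℤ.1ℤ) :* (con ℤ.1ℤ :+ w :+ w :* w) := w :* (w :* (w :* con ℤ.1ℤ)) :- con ℤ.1ℤ) refl ω ⟩
        ω * (ω * (ω * 1#)) + - 1#  ≡⟨ cong (_+ - 1#) ω³≡1 ⟩
        1# + - 1#                  ≡⟨ -‿inverseʳ 1# ⟩
        0#                         ∎

    -- Since (ω - 1)² = (1 + ω + ω²) - 3ω, characteristic 3 would force ω = 1.
    3≢0 : 1# + 1# + 1# ≢ 0#
    3≢0 3≡0 = ω≢1 (difference-zero (no-zero-divisors square (ω≢1 ∘ difference-zero)))
      where
      open ≡-Reasoning
      open ℤSolver
      square : (ω + - 1#) * (ω + - 1#) ≡ 0#
      square = begin
        (ω + - 1#) * (ω + - 1#)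
          ≡⟨ solve 1 (λ w → let 1' = con ℤ.1ℤ in (w :- 1') :* (w :- 1') := (1' :+ w :+ w :* w) :- (1' :+ 1' :+ 1') :* w) refl ω ⟩
        1# + ω + ω * ω + - ((1# + 1# + 1#) * ω)    ≡⟨ cong₂ (λ x y → x + - (y * ω)) 1+ω+ω²≡0 3≡0 ⟩
        0# + - (0# * ω)                            ≡⟨ solve 1 (λ w → con ℤ.0ℤ :- con ℤ.0ℤ :* w := con ℤ.0ℤ) refl ω ⟩
        0#                                         ∎

    sg : Bool → Carrier
    sg false = 1#
    sg true  = - 1#

    sg-square : ∀ ε → sg ε * sg ε ≡ 1#
    sg-square false = *-identityˡ 1#
    sg-square true  = solve 0 (:- con ℤ.1ℤ :* :- con ℤ.1ℤ := con ℤ.1ℤ) refl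
      where open ℤSolver

    -- The sixth roots of unity ± ωᵏ as powers of ζ = gᵗ, using - 1 = ζ³ and ω = ζ².
    unit : Bool → Fin 3 → Fin 6
    unit false 0F = 0F
    unit false 1F = 2F
    unit false 2F = 4F
    unit true  0F = 3F
    unit true  1F = 5F
    unit true  2F = 1F

    unit⁻¹ : Fin 6 → Bool × Fin 3
    unit⁻¹ 0F = false , 0F
    unit⁻¹ 1F = true  , 2F
    unit⁻¹ 2F = false , 1F
    unit⁻¹ 3F = true  , 0F
    unit⁻¹ 4F = false , 2F
    unit⁻¹ 5F = true  , 1F

    unit⁻¹-unit : ∀ ε k → unit⁻¹ (unit ε k) ≡ (ε , k)
    unit⁻¹-unit false 0F = refl
    unit⁻¹-unit false 1F = refl
    unit⁻¹-unit false 2F = refl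
    unit⁻¹-unit true  0F = refl
    unit⁻¹-unit true  1F = refl
    unit⁻¹-unit true  2F = refl

    unit-unit⁻¹ : ∀ s → unit (proj₁ (unit⁻¹ s)) (proj₂ (unit⁻¹ s)) ≡ s
    unit-unit⁻¹ 0F = refl
    unit-unit⁻¹ 1F = refl
    unit-unit⁻¹ 2F = refl
    unit-unit⁻¹ 3F = refl
    unit-unit⁻¹ 4F = refl
    unit-unit⁻¹ 5F = refl

    pow-ζ-unit : ∀ ε k → pow ζ (toℕ (unit ε k)) ≡ sg ε * pow ω (toℕ k)
    pow-ζ-unit ε k = trans (in-ζ ε k) (cong₂ _*_ (sg-ζ ε) (cong (λ x → pow x (toℕ k)) (sym ω≡ζ²)))
      where
      sg' : Bool → Carrier
      sg' false = 1#
      sg' true  = pow ζ 3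
      sg-ζ : ∀ ε → sg' ε ≡ sg ε
      sg-ζ false = refl
      sg-ζ true  = ζ³≡-1
      ζ⁶≡1 : pow ζ 6 ≡ 1#
      ζ⁶≡1 = trans (sym (pow-* g 6 t)) pow-order
      in-ζ : ∀ ε k → pow ζ (toℕ (unit ε k)) ≡ sg' ε * pow (pow ζ 2) (toℕ k)
      in-ζ false k = trans (exponent k) (trans (pow-* ζ (toℕ k) 2) (sym (*-identityˡ _)))
        where
        exponent : ∀ k → pow ζ (toℕ (unit false k)) ≡ pow ζ (toℕ k *ℕ 2)
        exponent 0F = refl
        exponent 1F = refl
        exponent 2F = refl
      in-ζ true  k = trans (exponent k) (trans (pow-+ ζ 3 (toℕ k *ℕ 2)) (cong (pow ζ 3 *_) (pow-* ζ (toℕ k) 2)))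
        where
        exponent : ∀ k → pow ζ (toℕ (unit true k)) ≡ pow ζ (3 +ℕ toℕ k *ℕ 2)
        exponent 0F = refl
        exponent 1F = refl
        -- The exponent 3 + 4 = 7 is the only one that exceeds 5 and has to be reduced by ζ⁶ = 1.
        exponent 2F = cong (ζ *_) (sym ζ⁶≡1)

    private
      pow-combine : ∀ ε k m → pow g (toℕ (combine {6} {t} (unit ε k) m)) ≡ sg ε * (pow ω (toℕ k) * pow g (toℕ m))
      pow-combine ε k m = begin
        pow g (toℕ (combine {6} {t} s m))             ≡⟨ cong (pow g) (toℕ-combine {6} {t} s m) ⟩
        pow g (t *ℕ toℕ s +ℕ toℕ m)           ≡⟨ pow-+ g (t *ℕ toℕ s) (toℕ m) ⟩
        pow g (t *ℕ toℕ s) * pow g (toℕ m)    ≡⟨ cong (λ e → pow g e * pow g (toℕ m)) (ℕₚ.*-comm t (toℕ s)) ⟩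
        pow g (toℕ s *ℕ t) * pow g (toℕ m)    ≡⟨ cong (_* pow g (toℕ m)) (trans (pow-* g (toℕ s) t) (pow-ζ-unit ε k)) ⟩
        sg ε * pow ω (toℕ k) * pow g (toℕ m)  ≡⟨ *-assoc _ _ _ ⟩
        sg ε * (pow ω (toℕ k) * pow g (toℕ m)) ∎
        where
        open ≡-Reasoning
        s = unit ε k

    -- Divide the exponent of `c` by `t`: the remainder is `m`, and the quotient, being below 6,
    -- names the sixth root of unity ± ωᵏ.
    decompose : ∀ c → c ≢ 0# → ∃ λ ε → ∃ λ (k : Fin 3) → ∃ λ (m : Fin t) → c ≡ sg ε * (pow ω (toℕ k) * pow g (toℕ m))
    decompose c c≢0 with log c c≢0
    ... | e , c≡ = ε , k , m , (begin
        c                                        ≡⟨ c≡ ⟩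
        pow g (toℕ e)                            ≡⟨ cong (pow g ∘ toℕ) (sym (combine-remQuot {6} t e)) ⟩
        pow g (toℕ (combine {6} {t} s m))                ≡⟨ cong (λ s → pow g (toℕ (combine {6} {t} s m))) (sym (unit-unit⁻¹ s)) ⟩
        pow g (toℕ (combine {6} {t} (unit ε k) m))       ≡⟨ pow-combine ε k m ⟩
        sg ε * (pow ω (toℕ k) * pow g (toℕ m))   ∎)
      where
      open ≡-Reasoning
      s = proj₁ (remQuot {6} t e)
      m = proj₂ (remQuot {6} t e)
      ε = proj₁ (unit⁻¹ s)
      k = proj₂ (unit⁻¹ s)

    decompose-unique : ∀ {ε ε'} {k k' : Fin 3} {m m' : Fin t}
      → sg ε * (pow ω (toℕ k) * pow g (toℕ m)) ≡ sg ε' * (pow ω (toℕ k') * pow g (toℕ m'))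
      → ε ≡ ε' × k ≡ k' × m ≡ m'
    decompose-unique {ε} {ε'} {k} {k'} {m} {m'} eq with combine-injective {6} {t} (unit ε k) m (unit ε' k') m'
      (pow-injective _ _ (trans (pow-combine ε k m) (trans eq (sym (pow-combine ε' k' m')))))
    ... | s≡s' , m≡m' with trans (sym (unit⁻¹-unit ε k)) (trans (cong unit⁻¹ s≡s') (unit⁻¹-unit ε' k'))
    ...   | refl = refl , refl , m≡m'

-- Linear identities over ℤ[ω]

module LinearSolver {q : ℕ} (𝔽 : FiniteField q) (n : ℕ)
  (ω : FiniteField.Carrier 𝔽)
  (1+ω+ω²≡0 : FiniteField._+_ 𝔽 (FiniteField._+_ 𝔽 (FiniteField.1# 𝔽) ω) (FiniteField._*_ 𝔽 ω ω) ≡ FiniteField.0# 𝔽) where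
  open FiniteField 𝔽 renaming (_+_ to infixl 6 _+_; _*_ to infixl 7 _*_; -_ to infix 8 -_)
  open Field 𝔽
  open CommutativeRing commutativeRing using (+-identityʳ; +-identityˡ; *-identityˡ; zeroˡ)
  open Construction 𝔽 n using (W; 0v; _⊕_; neg; _•_)

  -- The pair (a, b) stands for a + bω, multiplied by the rule ω² = - 1 - ω. With these coefficients
  -- the relation is built into the normal forms, so identities that hold only because of it are
  -- still proved by computation.
  ℤ[ω] : RawRing 0ℓ 0ℓ
  ℤ[ω] = record
    { Carrier = ℤ × ℤ
    ; _≈_     = _≡_
    ; _+_     = λ (a , b) (c , d) → a ℤ.+ c , b ℤ.+ d
    ; _*_     = λ (a , b) (c , d) → a ℤ.* c ℤ.- b ℤ.* d , a ℤ.* d ℤ.+ b ℤ.* c ℤ.- b ℤ.* d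
    ; -_      = λ (a , b) → ℤ.- a , ℤ.- b
    ; 0#      = ℤ.0ℤ , ℤ.0ℤ
    ; 1#      = ℤ.1ℤ , ℤ.0ℤ
    }

  private module E = RawRing ℤ[ω]

  fromℤ[ω] : ℤ × ℤ → Carrier
  fromℤ[ω] (a , b) = fromℤ a + fromℤ b * ω

  private
    open ℤSolver using (solve; _:=_; _:+_; _:*_; _:-_; :-_; con)

    0+0*ω : ∀ x → x + 0# * ω ≡ x
    0+0*ω x = trans (cong (x +_) (zeroˡ ω)) (+-identityʳ x)

    fromℤ[ω]-+ : ∀ x y → fromℤ[ω] (x E.+ y) ≡ fromℤ[ω] x + fromℤ[ω] y
    fromℤ[ω]-+ (a , b) (c , d) = trans
      (cong₂ (λ x y → x + y * ω) (fromℤ-+ a c) (fromℤ-+ b d))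
      (solve 5 (λ a b c d w → (a :+ c) :+ (b :+ d) :* w := (a :+ b :* w) :+ (c :+ d :* w)) refl
        (fromℤ a) (fromℤ b) (fromℤ c) (fromℤ d) ω)

    fromℤ[ω]-neg : ∀ x → fromℤ[ω] (E.- x) ≡ - fromℤ[ω] x
    fromℤ[ω]-neg (a , b) = trans
      (cong₂ (λ x y → x + y * ω) (fromℤ-neg a) (fromℤ-neg b))
      (solve 3 (λ a b w → (:- a) :+ (:- b) :* w := :- (a :+ b :* w)) refl (fromℤ a) (fromℤ b) ω)

    fromℤ-− : ∀ a b → fromℤ (a ℤ.- b) ≡ fromℤ a + - fromℤ b
    fromℤ-− a b = trans (fromℤ-+ a (ℤ.- b)) (cong (fromℤ a +_) (fromℤ-neg b))

    fromℤ[ω]-* : ∀ x y → fromℤ[ω] (x E.* y) ≡ fromℤ[ω] x * fromℤ[ω] y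
    fromℤ[ω]-* (a , b) (c , d) = begin
      fromℤ (a ℤ.* c ℤ.- b ℤ.* d) + fromℤ (a ℤ.* d ℤ.+ b ℤ.* c ℤ.- b ℤ.* d) * ω
        ≡⟨ cong₂ (λ x y → x + y * ω)
             (trans (fromℤ-− (a ℤ.* c) (b ℤ.* d)) (cong₂ (λ x y → x + - y) (fromℤ-* a c) (fromℤ-* b d)))
             (trans (fromℤ-− (a ℤ.* d ℤ.+ b ℤ.* c) (b ℤ.* d))
               (cong₂ (λ x y → x + - y) (trans (fromℤ-+ (a ℤ.* d) (b ℤ.* c)) (cong₂ _+_ (fromℤ-* a d) (fromℤ-* b c))) (fromℤ-* b d))) ⟩
      (A * C + - (B * D)) + ((A * D + B * C) + - (B * D)) * ω
        -- The reduced product and the ordinary one differ by bd(1 + ω + ω²).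
        ≡⟨ solve 5 (λ a b c d w → (a :* c :- b :* d) :+ (a :* d :+ b :* c :- b :* d) :* w
               := (a :+ b :* w) :* (c :+ d :* w) :- (b :* d) :* (con ℤ.1ℤ :+ w :+ w :* w)) refl A B C D ω ⟩
      (A + B * ω) * (C + D * ω) + - ((B * D) * (1# + ω + ω * ω))
        ≡⟨ cong (λ z → (A + B * ω) * (C + D * ω) + - ((B * D) * z)) 1+ω+ω²≡0 ⟩
      (A + B * ω) * (C + D * ω) + - ((B * D) * 0#)
        ≡⟨ solve 2 (λ x y → x :- y :* con ℤ.0ℤ := x) refl _ (B * D) ⟩
      (A + B * ω) * (C + D * ω) ∎
      where
      open ≡-Reasoning
      A = fromℤ a
      B = fromℤ b
      C = fromℤ c
      D = fromℤ d

    morphism : ℤ[ω] -Raw-AlmostCommutative⟶ almostCommutativeRing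
    morphism = record
      { ⟦_⟧    = fromℤ[ω]
      ; +-homo = fromℤ[ω]-+
      ; *-homo = fromℤ[ω]-*
      ; -‿homo = fromℤ[ω]-neg
      ; 0-homo = 0+0*ω 0#
      ; 1-homo = 0+0*ω 1#
      }

  module Poly = Algebra.Solver.Ring ℤ[ω] almostCommutativeRing morphism
    (λ x y → Maybe.map (cong fromℤ[ω]) (dec⇒maybe (Productₚ.≡-dec ℤₚ._≟_ ℤₚ._≟_ x y)))

  infixl 6 _⊞_ _⊟_ _⊞ᵥ_ _⊟ᵥ_
  infixl 7 _⊠_
  infixr 7 _⊡_
  infix  8 ⊟_ ⊟ᵥ_
  infix  4 _⊜_

  -- Vector identities are checked in every coordinate, as identities of polynomials over ℤ[ω] = ℤ[X]/(1 + X + X²).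
  data Scalar (m : ℕ) : Set where
    var     : Fin m → Scalar m
    0ₛ 1ₛ ωₛ : Scalar m
    _⊞_ _⊠_ : Scalar m → Scalar m → Scalar m
    ⊟_      : Scalar m → Scalar m

  data Vector (m k : ℕ) : Set where
    varᵥ : Fin k → Vector m k
    0ᵥ   : Vector m k
    _⊞ᵥ_ : Vector m k → Vector m k → Vector m k
    _⊡_  : Scalar m → Vector m k → Vector m k
    ⊟ᵥ_  : Vector m k → Vector m k

  pattern _⊟_ x y = x ⊞ (⊟ y)
  pattern _⊟ᵥ_ x y = x ⊞ᵥ (⊟ᵥ y)

  record Equation (A : Set) : Set where
    constructor _⊜_
    field lhs rhs : A
  open Equation

  ⟦_⟧ₛ : ∀ {m} → Scalar m → Vec Carrier m → Carrier
  ⟦ var i ⟧ₛ ρ = lookup ρ i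
  ⟦ 0ₛ ⟧ₛ    ρ = 0#
  ⟦ 1ₛ ⟧ₛ    ρ = 1#
  ⟦ ωₛ ⟧ₛ    ρ = ω
  ⟦ x ⊞ y ⟧ₛ ρ = ⟦ x ⟧ₛ ρ + ⟦ y ⟧ₛ ρ
  ⟦ x ⊠ y ⟧ₛ ρ = ⟦ x ⟧ₛ ρ * ⟦ y ⟧ₛ ρ
  ⟦ ⊟ x ⟧ₛ   ρ = - ⟦ x ⟧ₛ ρ

  ⟦_⟧ᵥ : ∀ {m k} → Vector m k → Vec Carrier m → Vec W k → W
  ⟦ varᵥ i ⟧ᵥ ρ σ = lookup σ i
  ⟦ 0ᵥ ⟧ᵥ     ρ σ = 0v
  ⟦ x ⊞ᵥ y ⟧ᵥ ρ σ = ⟦ x ⟧ᵥ ρ σ ⊕ ⟦ y ⟧ᵥ ρ σ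
  ⟦ c ⊡ x ⟧ᵥ  ρ σ = ⟦ c ⟧ₛ ρ • ⟦ x ⟧ᵥ ρ σ
  ⟦ ⊟ᵥ x ⟧ᵥ   ρ σ = neg (⟦ x ⟧ᵥ ρ σ)

  private
    toPolyₛ : ∀ {m} k → Scalar m → Poly.Polynomial (m +ℕ k)
    toPolyₛ k (var i) = Poly.var (i ↑ˡ k)
    toPolyₛ k 0ₛ      = Poly.con E.0#
    toPolyₛ k 1ₛ      = Poly.con E.1#
    toPolyₛ k ωₛ      = Poly.con (ℤ.0ℤ , ℤ.1ℤ)
    toPolyₛ k (x ⊞ y) = toPolyₛ k x Poly.:+ toPolyₛ k y
    toPolyₛ k (x ⊠ y) = toPolyₛ k x Poly.:* toPolyₛ k y
    toPolyₛ k (⊟ x)   = Poly.:- toPolyₛ k x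

    -- A vector variable becomes a scalar variable for its value at the coordinate under
    -- consideration; these follow the `m` scalar variables in the environment.
    toPolyᵥ : ∀ {m k} → Vector m k → Poly.Polynomial (m +ℕ k)
    toPolyᵥ {m} (varᵥ i) = Poly.var (m ↑ʳ i)
    toPolyᵥ 0ᵥ       = Poly.con E.0#
    toPolyᵥ (x ⊞ᵥ y) = toPolyᵥ x Poly.:+ toPolyᵥ y
    toPolyᵥ {k = k} (c ⊡ x) = toPolyₛ k c Poly.:* toPolyᵥ x
    toPolyᵥ (⊟ᵥ x)   = Poly.:- toPolyᵥ x

    toPolyₛ-correct : ∀ {m k} (x : Scalar m) (ρ : Vec Carrier m) (τ : Vec Carrier k)
      → Poly.⟦ toPolyₛ k x ⟧ (ρ ++ τ) ≡ ⟦ x ⟧ₛ ρ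
    toPolyₛ-correct (var i) ρ τ = lookup-++ˡ ρ τ i
    toPolyₛ-correct 0ₛ      ρ τ = 0+0*ω 0#
    toPolyₛ-correct 1ₛ      ρ τ = 0+0*ω 1#
    toPolyₛ-correct ωₛ      ρ τ = trans (+-identityˡ _) (*-identityˡ ω)
    toPolyₛ-correct (x ⊞ y) ρ τ = cong₂ _+_ (toPolyₛ-correct x ρ τ) (toPolyₛ-correct y ρ τ)
    toPolyₛ-correct (x ⊠ y) ρ τ = cong₂ _*_ (toPolyₛ-correct x ρ τ) (toPolyₛ-correct y ρ τ)
    toPolyₛ-correct (⊟ x)   ρ τ = cong -_ (toPolyₛ-correct x ρ τ)

    toPolyᵥ-correct : ∀ {m k} (x : Vector m k) ρ σ i
      → Poly.⟦ toPolyᵥ x ⟧ (ρ ++ map (λ v → lookup v i) σ) ≡ lookup (⟦ x ⟧ᵥ ρ σ) i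
    toPolyᵥ-correct (varᵥ j) ρ σ i = trans (lookup-++ʳ ρ _ j) (lookup-map j _ σ)
    toPolyᵥ-correct 0ᵥ       ρ σ i = trans (0+0*ω 0#) (sym (lookup-replicate i 0#))
    toPolyᵥ-correct (x ⊞ᵥ y) ρ σ i = trans
      (cong₂ _+_ (toPolyᵥ-correct x ρ σ i) (toPolyᵥ-correct y ρ σ i)) (sym (lookup-zipWith _+_ i (⟦ x ⟧ᵥ ρ σ) (⟦ y ⟧ᵥ ρ σ)))
    toPolyᵥ-correct (c ⊡ x)  ρ σ i = trans
      (cong₂ _*_ (toPolyₛ-correct c ρ _) (toPolyᵥ-correct x ρ σ i)) (sym (lookup-map i (⟦ c ⟧ₛ ρ *_) (⟦ x ⟧ᵥ ρ σ)))
    toPolyᵥ-correct (⊟ᵥ x)   ρ σ i = trans (cong -_ (toPolyᵥ-correct x ρ σ i)) (sym (lookup-map i -_ (⟦ x ⟧ᵥ ρ σ)))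

    -- A Boolean test, so that `refl` discharges each use of the solver: coefficients and normal
    -- forms are concrete data even though the field is abstract.
    sameNormalForm : ∀ {m} → Poly.Polynomial m → Poly.Polynomial m → Bool
    sameNormalForm p p' = is-just (Poly.normalise p Poly.≟N Poly.normalise p')

    normal-form : ∀ {m} (p p' : Poly.Polynomial m) ρ → sameNormalForm p p' ≡ true → Poly.⟦ p ⟧ ρ ≡ Poly.⟦ p' ⟧ ρ
    normal-form p p' ρ eq with Poly.normalise p Poly.≟N Poly.normalise p'
    ... | just p≈p' = trans (sym (Poly.correct p ρ)) (trans (Poly.⟦ p≈p' ⟧N-cong ρ) (Poly.correct p' ρ))

    lookup-ext : {x y : W} → (∀ i → lookup x i ≡ lookup y i) → x ≡ y
    lookup-ext {x} {y} eq = trans (sym (tabulate∘lookup x)) (trans (tabulate-cong eq) (tabulate∘lookup y))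

  scalarEquation : ∀ {m} → N-ary m (Scalar m) (Equation (Scalar m)) → Equation (Scalar m)
  scalarEquation {m} f = _$ⁿ_ {n = m} f (tabulate var)

  vectorEquation : ∀ {m k} → N-ary m (Scalar m) (N-ary k (Vector m k) (Equation (Vector m k))) → Equation (Vector m k)
  vectorEquation {m} {k} f = _$ⁿ_ {n = k} (_$ⁿ_ {n = m} f (tabulate var)) (tabulate varᵥ)

  ssolve : ∀ {m} (ρ : Vec Carrier m) (f : N-ary m (Scalar m) (Equation (Scalar m)))
    → (let e = scalarEquation {m} f)
    → sameNormalForm (toPolyₛ 0 (lhs e)) (toPolyₛ 0 (rhs e)) ≡ true
    → ⟦ lhs e ⟧ₛ ρ ≡ ⟦ rhs e ⟧ₛ ρ
  ssolve {m} ρ f eq = trans (sym (toPolyₛ-correct (lhs e) ρ []))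
    (trans (normal-form (toPolyₛ 0 (lhs e)) (toPolyₛ 0 (rhs e)) (ρ ++ []) eq) (toPolyₛ-correct (rhs e) ρ []))
    where e = scalarEquation {m} f

  vsolve : ∀ {m k} (ρ : Vec Carrier m) (σ : Vec W k)
    (f : N-ary m (Scalar m) (N-ary k (Vector m k) (Equation (Vector m k))))
    → (let e = vectorEquation {m} {k} f)
    → sameNormalForm (toPolyᵥ (lhs e)) (toPolyᵥ (rhs e)) ≡ true
    → ⟦ lhs e ⟧ᵥ ρ σ ≡ ⟦ rhs e ⟧ᵥ ρ σ
  vsolve {m} {k} ρ σ f eq = lookup-ext λ i → trans (sym (toPolyᵥ-correct (lhs e) ρ σ i))
    (trans (normal-form (toPolyᵥ (lhs e)) (toPolyᵥ (rhs e)) (ρ ++ map (λ v → lookup v i) σ) eq)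
      (toPolyᵥ-correct (rhs e) ρ σ i))
    where e = vectorEquation {m} {k} f

-- Vectors, independence and collinearity

module LargeSet {t : ℕ} (𝔽 : FiniteField (suc (6 *ℕ t))) (n : ℕ) (D : Construction.ConstructionData 𝔽 n t) where
  open FiniteField 𝔽 using (Carrier; 0#; 1#; 0≢1; inverse; enum) renaming (_+_ to infixl 6 _+_; _*_ to infixl 7 _*_; -_ to infix 8 -_)
  open Field 𝔽
  open CommutativeRing commutativeRing using (-‿inverseʳ; *-comm; *-identityˡ; zeroˡ; zeroʳ)
  open Construction 𝔽 n using (pow; W; 0v; _⊕_; _⊖_; neg; _•_; InSpan1; InSpan2; Independent; SameSpan; extPt; Idx; BClass; B; IsLKTS)
  open Construction.ConstructionData D
  open Generator.Powers {t} 𝔽 n g g-gen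

  ω : Carrier
  ω = Construction.ω 𝔽 n D

  T : W → W → Tri W
  T = Construction.T 𝔽 n D

  P : W → Carrier → Coll W
  P = Construction.P 𝔽 n D

  open LinearSolver 𝔽 n ω 1+ω+ω²≡0

  2≢0 : 1# + 1# ≢ 0#
  2≢0 2≡0 = 1≢-1 (difference-zero (trans (ssolve [] (1ₛ ⊟ (⊟ 1ₛ) ⊜ 1ₛ ⊞ 1ₛ) refl) 2≡0))

  -1≢0 : - 1# ≢ 0#
  -1≢0 eq = 0≢1 (trans (sym (ssolve [] (⊟ 0ₛ ⊜ 0ₛ) refl)) (trans (cong -_ (sym eq)) (ssolve [] (⊟ ⊟ 1ₛ ⊜ 1ₛ) refl)))

  ω²≢ω : ω * ω + - ω ≢ 0#
  ω²≢ω eq = nonzero-* (pow≢0 (2 *ℕ t)) (ω≢1 ∘ difference-zero)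
    (trans (ssolve [] (ωₛ ⊠ (ωₛ ⊟ 1ₛ) ⊜ ωₛ ⊠ ωₛ ⊟ ωₛ) refl) eq)

  -- Negation modulo 3, the exponent of the inverse cube root of unity.
  inv₃ : Fin 3 → Fin 3
  inv₃ 0F = 0F
  inv₃ 1F = 2F
  inv₃ 2F = 1F

  inv₃-involutive : ∀ k → inv₃ (inv₃ k) ≡ k
  inv₃-involutive 0F = refl
  inv₃-involutive 1F = refl
  inv₃-involutive 2F = refl

  -- The trailing `1ₛ` mirrors the unfolding of `pow`, so that for each concrete exponent the
  -- interpretation is `ω^ k` definitionally.
  ωₛ^ : ∀ {m} → Fin 3 → Scalar m
  ωₛ^ 0F = 1ₛ
  ωₛ^ 1F = ωₛ ⊠ 1ₛ
  ωₛ^ 2F = ωₛ ⊠ (ωₛ ⊠ 1ₛ)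

  ω^_ : Fin 3 → Carrier
  ω^ k = pow ω (toℕ k)

  ω^-inverse : ∀ k → ω^ k * ω^ inv₃ k ≡ 1#
  ω^-inverse 0F = ssolve [] (ωₛ^ 0F ⊠ ωₛ^ 0F ⊜ 1ₛ) refl
  ω^-inverse 1F = ssolve [] (ωₛ^ 1F ⊠ ωₛ^ 2F ⊜ 1ₛ) refl
  ω^-inverse 2F = ssolve [] (ωₛ^ 2F ⊠ ωₛ^ 1F ⊜ 1ₛ) refl

  unit≢0 : ∀ {x y} → x * y ≡ 1# → x ≢ 0#
  unit≢0 {x} {y} xy≡1 x≡0 = 0≢1 (trans (sym (zeroˡ y)) (trans (cong (_* y) (sym x≡0)) xy≡1))

  ω^≢0 : ∀ k → ω^ k ≢ 0#
  ω^≢0 k = unit≢0 (ω^-inverse k)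

  1• : ∀ x → 1# • x ≡ x
  1• x = vsolve [] (x ∷ []) (λ x → 1ₛ ⊡ x ⊜ x) refl

  0• : ∀ x → 0# • x ≡ 0v
  0• x = vsolve [] (x ∷ []) (λ x → 0ₛ ⊡ x ⊜ 0ᵥ) refl

  scale-one : ∀ {c} → c ≡ 1# → ∀ x → c • x ≡ x
  scale-one c≡1 x = trans (cong (_• x) c≡1) (1• x)

  •-≡0 : ∀ {c x} → c ≢ 0# → c • x ≡ 0v → x ≡ 0v
  •-≡0 {c} {x} c≢0 eq with inverse c c≢0
  ... | c' , cc'≡1 = trans (sym (scale-one cc'≡1 x))
    (trans (vsolve (c ∷ c' ∷ []) (x ∷ []) (λ c c' x → (c ⊠ c') ⊡ x ⊜ c' ⊡ c ⊡ x) refl)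
      (trans (cong (c' •_) eq) (vsolve (c' ∷ []) [] (λ c → c ⊡ 0ᵥ ⊜ 0ᵥ) refl)))

  ⊖-≡0 : ∀ {x y} → x ⊖ y ≡ 0v → x ≡ y
  ⊖-≡0 {x} {y} eq = trans (vsolve [] (x ∷ y ∷ []) (λ x y → x ⊜ (x ⊟ᵥ y) ⊞ᵥ y) refl)
    (trans (cong (_⊕ y) eq) (vsolve [] (y ∷ []) (λ y → 0ᵥ ⊞ᵥ y ⊜ y) refl))

  •-cancelˡ : ∀ {c x y} → c ≢ 0# → c • x ≡ c • y → x ≡ y
  •-cancelˡ {c} {x} {y} c≢0 eq = ⊖-≡0 (•-≡0 c≢0
    (trans (vsolve (c ∷ []) (x ∷ y ∷ []) (λ c x y → c ⊡ (x ⊟ᵥ y) ⊜ c ⊡ x ⊟ᵥ c ⊡ y) refl)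
      (trans (cong (_⊖ c • y) eq) (vsolve (c ∷ []) (y ∷ []) (λ c y → c ⊡ y ⊟ᵥ c ⊡ y ⊜ 0ᵥ) refl))))

  •-cancelʳ : ∀ {c d x} → x ≢ 0v → c • x ≡ d • x → c ≡ d
  •-cancelʳ {c} {d} {x} x≢0 eq with c ≟ᶠ d
  ... | yes c≡d = c≡d
  ... | no  c≢d = contradiction (•-≡0 (c≢d ∘ difference-zero)
    (trans (vsolve (c ∷ d ∷ []) (x ∷ []) (λ c d x → (c ⊟ d) ⊡ x ⊜ c ⊡ x ⊟ᵥ d ⊡ x) refl)
      (trans (cong (_⊖ d • x) eq) (vsolve (d ∷ []) (x ∷ []) (λ d x → d ⊡ x ⊟ᵥ d ⊡ x ⊜ 0ᵥ) refl)))) x≢0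

  independent-≢0 : ∀ {x y} → Independent x y → x ≢ 0v
  independent-≢0 {y = y} ind refl = 0≢1 (sym (proj₁ (ind 1# 0# (vsolve [] (y ∷ []) (λ y → 1ₛ ⊡ 0ᵥ ⊞ᵥ 0ₛ ⊡ y ⊜ 0ᵥ) refl))))

  -- Cramer's rule: a vanishing combination of x' and y' has vanishing coefficients over x and y,
  -- and the adjugate matrix turns these into det · σ and det · τ.
  independent-det : ∀ {x y x' y'} α β γ δ → Independent x y → α * δ + - (β * γ) ≢ 0#
    → x' ≡ α • x ⊕ β • y → y' ≡ γ • x ⊕ δ • y → Independent x' y'
  independent-det {x} {y} α β γ δ ind det≢0 refl refl σ τ eq =
      no-zero-divisors (trans
        (ssolve (α ∷ β ∷ γ ∷ δ ∷ σ ∷ τ ∷ []) (λ α β γ δ σ τ →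
          (α ⊠ δ ⊟ β ⊠ γ) ⊠ σ ⊜ δ ⊠ (σ ⊠ α ⊞ τ ⊠ γ) ⊟ γ ⊠ (σ ⊠ β ⊞ τ ⊠ δ)) refl)
        (trans (cong₂ (λ a b → δ * a + - (γ * b)) (proj₁ both) (proj₂ both))
          (ssolve (γ ∷ δ ∷ []) (λ γ δ → δ ⊠ 0ₛ ⊟ γ ⊠ 0ₛ ⊜ 0ₛ) refl))) det≢0
    , no-zero-divisors (trans
        (ssolve (α ∷ β ∷ γ ∷ δ ∷ σ ∷ τ ∷ []) (λ α β γ δ σ τ →
          (α ⊠ δ ⊟ β ⊠ γ) ⊠ τ ⊜ α ⊠ (σ ⊠ β ⊞ τ ⊠ δ) ⊟ β ⊠ (σ ⊠ α ⊞ τ ⊠ γ)) refl)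
        (trans (cong₂ (λ a b → α * a + - (β * b)) (proj₂ both) (proj₁ both))
          (ssolve (α ∷ β ∷ []) (λ α β → α ⊠ 0ₛ ⊟ β ⊠ 0ₛ ⊜ 0ₛ) refl))) det≢0
    where
    both : σ * α + τ * γ ≡ 0# × σ * β + τ * δ ≡ 0#
    both = ind (σ * α + τ * γ) (σ * β + τ * δ)
      (trans (vsolve (α ∷ β ∷ γ ∷ δ ∷ σ ∷ τ ∷ []) (x ∷ y ∷ []) (λ α β γ δ σ τ x y →
        (σ ⊠ α ⊞ τ ⊠ γ) ⊡ x ⊞ᵥ (σ ⊠ β ⊞ τ ⊠ δ) ⊡ y ⊜ σ ⊡ (α ⊡ x ⊞ᵥ β ⊡ y) ⊞ᵥ τ ⊡ (γ ⊡ x ⊞ᵥ δ ⊡ y)) refl) eq)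

  -- For x = cw and y = dw the relation dx - cy = 0 gives c = 0, hence x = 0.
  independent⇒not-collinear : ∀ {w x y} → Independent x y → InSpan1 w x → InSpan1 w y → ⊥
  independent⇒not-collinear {w} ind (c , refl) (d , refl) = independent-≢0 ind (trans (cong (_• w) c≡0) (0• w))
    where
    -c≡0 : - c ≡ 0#
    -c≡0 = proj₂ (ind d (- c) (vsolve (c ∷ d ∷ []) (w ∷ []) (λ c d w → d ⊡ c ⊡ w ⊞ᵥ (⊟ c) ⊡ d ⊡ w ⊜ 0ᵥ) refl))
    c≡0 : c ≡ 0#
    c≡0 = trans (ssolve (c ∷ []) (λ c → c ⊜ ⊟ ⊟ c) refl) (trans (cong -_ -c≡0) (ssolve [] (⊟ 0ₛ ⊜ 0ₛ) refl))

  -- Skew-symmetric forms on planes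

  span-comb : ∀ {x y z z'} α β → InSpan2 x y z → InSpan2 x y z' → InSpan2 x y (α • z ⊕ β • z')
  span-comb {x} {y} α β (a , b , refl) (c , d , refl) = α * a + β * c , α * b + β * d ,
    vsolve (α ∷ β ∷ a ∷ b ∷ c ∷ d ∷ []) (x ∷ y ∷ []) (λ α β a b c d x y →
      α ⊡ (a ⊡ x ⊞ᵥ b ⊡ y) ⊞ᵥ β ⊡ (c ⊡ x ⊞ᵥ d ⊡ y) ⊜ (α ⊠ a ⊞ β ⊠ c) ⊡ x ⊞ᵥ (α ⊠ b ⊞ β ⊠ d) ⊡ y) refl

  span-• : ∀ {x y z} c → InSpan2 x y z → InSpan2 x y (c • z)
  span-• {x} {y} {z} c z∈ = subst (InSpan2 x y)
    (vsolve (c ∷ []) (z ∷ []) (λ c z → c ⊡ z ⊞ᵥ 0ₛ ⊡ z ⊜ c ⊡ z) refl) (span-comb c 0# z∈ z∈)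

  span-generators : ∀ {x y} → InSpan2 x y x × InSpan2 x y y
  span-generators {x} {y} =
      (1# , 0# , vsolve [] (x ∷ y ∷ []) (λ x y → x ⊜ 1ₛ ⊡ x ⊞ᵥ 0ₛ ⊡ y) refl)
    , (0# , 1# , vsolve [] (x ∷ y ∷ []) (λ x y → y ⊜ 0ₛ ⊡ x ⊞ᵥ 1ₛ ⊡ y) refl)

  L : Fin M → W → Set
  L l = InSpan2 (b₁ l) (b₂ l)

  f-combˡ : ∀ {l x y z} α β → L l x → L l y → L l z → f l (α • x ⊕ β • y) z ≡ α * f l x z + β * f l y z
  f-combˡ {l} {x} {y} {z} α β x∈ y∈ z∈ = trans
    (f-addˡ l (α • x) (β • y) z (span-• α x∈) (span-• β y∈) z∈)
    (cong₂ _+_ (f-scaleˡ l α x z x∈ z∈) (f-scaleˡ l β y z y∈ z∈))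

  f-combʳ : ∀ {l x y z} α β → L l x → L l y → L l z → f l z (α • x ⊕ β • y) ≡ α * f l z x + β * f l z y
  f-combʳ {l} {x} {y} {z} α β x∈ y∈ z∈ = trans
    (f-addʳ l z (α • x) (β • y) z∈ (span-• α x∈) (span-• β y∈))
    (cong₂ _+_ (f-scaleʳ l α z x z∈ x∈) (f-scaleʳ l β z y z∈ y∈))

  -- Skew symmetry gives 2f(x, x) = 0, and the characteristic is not 2.
  f-alternating : ∀ {l x} → L l x → f l x x ≡ 0#
  f-alternating {l} {x} x∈ = no-zero-divisors (trans
    (ssolve (f l x x ∷ []) (λ a → (1ₛ ⊞ 1ₛ) ⊠ a ⊜ a ⊟ ⊟ a) refl)
    (trans (cong (λ z → f l x x + - z) (sym (f-skew l x x x∈ x∈))) (-‿inverseʳ _))) 2≢0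

  -- On the span of x and y the form is a multiple of the determinant. A change of pair by a matrix
  -- of determinant 1 therefore keeps its value.
  f-det : ∀ {l x y} α β γ δ → L l x → L l y
    → f l (α • x ⊕ β • y) (γ • x ⊕ δ • y) ≡ (α * δ + - (β * γ)) * f l x y
  f-det {l} {x} {y} α β γ δ x∈ y∈ = begin
    f l (α • x ⊕ β • y) (γ • x ⊕ δ • y)
      ≡⟨ f-combˡ α β x∈ y∈ (span-comb γ δ x∈ y∈) ⟩
    α * f l x (γ • x ⊕ δ • y) + β * f l y (γ • x ⊕ δ • y)
      ≡⟨ cong₂ (λ a b → α * a + β * b) (f-combʳ γ δ x∈ y∈ x∈) (f-combʳ γ δ x∈ y∈ y∈) ⟩
    α * (γ * f l x x + δ * f l x y) + β * (γ * f l y x + δ * f l y y)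
      ≡⟨ cong₂ (λ a b → α * (γ * a + δ * f l x y) + β * (γ * f l y x + δ * b)) (f-alternating x∈) (f-alternating y∈) ⟩
    α * (γ * 0# + δ * f l x y) + β * (γ * f l y x + δ * 0#)
      ≡⟨ cong (λ a → α * (γ * 0# + δ * f l x y) + β * (γ * a + δ * 0#)) (f-skew l y x y∈ x∈) ⟩
    α * (γ * 0# + δ * f l x y) + β * (γ * - f l x y + δ * 0#)
      ≡⟨ ssolve (α ∷ β ∷ γ ∷ δ ∷ f l x y ∷ []) (λ α β γ δ c →
           α ⊠ (γ ⊠ 0ₛ ⊞ δ ⊠ c) ⊞ β ⊠ (γ ⊠ (⊟ c) ⊞ δ ⊠ 0ₛ) ⊜ (α ⊠ δ ⊟ β ⊠ γ) ⊠ c) refl ⟩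
    (α * δ + - (β * γ)) * f l x y ∎
    where open ≡-Reasoning

  f-det′ : ∀ {l x y x' y'} α β γ δ → L l x → L l y → x' ≡ α • x ⊕ β • y → y' ≡ γ • x ⊕ δ • y
    → f l x' y' ≡ (α * δ + - (β * γ)) * f l x y
  f-det′ α β γ δ x∈ y∈ refl refl = f-det α β γ δ x∈ y∈

  -- Some value of the form on the plane of x and y is nonzero, and by `f-det` it is a multiple of
  -- f(x, y).
  f-nondegenerate : ∀ {x y} → Independent x y → ∃ λ l → L l x × L l y × f l x y ≢ 0#
  f-nondegenerate {x} {y} ind =
    let l , same = L-cover x y ind
        v , w , v∈ , w∈ , fvw≢0 = f-nonzero l
        α , β , v≡ = proj₁ (same v) v∈
        γ , δ , w≡ = proj₁ (same w) w∈
        x∈ = proj₂ (same x) (proj₁ span-generators)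
        y∈ = proj₂ (same y) (proj₂ span-generators)
    in l , x∈ , y∈ , λ fxy≡0 → fvw≢0
         (trans (f-det′ α β γ δ x∈ y∈ v≡ w≡) (trans (cong ((α * δ + - (β * γ)) *_) fxy≡0) (zeroʳ _)))

  -- Pairing αx + βy with y leaves αf(x, y), and pairing x with it leaves βf(x, y).
  f≢0⇒independent : ∀ {l x y} → L l x → L l y → f l x y ≢ 0# → Independent x y
  f≢0⇒independent {l} {x} {y} x∈ y∈ fxy≢0 α β eq = α≡0 , β≡0
    where
    open ≡-Reasoning
    zero-comb : α • x ⊕ β • y ≡ 0# • x ⊕ 0# • y
    zero-comb = trans eq (vsolve [] (x ∷ y ∷ []) (λ x y → 0ᵥ ⊜ 0ₛ ⊡ x ⊞ᵥ 0ₛ ⊡ y) refl)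
    α≡0 : α ≡ 0#
    α≡0 = no-zero-divisors (begin
      f l x y * α                                   ≡⟨ ssolve (α ∷ β ∷ f l x y ∷ []) (λ α β c → c ⊠ α ⊜ (α ⊠ 1ₛ ⊟ β ⊠ 0ₛ) ⊠ c) refl ⟩
      (α * 1# + - (β * 0#)) * f l x y               ≡⟨ sym (f-det α β 0# 1# x∈ y∈) ⟩
      f l (α • x ⊕ β • y) (0# • x ⊕ 1# • y)         ≡⟨ f-det′ 0# 0# 0# 1# x∈ y∈ zero-comb refl ⟩
      (0# * 1# + - (0# * 0#)) * f l x y             ≡⟨ ssolve (f l x y ∷ []) (λ c → (0ₛ ⊠ 1ₛ ⊟ 0ₛ ⊠ 0ₛ) ⊠ c ⊜ 0ₛ) refl ⟩
      0#                                            ∎) fxy≢0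
    β≡0 : β ≡ 0#
    β≡0 = no-zero-divisors (begin
      f l x y * β                                   ≡⟨ ssolve (α ∷ β ∷ f l x y ∷ []) (λ α β c → c ⊠ β ⊜ (1ₛ ⊠ β ⊟ 0ₛ ⊠ α) ⊠ c) refl ⟩
      (1# * β + - (0# * α)) * f l x y               ≡⟨ sym (f-det 1# 0# α β x∈ y∈) ⟩
      f l (1# • x ⊕ 0# • y) (α • x ⊕ β • y)         ≡⟨ f-det′ 1# 0# 0# 0# x∈ y∈ refl zero-comb ⟩
      (1# * 0# + - (0# * 0#)) * f l x y             ≡⟨ ssolve (f l x y ∷ []) (λ c → (1ₛ ⊠ 0ₛ ⊟ 0ₛ ⊠ 0ₛ) ⊠ c ⊜ 0ₛ) refl ⟩
      0#                                            ∎) fxy≢0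

  span-≡ : ∀ {l x y} → L l x → L l y → f l x y ≢ 0# → SameSpan (b₁ l) (b₂ l) x y
  span-≡ {l} {x} {y} x∈@(α , β , x≡) y∈@(γ , δ , y≡) fxy≢0 z = into , out
    where
    det = α * δ + - (β * γ)
    det≢0 : det ≢ 0#
    det≢0 det≡0 = fxy≢0 (trans (f-det′ α β γ δ (proj₁ span-generators) (proj₂ span-generators) x≡ y≡)
      (trans (cong (_* f l (b₁ l) (b₂ l)) det≡0) (zeroˡ _)))
    into : L l z → InSpan2 x y z
    -- The coefficients of `z` over `x` and `y` by Cramer's rule, with `e` the inverse determinant.
    into (σ , τ , z≡) = let e , det*e≡1 = inverse det det≢0 in e * (σ * δ + - (τ * γ)) , e * (α * τ + - (β * σ)) ,
      trans z≡ (trans (sym (scale-one det*e≡1 _)) (trans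
        (vsolve (α ∷ β ∷ γ ∷ δ ∷ e ∷ σ ∷ τ ∷ []) (b₁ l ∷ b₂ l ∷ []) (λ α β γ δ e σ τ b₁ b₂ →
          ((α ⊠ δ ⊟ β ⊠ γ) ⊠ e) ⊡ (σ ⊡ b₁ ⊞ᵥ τ ⊡ b₂)
          ⊜ (e ⊠ (σ ⊠ δ ⊟ τ ⊠ γ)) ⊡ (α ⊡ b₁ ⊞ᵥ β ⊡ b₂) ⊞ᵥ (e ⊠ (α ⊠ τ ⊟ β ⊠ σ)) ⊡ (γ ⊡ b₁ ⊞ᵥ δ ⊡ b₂)) refl)
        (sym (cong₂ (λ x y → (e * (σ * δ + - (τ * γ))) • x ⊕ (e * (α * τ + - (β * σ))) • y) x≡ y≡))))
    out : InSpan2 x y z → L l z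
    out (σ , τ , refl) = span-comb σ τ x∈ y∈

  -- Both planes are the span of x and y. Nonvanishing of the form replaces independence as
  -- hypothesis, because form values are what the blocks record.
  plane-unique : ∀ {l l' x y} → L l x → L l y → f l x y ≢ 0# → L l' x → L l' y → f l' x y ≢ 0# → l ≡ l'
  plane-unique x∈ y∈ fxy≢0 x∈' y∈' fxy'≢0 = L-distinct _ _ λ z →
      proj₂ (span-≡ x∈' y∈' fxy'≢0 z) ∘ proj₁ (span-≡ x∈ y∈ fxy≢0 z)
    , proj₂ (span-≡ x∈ y∈ fxy≢0 z) ∘ proj₁ (span-≡ x∈' y∈' fxy'≢0 z)

  -- The blocks ± T(u, v)

  ⟨⟩-cong : ∀ {A : Set} {x x' y y' z z' : A} → x ≡ x' → y ≡ y' → z ≡ z' → ⟨ x , y , z ⟩ ≡ ⟨ x' , y' , z' ⟩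
  ⟨⟩-cong refl refl refl = refl

  signed : Bool → Tri W → Tri W
  signed false = id
  signed true  = mapTri neg

  signed-T : ∀ ε x v → signed ε (T x v) ≡ T (sg ε • x) (sg ε • v)
  signed-T false x v = sym (cong₂ T (1• x) (1• v))
  signed-T true  x v = ⟨⟩-cong
    (vsolve [] (x ∷ v ∷ []) (λ x v → ⊟ᵥ (x ⊞ᵥ v) ⊜ (⊟ 1ₛ) ⊡ x ⊞ᵥ (⊟ 1ₛ) ⊡ v) refl)
    (vsolve [] (x ∷ v ∷ []) (λ x v → ⊟ᵥ (ωₛ ⊡ x ⊞ᵥ (ωₛ ⊠ ωₛ) ⊡ v) ⊜ ωₛ ⊡ (⊟ 1ₛ) ⊡ x ⊞ᵥ (ωₛ ⊠ ωₛ) ⊡ (⊟ 1ₛ) ⊡ v) refl)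
    (vsolve [] (x ∷ v ∷ []) (λ x v → ⊟ᵥ ((ωₛ ⊠ ωₛ) ⊡ x ⊞ᵥ ωₛ ⊡ v) ⊜ (ωₛ ⊠ ωₛ) ⊡ (⊟ 1ₛ) ⊡ x ⊞ᵥ ωₛ ⊡ (⊟ 1ₛ) ⊡ v) refl)

  -- A form of `P` adapted to computation: - T(x, v) is T(- x, - v), so a scalar `sg ε` replaces the
  -- case distinction, and `m` has the type that `decompose` delivers.
  record Block (x : W) (c : Carrier) (s : Tri W) : Set where
    field
      l   : Fin M
      ε   : Bool
      v   : W
      m   : Fin t
      x∈  : L l x
      v∈  : L l v
      fxv : f l x v ≡ pow g (toℕ m) * c
      s≡  : s ≡ T (sg ε • x) (sg ε • v)

  P⇒Block : ∀ {x c s} → P x c s → Block x c s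
  P⇒Block {x} {c} (l , x∈ , v , v∈ , m , m<t , fxv , s≡) = record
    { l = l ; ε = sign s≡ ; v = v ; m = fromℕ< m<t ; x∈ = x∈ ; v∈ = v∈
    ; fxv = trans fxv (cong (λ m → pow g m * c) (sym (toℕ-fromℕ< m<t)))
    ; s≡ = eq s≡ }
    where
    sign : ∀ {s} → s ≡ T x v ⊎ s ≡ mapTri neg (T x v) → Bool
    sign (inj₁ _) = false
    sign (inj₂ _) = true
    eq : ∀ {s} (s≡ : s ≡ T x v ⊎ s ≡ mapTri neg (T x v)) → s ≡ T (sg (sign s≡) • x) (sg (sign s≡) • v)
    eq (inj₁ e) = trans e (signed-T false x v)
    eq (inj₂ e) = trans e (signed-T true x v)

  Block⇒P : ∀ {x c s} → Block x c s → P x c s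
  Block⇒P {x} {c} {s} β = l , x∈ , v , v∈ , toℕ m , toℕ<n m , fxv , eq ε (trans s≡ (sym (signed-T ε x v)))
    where
    open Block β
    eq : ∀ ε → s ≡ signed ε (T x v) → s ≡ T x v ⊎ s ≡ mapTri neg (T x v)
    eq false = inj₁
    eq true  = inj₂

  element : Fin 3 → W → W → W
  element 0F x v = x ⊕ v
  element 1F x v = ω • x ⊕ (ω * ω) • v
  element 2F x v = (ω * ω) • x ⊕ ω • v

  ∈T⇒element : ∀ {y x v} → y ∈ₜ T x v → ∃ λ j → y ≡ element j x v
  ∈T⇒element (inj₁ e)        = 0F , e
  ∈T⇒element (inj₂ (inj₁ e)) = 1F , e
  ∈T⇒element (inj₂ (inj₂ e)) = 2F , e

  element∈T : ∀ j {x v} → element j x v ∈ₜ T x v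
  element∈T 0F = in-1
  element∈T 1F = in-2
  element∈T 2F = in-3

  element-comb : ∀ j e x v → element j (e • x) (e • v) ≡ (e * ω^ j) • x ⊕ (e * ω^ inv₃ j) • v
  element-comb 0F e x v = vsolve (e ∷ []) (x ∷ v ∷ []) (λ e x v →
    e ⊡ x ⊞ᵥ e ⊡ v ⊜ (e ⊠ ωₛ^ 0F) ⊡ x ⊞ᵥ (e ⊠ ωₛ^ 0F) ⊡ v) refl
  element-comb 1F e x v = vsolve (e ∷ []) (x ∷ v ∷ []) (λ e x v →
    ωₛ ⊡ e ⊡ x ⊞ᵥ (ωₛ ⊠ ωₛ) ⊡ e ⊡ v ⊜ (e ⊠ ωₛ^ 1F) ⊡ x ⊞ᵥ (e ⊠ ωₛ^ 2F) ⊡ v) refl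
  element-comb 2F e x v = vsolve (e ∷ []) (x ∷ v ∷ []) (λ e x v →
    (ωₛ ⊠ ωₛ) ⊡ e ⊡ x ⊞ᵥ ωₛ ⊡ e ⊡ v ⊜ (e ⊠ ωₛ^ 2F) ⊡ x ⊞ᵥ (e ⊠ ωₛ^ 1F) ⊡ v) refl

  f-element : ∀ {l x v} j e → L l x → L l v → f l x (element j (e • x) (e • v)) ≡ e * (ω^ inv₃ j * f l x v)
  f-element {l} {x} {v} j e x∈ v∈ = trans
    (f-det′ 1# 0# (e * ω^ j) (e * ω^ inv₃ j) x∈ v∈
      (vsolve [] (x ∷ v ∷ []) (λ x v → x ⊜ 1ₛ ⊡ x ⊞ᵥ 0ₛ ⊡ v) refl) (element-comb j e x v))
    (ssolve (e ∷ ω^ j ∷ ω^ inv₃ j ∷ f l x v ∷ []) (λ e a b c →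
      (1ₛ ⊠ (e ⊠ b) ⊟ 0ₛ ⊠ (e ⊠ a)) ⊠ c ⊜ e ⊠ (b ⊠ c)) refl)

  element∈L : ∀ {l x v} j e → L l x → L l v → L l (element j (e • x) (e • v))
  element∈L {l} {x} {v} j e x∈ v∈ = subst (L l) (sym (element-comb j e x v)) (span-comb (e * ω^ j) (e * ω^ inv₃ j) x∈ v∈)

  sg≢0 : ∀ ε → sg ε ≢ 0#
  sg≢0 ε = unit≢0 (sg-square ε)

  -- The solution v of y = ± (ωʲ x + ω²ʲ v).
  T-cofactor : W → Fin 3 → Bool → W → W
  T-cofactor x j ε y = (sg ε * ω^ j) • y ⊖ (ω^ j * ω^ j) • x

  private
    squares : ∀ ε j → (sg ε * sg ε) * (ω^ j * ω^ inv₃ j) ≡ 1#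
    squares ε j = trans (cong₂ _*_ (sg-square ε) (ω^-inverse j)) (*-identityˡ 1#)

  T-cofactor-element : ∀ x v j ε → T-cofactor x j ε (element j (sg ε • x) (sg ε • v)) ≡ v
  T-cofactor-element x v j ε = begin
    (e * a) • element j (e • x) (e • v) ⊖ (a * a) • x
      ≡⟨ cong (λ y → (e * a) • y ⊖ (a * a) • x) (element-comb j e x v) ⟩
    (e * a) • ((e * a) • x ⊕ (e * b) • v) ⊖ (a * a) • x
      ≡⟨ vsolve (e ∷ a ∷ b ∷ []) (x ∷ v ∷ []) (λ e a b x v →
           (e ⊠ a) ⊡ ((e ⊠ a) ⊡ x ⊞ᵥ (e ⊠ b) ⊡ v) ⊟ᵥ (a ⊠ a) ⊡ x
           ⊜ ((e ⊠ e) ⊠ (a ⊠ b)) ⊡ v ⊞ᵥ ((e ⊠ e) ⊠ (a ⊠ a) ⊟ a ⊠ a) ⊡ x) refl ⟩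
    ((e * e) * (a * b)) • v ⊕ ((e * e) * (a * a) + - (a * a)) • x
      ≡⟨ cong₂ (λ p q → p • v ⊕ (q * (a * a) + - (a * a)) • x) (squares ε j) (sg-square ε) ⟩
    1# • v ⊕ (1# * (a * a) + - (a * a)) • x
      ≡⟨ vsolve (a ∷ []) (x ∷ v ∷ []) (λ a x v → 1ₛ ⊡ v ⊞ᵥ (1ₛ ⊠ (a ⊠ a) ⊟ a ⊠ a) ⊡ x ⊜ v) refl ⟩
    v ∎
    where
    open ≡-Reasoning
    e = sg ε
    a = ω^ j
    b = ω^ inv₃ j

  element-T-cofactor : ∀ x y j ε → element j (sg ε • x) (sg ε • T-cofactor x j ε y) ≡ y
  element-T-cofactor x y j ε = begin
    element j (e • x) (e • T-cofactor x j ε y)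
      ≡⟨ element-comb j e x _ ⟩
    (e * a) • x ⊕ (e * b) • ((e * a) • y ⊖ (a * a) • x)
      ≡⟨ vsolve (e ∷ a ∷ b ∷ []) (x ∷ y ∷ []) (λ e a b x y →
           (e ⊠ a) ⊡ x ⊞ᵥ (e ⊠ b) ⊡ ((e ⊠ a) ⊡ y ⊟ᵥ (a ⊠ a) ⊡ x)
           ⊜ ((e ⊠ e) ⊠ (a ⊠ b)) ⊡ y ⊞ᵥ ((e ⊠ a) ⊟ (a ⊠ b) ⊠ (e ⊠ a)) ⊡ x) refl ⟩
    ((e * e) * (a * b)) • y ⊕ ((e * a) + - ((a * b) * (e * a))) • x
      ≡⟨ cong₂ (λ p q → p • y ⊕ ((e * a) + - (q * (e * a))) • x) (squares ε j) (ω^-inverse j) ⟩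
    1# • y ⊕ ((e * a) + - (1# * (e * a))) • x
      ≡⟨ vsolve (e ∷ a ∷ []) (x ∷ y ∷ []) (λ e a x y → 1ₛ ⊡ y ⊞ᵥ (e ⊠ a ⊟ 1ₛ ⊠ (e ⊠ a)) ⊡ x ⊜ y) refl ⟩
    y ∎
    where
    open ≡-Reasoning
    e = sg ε
    a = ω^ j
    b = ω^ inv₃ j

  -- Pairing with x removes the x-component of y = ± (ωʲx + ω⁻ʲv). What remains, divided by `c`, has
  -- the normal form of `decompose`, so the sign and the position j can be read off from f(x, y).
  block-f : ∀ {x c s y} (β : Block x c s) → y ∈ₜ s → let open Block β in
    ∃ λ j → y ≡ element j (sg ε • x) (sg ε • v) × L l y × f l x y ≡ (sg ε * (ω^ inv₃ j * pow g (toℕ m))) * c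
  block-f {x} {c} {s} {y} β y∈ =
    let j , y≡ = ∈T⇒element (subst (y ∈ₜ_) s≡ y∈) in
    j , y≡ , subst (L l) (sym y≡) (element∈L j (sg ε) x∈ v∈) ,
    trans (cong (f l x) y≡) (trans (f-element j (sg ε) x∈ v∈)
      (trans (cong (λ z → sg ε * (ω^ inv₃ j * z)) fxv)
        (ssolve (sg ε ∷ ω^ inv₃ j ∷ pow g (toℕ m) ∷ c ∷ []) (λ e w p c → e ⊠ (w ⊠ (p ⊠ c)) ⊜ (e ⊠ (w ⊠ p)) ⊠ c) refl)))
    where open Block β

  block-f≢0 : ∀ {x c s y} (β : Block x c s) → c ≢ 0# → y ∈ₜ s → L (Block.l β) y × f (Block.l β) x y ≢ 0#
  block-f≢0 β c≢0 y∈ = let j , _ , y∈L , fxy = block-f β y∈ in y∈L , λ fxy≡0 →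
    nonzero-* (nonzero-* (sg≢0 (Block.ε β)) (nonzero-* (ω^≢0 (inv₃ j)) (pow≢0 (toℕ (Block.m β))))) c≢0 (trans (sym fxy) fxy≡0)

  block-independent : ∀ {x c s y} → Block x c s → c ≢ 0# → y ∈ₜ s → Independent x y
  block-independent β c≢0 y∈ = let y∈L , fxy≢0 = block-f≢0 β c≢0 y∈ in f≢0⇒independent (Block.x∈ β) y∈L fxy≢0

  block-unique : ∀ {x c s s' y} → c ≢ 0# → Block x c s → Block x c s' → y ∈ₜ s → y ∈ₜ s' → s ≡ s'
  block-unique {x} {c} {y = y} c≢0 β β' y∈ y∈' = go (plane-unique (Block.x∈ β) y∈L f≢0 (Block.x∈ β') y∈L' f≢0')
    where
    y∈L  = proj₁ (block-f≢0 β c≢0 y∈)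
    f≢0  = proj₂ (block-f≢0 β c≢0 y∈)
    y∈L' = proj₁ (block-f≢0 β' c≢0 y∈')
    f≢0' = proj₂ (block-f≢0 β' c≢0 y∈')
    open Block
    go : l β ≡ l β' → _ ≡ _
    go l≡l' =
      let j  , y≡  , _ , fxy  = block-f β  y∈
          j' , y≡' , _ , fxy' = block-f β' y∈'
          -- The sign and the position of `y` agree in both blocks; `T-cofactor` then recovers the
          -- same `v`.
          ε≡ , k≡ , _ = decompose-unique {ε β} {ε β'} {m = m β} {m β'} (*-cancelˡ c≢0 (trans (*-comm c _) (trans
            (trans (sym fxy) (trans (cong (λ l → f l x y) l≡l') fxy')) (*-comm _ c))))
          j≡ = trans (sym (inv₃-involutive j)) (trans (cong inv₃ k≡) (inv₃-involutive j'))
          v≡ = trans (sym (T-cofactor-element x (v β) j (ε β))) (trans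
                 (cong (T-cofactor x j (ε β)) (trans (sym y≡) y≡'))
                 (trans (cong₂ (λ j ε → T-cofactor x j ε (element j' (sg (Block.ε β') • x) (sg (Block.ε β') • v β'))) j≡ ε≡)
                   (T-cofactor-element x (v β') j' (ε β'))))
      in trans (s≡ β) (trans (cong₂ (λ ε v → T (sg ε • x) (sg ε • v)) ε≡ v≡) (sym (s≡ β')))

  abstract
    block-exists : ∀ {x c y} → c ≢ 0# → Independent x y → ∃ λ s → Block x c s × y ∈ₜ s
    block-exists {x} {c} {y} c≢0 ind =
      let l , x∈ , y∈ , fxy≢0 = f-nondegenerate ind
          c' , cc'≡1 = inverse c c≢0
          c'≢0 = unit≢0 (trans (*-comm c' c) cc'≡1)
          -- The root of unity occurring in f(x, y)/c is ω⁻ʲ, so the position j is the inverse of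
          -- the exponent found here.
          ε , k , m , eq = decompose (f l x y * c') (nonzero-* fxy≢0 c'≢0)
          j = inv₃ k
          e = sg ε
          p = pow g (toℕ m)
          v = T-cofactor x j ε y
          v∈ : L l v
          v∈ = subst (L l) (vsolve (e ∷ ω^ j ∷ []) (x ∷ y ∷ []) (λ e a x y →
                 (e ⊠ a) ⊡ y ⊞ᵥ (⊟ (a ⊠ a)) ⊡ x ⊜ (e ⊠ a) ⊡ y ⊟ᵥ (a ⊠ a) ⊡ x) refl) (span-comb (e * ω^ j) (- (ω^ j * ω^ j)) y∈ x∈)
          fxv : f l x v ≡ p * c
          fxv = begin
            f l x v
              ≡⟨ f-det′ 1# 0# (- (ω^ j * ω^ j)) (e * ω^ j) x∈ y∈
                   (vsolve [] (x ∷ y ∷ []) (λ x v → x ⊜ 1ₛ ⊡ x ⊞ᵥ 0ₛ ⊡ v) refl)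
                   (vsolve (e ∷ ω^ j ∷ []) (x ∷ y ∷ []) (λ e a x y →
                     (e ⊠ a) ⊡ y ⊟ᵥ (a ⊠ a) ⊡ x ⊜ (⊟ (a ⊠ a)) ⊡ x ⊞ᵥ (e ⊠ a) ⊡ y) refl) ⟩
            (1# * (e * ω^ j) + - (0# * - (ω^ j * ω^ j))) * f l x y
              ≡⟨ ssolve (e ∷ ω^ j ∷ f l x y ∷ []) (λ e a z →
                   (1ₛ ⊠ (e ⊠ a) ⊟ 0ₛ ⊠ (⊟ (a ⊠ a))) ⊠ z ⊜ (e ⊠ a) ⊠ (z ⊠ 1ₛ)) refl ⟩
            (e * ω^ j) * (f l x y * 1#)
              ≡⟨ cong (λ z → (e * ω^ j) * (f l x y * z)) (sym cc'≡1) ⟩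
            (e * ω^ j) * (f l x y * (c * c'))
              ≡⟨ ssolve (e ∷ ω^ j ∷ f l x y ∷ c ∷ c' ∷ []) (λ e a z c c' → (e ⊠ a) ⊠ (z ⊠ (c ⊠ c')) ⊜ (e ⊠ a) ⊠ c ⊠ (z ⊠ c')) refl ⟩
            (e * ω^ j) * c * (f l x y * c')
              ≡⟨ cong ((e * ω^ j) * c *_) eq ⟩
            (e * ω^ j) * c * (e * (ω^ k * p))
              ≡⟨ ssolve (e ∷ ω^ j ∷ ω^ k ∷ c ∷ p ∷ []) (λ e a b c p →
                   (e ⊠ a) ⊠ c ⊠ (e ⊠ (b ⊠ p)) ⊜ (e ⊠ e) ⊠ (b ⊠ a) ⊠ (p ⊠ c)) refl ⟩
            (e * e) * (ω^ k * ω^ j) * (p * c)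
              ≡⟨ cong₂ (λ a b → a * b * (p * c)) (sg-square ε) (ω^-inverse k) ⟩
            1# * 1# * (p * c)
              ≡⟨ ssolve (p ∷ c ∷ []) (λ p c → 1ₛ ⊠ 1ₛ ⊠ (p ⊠ c) ⊜ p ⊠ c) refl ⟩
            p * c ∎
      in T (e • x) (e • v)
       , record { l = l ; ε = ε ; v = v ; m = m ; x∈ = x∈ ; v∈ = v∈ ; fxv = fxv ; s≡ = refl }
       , subst (_∈ₜ T (e • x) (e • v)) (element-T-cofactor x y j ε) (element∈T j)
      where open ≡-Reasoning

  -- Zero-sum triples spanning a plane

  Frame : Tri W → Set
  Frame ⟨ x , y , z ⟩ = x ⊕ y ⊕ z ≡ 0v × Independent x y

  frame-third : ∀ {x y z} → x ⊕ y ⊕ z ≡ 0v → z ≡ neg (x ⊕ y)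
  frame-third {x} {y} {z} eq = trans
    (vsolve [] (x ∷ y ∷ z ∷ []) (λ x y z → z ⊜ (x ⊞ᵥ y ⊞ᵥ z) ⊟ᵥ (x ⊞ᵥ y)) refl)
    (trans (cong (_⊖ (x ⊕ y)) eq)
      (vsolve [] (x ∷ y ∷ []) (λ x y → 0ᵥ ⊟ᵥ (x ⊞ᵥ y) ⊜ ⊟ᵥ (x ⊞ᵥ y)) refl))

  frame-sum : ∀ x y → x ⊕ y ⊕ neg (x ⊕ y) ≡ 0v
  frame-sum x y = vsolve [] (x ∷ y ∷ []) (λ x y → x ⊞ᵥ y ⊟ᵥ (x ⊞ᵥ y) ⊜ 0ᵥ) refl

  independent-cycle : ∀ {x y z} → x ⊕ y ⊕ z ≡ 0v → Independent x y → Independent y z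
  independent-cycle {x} {y} {z} sum ind = independent-det 0# 1# (- 1#) (- 1#) ind
    (0≢1 ∘ sym ∘ trans (ssolve [] (1ₛ ⊜ 0ₛ ⊠ (⊟ 1ₛ) ⊟ 1ₛ ⊠ (⊟ 1ₛ)) refl))
    (vsolve [] (x ∷ y ∷ []) (λ x y → y ⊜ 0ₛ ⊡ x ⊞ᵥ 1ₛ ⊡ y) refl)
    (trans (frame-third sum) (vsolve [] (x ∷ y ∷ []) (λ x y → ⊟ᵥ (x ⊞ᵥ y) ⊜ (⊟ 1ₛ) ⊡ x ⊞ᵥ (⊟ 1ₛ) ⊡ y) refl))

  independent-sym : ∀ {x y} → Independent x y → Independent y x
  independent-sym {x} {y} ind = independent-det 0# 1# 1# 0# ind
    (-1≢0 ∘ trans (ssolve [] (⊟ 1ₛ ⊜ 0ₛ ⊠ 0ₛ ⊟ 1ₛ ⊠ 1ₛ) refl))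
    (vsolve [] (x ∷ y ∷ []) (λ x y → y ⊜ 0ₛ ⊡ x ⊞ᵥ 1ₛ ⊡ y) refl)
    (vsolve [] (x ∷ y ∷ []) (λ x y → x ⊜ 1ₛ ⊡ x ⊞ᵥ 0ₛ ⊡ y) refl)

  frame-cycle : ∀ {x y z} → Frame ⟨ x , y , z ⟩ → Frame ⟨ y , z , x ⟩
  frame-cycle {x} {y} {z} (sum , ind) =
    trans (vsolve [] (x ∷ y ∷ z ∷ []) (λ x y z → y ⊞ᵥ z ⊞ᵥ x ⊜ x ⊞ᵥ y ⊞ᵥ z) refl) sum , independent-cycle sum ind

  frame-swap : ∀ {x y z} → Frame ⟨ x , y , z ⟩ → Frame ⟨ y , x , z ⟩
  frame-swap {x} {y} {z} (sum , ind) =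
    trans (vsolve [] (x ∷ y ∷ z ∷ []) (λ x y z → y ⊞ᵥ x ⊞ᵥ z ⊜ x ⊞ᵥ y ⊞ᵥ z) refl) sum , independent-sym ind

  frame-perm : ∀ {s s'} → Perm s s' → Frame s → Frame s'
  frame-perm p123 fr = fr
  frame-perm p231 fr = frame-cycle fr
  frame-perm p312 fr = frame-cycle (frame-cycle fr)
  frame-perm p132 fr = frame-cycle (frame-swap fr)
  frame-perm p213 fr = frame-swap fr
  frame-perm p321 fr = frame-swap (frame-cycle fr)

  independent⇒≢ : ∀ {x y} → Independent x y → x ≢ y
  independent⇒≢ {x} ind refl = 0≢1 (sym (proj₁ (ind 1# (- 1#) (vsolve [] (x ∷ []) (λ x → 1ₛ ⊡ x ⊞ᵥ (⊟ 1ₛ) ⊡ x ⊜ 0ᵥ) refl))))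

  frame-proper : ∀ s → Frame s → Proper s
  frame-proper _ fr =
      independent⇒≢ (proj₂ fr)
    , independent⇒≢ (proj₂ (frame-cycle (frame-cycle fr))) ∘ sym
    , independent⇒≢ (proj₂ (frame-cycle fr))

  T-frame : ∀ {u v} → Independent u v → Frame (T u v)
  T-frame {u} {v} ind =
      vsolve [] (u ∷ v ∷ []) (λ u v → (u ⊞ᵥ v) ⊞ᵥ (ωₛ ⊡ u ⊞ᵥ (ωₛ ⊠ ωₛ) ⊡ v) ⊞ᵥ ((ωₛ ⊠ ωₛ) ⊡ u ⊞ᵥ ωₛ ⊡ v) ⊜ 0ᵥ) refl
    , independent-det 1# 1# ω (ω * ω) ind
        (ω²≢ω ∘ trans (ssolve [] (ωₛ ⊠ ωₛ ⊟ ωₛ ⊜ 1ₛ ⊠ (ωₛ ⊠ ωₛ) ⊟ 1ₛ ⊠ ωₛ) refl))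
        (vsolve [] (u ∷ v ∷ []) (λ u v → u ⊞ᵥ v ⊜ 1ₛ ⊡ u ⊞ᵥ 1ₛ ⊡ v) refl) refl

  block-frame : ∀ {x c s} → c ≢ 0# → Block x c s → Frame s
  block-frame {x} {c} c≢0 β = subst Frame (sym s≡) (T-frame
    (independent-det e 0# 0# e (f≢0⇒independent x∈ v∈ λ fxv≡0 → nonzero-* (pow≢0 (toℕ m)) c≢0 (trans (sym fxv) fxv≡0))
      (0≢1 ∘ sym ∘ trans (sym (trans (ssolve (e ∷ []) (λ e → e ⊠ e ⊟ 0ₛ ⊠ 0ₛ ⊜ e ⊠ e) refl) (sg-square ε))))
      (vsolve (e ∷ []) (x ∷ v ∷ []) (λ e x v → e ⊡ x ⊜ e ⊡ x ⊞ᵥ 0ₛ ⊡ v) refl)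
      (vsolve (e ∷ []) (x ∷ v ∷ []) (λ e x v → e ⊡ v ⊜ 0ₛ ⊡ x ⊞ᵥ e ⊡ v) refl)))
    where
    open Block β
    e = sg ε

  -- The zero sum determines the third point as - (a + b).
  frame-unique : ∀ {s s' a b} → Frame s → Frame s' → a ≢ b → a ∈ₜ s → b ∈ₜ s → a ∈ₜ s' → b ∈ₜ s' → SameSet s s'
  frame-unique {s} {s'} fr fr' a≢b a∈ b∈ a∈' b∈' =
    let c  , π  = third-point s  a≢b a∈ b∈
        c' , π' = third-point s' a≢b a∈' b∈'
        c≡c' = trans (frame-third (proj₁ (frame-perm π fr))) (sym (frame-third (proj₁ (frame-perm π' fr'))))
    in same-trans (perm⇒same π) (subst (λ z → SameSet ⟨ _ , _ , z ⟩ s') (sym c≡c') (same-sym (perm⇒same π')))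

  frame-independent : ∀ {s a b} → Frame s → a ≢ b → a ∈ₜ s → b ∈ₜ s → Independent a b
  frame-independent {s} fr a≢b a∈ b∈ = let c , π = third-point s a≢b a∈ b∈ in proj₂ (frame-perm π fr)

  -- `T` is a Fourier synthesis: multiplying its two coefficients by inverse cube roots of unity
  -- shifts the triple cyclically.
  T-rotate : ∀ k u v → Perm (T u v) (T (ω^ inv₃ k • u) (ω^ k • v))
  T-rotate 0F u v = subst (Perm (T u v)) (sym (cong₂ T (1• u) (1• v))) p123
  T-rotate 1F u v = subst (Perm (T u v)) (⟨⟩-cong
    (vsolve [] (u ∷ v ∷ []) (λ u v → (ωₛ ⊠ ωₛ) ⊡ u ⊞ᵥ ωₛ ⊡ v ⊜ ωₛ^ 2F ⊡ u ⊞ᵥ ωₛ^ 1F ⊡ v) refl)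
    (vsolve [] (u ∷ v ∷ []) (λ u v → u ⊞ᵥ v ⊜ ωₛ ⊡ ωₛ^ 2F ⊡ u ⊞ᵥ (ωₛ ⊠ ωₛ) ⊡ ωₛ^ 1F ⊡ v) refl)
    (vsolve [] (u ∷ v ∷ []) (λ u v → ωₛ ⊡ u ⊞ᵥ (ωₛ ⊠ ωₛ) ⊡ v ⊜ (ωₛ ⊠ ωₛ) ⊡ ωₛ^ 2F ⊡ u ⊞ᵥ ωₛ ⊡ ωₛ^ 1F ⊡ v) refl)) p312
  T-rotate 2F u v = subst (Perm (T u v)) (⟨⟩-cong
    (vsolve [] (u ∷ v ∷ []) (λ u v → ωₛ ⊡ u ⊞ᵥ (ωₛ ⊠ ωₛ) ⊡ v ⊜ ωₛ^ 1F ⊡ u ⊞ᵥ ωₛ^ 2F ⊡ v) refl)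
    (vsolve [] (u ∷ v ∷ []) (λ u v → (ωₛ ⊠ ωₛ) ⊡ u ⊞ᵥ ωₛ ⊡ v ⊜ ωₛ ⊡ ωₛ^ 1F ⊡ u ⊞ᵥ (ωₛ ⊠ ωₛ) ⊡ ωₛ^ 2F ⊡ v) refl)
    (vsolve [] (u ∷ v ∷ []) (λ u v → u ⊞ᵥ v ⊜ (ωₛ ⊠ ωₛ) ⊡ ωₛ^ 1F ⊡ u ⊞ᵥ ωₛ ⊡ ωₛ^ 2F ⊡ v) refl)) p231

  T-swap : ∀ u v → Perm (T u v) (T v u)
  T-swap u v = subst (Perm (T u v)) (⟨⟩-cong
    (vsolve [] (u ∷ v ∷ []) (λ u v → u ⊞ᵥ v ⊜ v ⊞ᵥ u) refl)
    (vsolve [] (u ∷ v ∷ []) (λ u v → (ωₛ ⊠ ωₛ) ⊡ u ⊞ᵥ ωₛ ⊡ v ⊜ ωₛ ⊡ v ⊞ᵥ (ωₛ ⊠ ωₛ) ⊡ u) refl)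
    (vsolve [] (u ∷ v ∷ []) (λ u v → ωₛ ⊡ u ⊞ᵥ (ωₛ ⊠ ωₛ) ⊡ v ⊜ (ωₛ ⊠ ωₛ) ⊡ v ⊞ᵥ ωₛ ⊡ u) refl)) p132

  -- Every zero-sum triple occurs in a class

  generator : Fin N → Fin t → W
  generator i a = pow g (toℕ a) • u i

  CoveredBy : Tri W → Set
  CoveredBy s = ∃ λ i → ∃ λ a → ∃ λ b → ∃ λ s' → Block (generator i a) (ω^ b) s' × SameSet s' s

  -- Write x = ± ωᵏgᵃu_i. Removing the sign and ωᵏ from x and compensating on y is a change of
  -- determinant 1, so the form value, and with it `b` and `m`, survives. The sign becomes the sign
  -- of the block, and the power of ω only rotates the triple.
  T-block : ∀ {l x y} (b : Fin 3) (m : Fin t) → L l x → L l y → f l x y ≡ pow g (toℕ m) * ω^ b → CoveredBy (T x y)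
  T-block {l} {x} {y} b m x∈ y∈ fxy =
    let x≢0 = independent-≢0 (f≢0⇒independent x∈ y∈ λ fxy≡0 →
                nonzero-* (pow≢0 (toℕ m)) (ω^≢0 b) (trans (sym fxy) fxy≡0))
        i , c , x≡ = K-cover x x≢0
        c≢0 = λ c≡0 → x≢0 (trans x≡ (trans (cong (_• u i) c≡0) (0• (u i))))
        ε , k , a , c≡ = decompose c c≢0
        e = sg ε
        p = pow g (toℕ a)
        x' = generator i a
        y' = (e * ω^ k) • y
        x'≡ : x' ≡ (e * ω^ inv₃ k) • x
        x'≡ = begin
          p • u i                                       ≡⟨ sym (1• _) ⟩
          1# • p • u i                                  ≡⟨ cong (_• p • u i) (sym (squares ε k)) ⟩
          ((e * e) * (ω^ k * ω^ inv₃ k)) • p • u i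
            ≡⟨ vsolve (e ∷ ω^ k ∷ ω^ inv₃ k ∷ p ∷ []) (u i ∷ []) (λ e w w' p z →
                 ((e ⊠ e) ⊠ (w ⊠ w')) ⊡ p ⊡ z ⊜ (e ⊠ w') ⊡ (e ⊠ (w ⊠ p)) ⊡ z) refl ⟩
          (e * ω^ inv₃ k) • (e * (ω^ k * p)) • u i      ≡⟨ cong ((e * ω^ inv₃ k) •_) (sym (trans x≡ (cong (_• u i) c≡))) ⟩
          (e * ω^ inv₃ k) • x                           ∎
        x'∈ = subst (L l) (sym x'≡) (span-• (e * ω^ inv₃ k) x∈)
        fx'y' : f l x' y' ≡ pow g (toℕ m) * ω^ b
        fx'y' = begin
          f l x' y'
            ≡⟨ f-det′ (e * ω^ inv₃ k) 0# 0# (e * ω^ k) x∈ y∈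
                 (trans x'≡ (vsolve (e * ω^ inv₃ k ∷ []) (x ∷ y ∷ []) (λ c x y → c ⊡ x ⊜ c ⊡ x ⊞ᵥ 0ₛ ⊡ y) refl))
                 (vsolve (e * ω^ k ∷ []) (x ∷ y ∷ []) (λ c x y → c ⊡ y ⊜ 0ₛ ⊡ x ⊞ᵥ c ⊡ y) refl) ⟩
          ((e * ω^ inv₃ k) * (e * ω^ k) + - (0# * 0#)) * f l x y
            ≡⟨ ssolve (e ∷ ω^ k ∷ ω^ inv₃ k ∷ f l x y ∷ []) (λ e w w' z →
                 ((e ⊠ w') ⊠ (e ⊠ w) ⊟ 0ₛ ⊠ 0ₛ) ⊠ z ⊜ ((e ⊠ e) ⊠ (w ⊠ w')) ⊠ z) refl ⟩
          ((e * e) * (ω^ k * ω^ inv₃ k)) * f l x y      ≡⟨ cong (_* f l x y) (squares ε k) ⟩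
          1# * f l x y                                  ≡⟨ trans (*-identityˡ _) fxy ⟩
          pow g (toℕ m) * ω^ b                          ∎
        Tx'y'≡ : T (ω^ inv₃ k • x) (ω^ k • y) ≡ T (e • x') (e • y')
        Tx'y'≡ = cong₂ T
          (sym (trans (cong (e •_) x'≡) (trans
            (vsolve (e ∷ ω^ inv₃ k ∷ []) (x ∷ []) (λ e w x → e ⊡ (e ⊠ w) ⊡ x ⊜ (e ⊠ e) ⊡ w ⊡ x) refl) (scale-one (sg-square ε) _))))
          (sym (trans
            (vsolve (e ∷ ω^ k ∷ []) (y ∷ []) (λ e w x → e ⊡ (e ⊠ w) ⊡ x ⊜ (e ⊠ e) ⊡ w ⊡ x) refl) (scale-one (sg-square ε) _)))
    in i , a , b , T (e • x') (e • y')
     , record { l = l ; ε = ε ; v = y' ; m = m ; x∈ = x'∈ ; v∈ = span-• (e * ω^ k) y∈ ; fxv = fx'y' ; s≡ = refl }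
     , same-sym (perm⇒same (subst (Perm (T x y)) Tx'y'≡ (T-rotate k x y)))
    where open ≡-Reasoning

  -- Exactly one of f(x, y) and f(y, x) = − f(x, y) has the form gᵐωᵇ with m < t.
  independent-T-covered : ∀ {x y} → Independent x y → CoveredBy (T x y)
  independent-T-covered {x} {y} ind =
    let l , x∈ , y∈ , fxy≢0 = f-nondegenerate ind
        ε , b , m , fxy = decompose (f l x y) fxy≢0
    in go l x∈ y∈ ε b m fxy
    where
    go : ∀ l → L l x → L l y → ∀ ε (b : Fin 3) (m : Fin t) → f l x y ≡ sg ε * (ω^ b * pow g (toℕ m)) → CoveredBy (T x y)
    go l x∈ y∈ false b m fxy = T-block b m x∈ y∈ (trans fxy (trans (*-identityˡ _) (*-comm _ _)))
    go l x∈ y∈ true  b m fxy =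
      let i , a , b , s , β , same = T-block b m y∈ x∈ (trans (f-skew l y x y∈ x∈) (trans (cong -_ fxy)
            (ssolve (ω^ b ∷ pow g (toℕ m) ∷ []) (λ w p → ⊟ ((⊟ 1ₛ) ⊠ (w ⊠ p)) ⊜ p ⊠ w) refl)))
      in i , a , b , s , β , same-trans same (perm⇒same (T-swap y x))

  abstract
    frame-covered : ∀ s → Frame s → CoveredBy s
    frame-covered ⟨ x , y , z ⟩ (sum , ind) =
      let h , 3h≡1 = inverse (1# + 1# + 1#) 3≢0
          h≢0 = unit≢0 (trans (*-comm h _) 3h≡1)
          -- The Fourier coefficients divided by 3, with the third point written as - (x + y) so
          -- that both are combinations of x and y.
          u' = h • (x ⊕ (ω * ω) • y ⊕ ω • neg (x ⊕ y))
          v' = h • (x ⊕ ω • y ⊕ (ω * ω) • neg (x ⊕ y))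
          i , a , b , s , β , same = independent-T-covered {u'} {v'} (independent-det
            (h * (1# + - ω)) (h * (ω * ω + - ω)) (h * (1# + - (ω * ω))) (h * (ω + - (ω * ω))) ind
            -- The determinant of the Fourier transform in these coordinates is - 3h²(ω² - ω).
            (nonzero-* (nonzero-* h≢0 h≢0) (nonzero-* 3≢0 (nonzero-* -1≢0 ω²≢ω)) ∘ trans (ssolve (h ∷ []) (λ h →
              (h ⊠ h) ⊠ ((1ₛ ⊞ 1ₛ ⊞ 1ₛ) ⊠ ((⊟ 1ₛ) ⊠ (ωₛ ⊠ ωₛ ⊟ ωₛ)))
              ⊜ (h ⊠ (1ₛ ⊟ ωₛ)) ⊠ (h ⊠ (ωₛ ⊟ ωₛ ⊠ ωₛ)) ⊟ (h ⊠ (ωₛ ⊠ ωₛ ⊟ ωₛ)) ⊠ (h ⊠ (1ₛ ⊟ ωₛ ⊠ ωₛ))) refl))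
            (vsolve (h ∷ []) (x ∷ y ∷ []) (λ h x y →
              h ⊡ (x ⊞ᵥ (ωₛ ⊠ ωₛ) ⊡ y ⊞ᵥ ωₛ ⊡ (⊟ᵥ (x ⊞ᵥ y)))
              ⊜ (h ⊠ (1ₛ ⊟ ωₛ)) ⊡ x ⊞ᵥ (h ⊠ (ωₛ ⊠ ωₛ ⊟ ωₛ)) ⊡ y) refl)
            (vsolve (h ∷ []) (x ∷ y ∷ []) (λ h x y →
              h ⊡ (x ⊞ᵥ ωₛ ⊡ y ⊞ᵥ (ωₛ ⊠ ωₛ) ⊡ (⊟ᵥ (x ⊞ᵥ y)))
              ⊜ (h ⊠ (1ₛ ⊟ ωₛ ⊠ ωₛ)) ⊡ x ⊞ᵥ (h ⊠ (ωₛ ⊟ ωₛ ⊠ ωₛ)) ⊡ y) refl))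
      in i , a , b , s , β , subst (SameSet s) (⟨⟩-cong
           (trans (vsolve (h ∷ []) (x ∷ y ∷ []) (λ h x y →
             let u = h ⊡ (x ⊞ᵥ (ωₛ ⊠ ωₛ) ⊡ y ⊞ᵥ ωₛ ⊡ (⊟ᵥ (x ⊞ᵥ y)))
                 v = h ⊡ (x ⊞ᵥ ωₛ ⊡ y ⊞ᵥ (ωₛ ⊠ ωₛ) ⊡ (⊟ᵥ (x ⊞ᵥ y)))
             in u ⊞ᵥ v ⊜ ((1ₛ ⊞ 1ₛ ⊞ 1ₛ) ⊠ h) ⊡ x) refl) (scale-one 3h≡1 x))
           (trans (vsolve (h ∷ []) (x ∷ y ∷ []) (λ h x y →
             let u = h ⊡ (x ⊞ᵥ (ωₛ ⊠ ωₛ) ⊡ y ⊞ᵥ ωₛ ⊡ (⊟ᵥ (x ⊞ᵥ y)))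
                 v = h ⊡ (x ⊞ᵥ ωₛ ⊡ y ⊞ᵥ (ωₛ ⊠ ωₛ) ⊡ (⊟ᵥ (x ⊞ᵥ y)))
             in ωₛ ⊡ u ⊞ᵥ (ωₛ ⊠ ωₛ) ⊡ v ⊜ ((1ₛ ⊞ 1ₛ ⊞ 1ₛ) ⊠ h) ⊡ y) refl) (scale-one 3h≡1 y))
           (trans (vsolve (h ∷ []) (x ∷ y ∷ []) (λ h x y →
             let u = h ⊡ (x ⊞ᵥ (ωₛ ⊠ ωₛ) ⊡ y ⊞ᵥ ωₛ ⊡ (⊟ᵥ (x ⊞ᵥ y)))
                 v = h ⊡ (x ⊞ᵥ ωₛ ⊡ y ⊞ᵥ (ωₛ ⊠ ωₛ) ⊡ (⊟ᵥ (x ⊞ᵥ y)))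
             in (ωₛ ⊠ ωₛ) ⊡ u ⊞ᵥ ωₛ ⊡ v ⊜ ((1ₛ ⊞ 1ₛ ⊞ 1ₛ) ⊠ h) ⊡ (⊟ᵥ (x ⊞ᵥ y))) refl)
             (trans (scale-one 3h≡1 _) (sym (frame-third sum))))) same

  -- The discrete Fourier coefficients of a triple: on T u v they are 3u and 3v,
  -- and a permutation of the triple multiplies them by cube roots of unity, possibly interchanging them.
  Û V̂ : Tri W → W
  Û ⟨ x , y , z ⟩ = x ⊕ (ω * ω) • y ⊕ ω • z
  V̂ ⟨ x , y , z ⟩ = x ⊕ ω • y ⊕ (ω * ω) • z

  Û-T : ∀ u v → Û (T u v) ≡ (1# + 1# + 1#) • u
  Û-T u v = vsolve [] (u ∷ v ∷ []) (λ u v →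
    (u ⊞ᵥ v) ⊞ᵥ (ωₛ ⊠ ωₛ) ⊡ (ωₛ ⊡ u ⊞ᵥ (ωₛ ⊠ ωₛ) ⊡ v) ⊞ᵥ ωₛ ⊡ ((ωₛ ⊠ ωₛ) ⊡ u ⊞ᵥ ωₛ ⊡ v) ⊜ (1ₛ ⊞ 1ₛ ⊞ 1ₛ) ⊡ u) refl

  V̂-T : ∀ u v → V̂ (T u v) ≡ (1# + 1# + 1#) • v
  V̂-T u v = vsolve [] (u ∷ v ∷ []) (λ u v →
    (u ⊞ᵥ v) ⊞ᵥ ωₛ ⊡ (ωₛ ⊡ u ⊞ᵥ (ωₛ ⊠ ωₛ) ⊡ v) ⊞ᵥ (ωₛ ⊠ ωₛ) ⊡ ((ωₛ ⊠ ωₛ) ⊡ u ⊞ᵥ ωₛ ⊡ v) ⊜ (1ₛ ⊞ 1ₛ ⊞ 1ₛ) ⊡ v) refl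

  -- The cyclic orders give `direct` and the transpositions give `swapped`; in both cases the two
  -- factors are inverse, so a form value is preserved up to the sign of the exchange.
  data Related (k : Fin 3) (u v u' v' : W) : Set where
    direct  : u' ≡ ω^ k • u → v' ≡ ω^ inv₃ k • v → Related k u v u' v'
    swapped : u' ≡ ω^ k • v → v' ≡ ω^ inv₃ k • u → Related k u v u' v'

  perm-related : ∀ {s s'} → Perm s s' → ∃ λ k → Related k (Û s) (V̂ s) (Û s') (V̂ s')
  perm-related {⟨ x , y , z ⟩} p123 = 0F , direct (sym (1• _)) (sym (1• _))
  perm-related {⟨ x , y , z ⟩} p231 = 1F , direct
    (vsolve [] (x ∷ y ∷ z ∷ []) (λ x y z → y ⊞ᵥ (ωₛ ⊠ ωₛ) ⊡ z ⊞ᵥ ωₛ ⊡ x ⊜ ωₛ^ 1F ⊡ (x ⊞ᵥ (ωₛ ⊠ ωₛ) ⊡ y ⊞ᵥ ωₛ ⊡ z)) refl)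
    (vsolve [] (x ∷ y ∷ z ∷ []) (λ x y z → y ⊞ᵥ ωₛ ⊡ z ⊞ᵥ (ωₛ ⊠ ωₛ) ⊡ x ⊜ ωₛ^ 2F ⊡ (x ⊞ᵥ ωₛ ⊡ y ⊞ᵥ (ωₛ ⊠ ωₛ) ⊡ z)) refl)
  perm-related {⟨ x , y , z ⟩} p312 = 2F , direct
    (vsolve [] (x ∷ y ∷ z ∷ []) (λ x y z → z ⊞ᵥ (ωₛ ⊠ ωₛ) ⊡ x ⊞ᵥ ωₛ ⊡ y ⊜ ωₛ^ 2F ⊡ (x ⊞ᵥ (ωₛ ⊠ ωₛ) ⊡ y ⊞ᵥ ωₛ ⊡ z)) refl)
    (vsolve [] (x ∷ y ∷ z ∷ []) (λ x y z → z ⊞ᵥ ωₛ ⊡ x ⊞ᵥ (ωₛ ⊠ ωₛ) ⊡ y ⊜ ωₛ^ 1F ⊡ (x ⊞ᵥ ωₛ ⊡ y ⊞ᵥ (ωₛ ⊠ ωₛ) ⊡ z)) refl)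
  perm-related {⟨ x , y , z ⟩} p132 = 0F , swapped
    (vsolve [] (x ∷ y ∷ z ∷ []) (λ x y z → x ⊞ᵥ (ωₛ ⊠ ωₛ) ⊡ z ⊞ᵥ ωₛ ⊡ y ⊜ ωₛ^ 0F ⊡ (x ⊞ᵥ ωₛ ⊡ y ⊞ᵥ (ωₛ ⊠ ωₛ) ⊡ z)) refl)
    (vsolve [] (x ∷ y ∷ z ∷ []) (λ x y z → x ⊞ᵥ ωₛ ⊡ z ⊞ᵥ (ωₛ ⊠ ωₛ) ⊡ y ⊜ ωₛ^ 0F ⊡ (x ⊞ᵥ (ωₛ ⊠ ωₛ) ⊡ y ⊞ᵥ ωₛ ⊡ z)) refl)
  perm-related {⟨ x , y , z ⟩} p213 = 2F , swapped
    (vsolve [] (x ∷ y ∷ z ∷ []) (λ x y z → y ⊞ᵥ (ωₛ ⊠ ωₛ) ⊡ x ⊞ᵥ ωₛ ⊡ z ⊜ ωₛ^ 2F ⊡ (x ⊞ᵥ ωₛ ⊡ y ⊞ᵥ (ωₛ ⊠ ωₛ) ⊡ z)) refl)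
    (vsolve [] (x ∷ y ∷ z ∷ []) (λ x y z → y ⊞ᵥ ωₛ ⊡ x ⊞ᵥ (ωₛ ⊠ ωₛ) ⊡ z ⊜ ωₛ^ 1F ⊡ (x ⊞ᵥ (ωₛ ⊠ ωₛ) ⊡ y ⊞ᵥ ωₛ ⊡ z)) refl)
  perm-related {⟨ x , y , z ⟩} p321 = 1F , swapped
    (vsolve [] (x ∷ y ∷ z ∷ []) (λ x y z → z ⊞ᵥ (ωₛ ⊠ ωₛ) ⊡ y ⊞ᵥ ωₛ ⊡ x ⊜ ωₛ^ 1F ⊡ (x ⊞ᵥ ωₛ ⊡ y ⊞ᵥ (ωₛ ⊠ ωₛ) ⊡ z)) refl)
    (vsolve [] (x ∷ y ∷ z ∷ []) (λ x y z → z ⊞ᵥ ωₛ ⊡ y ⊞ᵥ (ωₛ ⊠ ωₛ) ⊡ x ⊜ ωₛ^ 2F ⊡ (x ⊞ᵥ (ωₛ ⊠ ωₛ) ⊡ y ⊞ᵥ ωₛ ⊡ z)) refl)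

  T-related : ∀ {u v u' v'} → Perm (T u v) (T u' v') → ∃ λ k → Related k u v u' v'
  T-related {u} {v} {u'} {v'} π = let k , r = perm-related π in k , divide r
    where
    cancel-3 : ∀ {c x x' X X'} → X ≡ (1# + 1# + 1#) • x → X' ≡ (1# + 1# + 1#) • x' → X' ≡ c • X → x' ≡ c • x
    cancel-3 {c} {x} {x'} X≡ X'≡ eq = •-cancelˡ 3≢0 (trans (sym X'≡) (trans eq (trans (cong (c •_) X≡)
      (vsolve (c ∷ []) (x ∷ []) (λ c x → c ⊡ (1ₛ ⊞ 1ₛ ⊞ 1ₛ) ⊡ x ⊜ (1ₛ ⊞ 1ₛ ⊞ 1ₛ) ⊡ c ⊡ x) refl))))
    divide : ∀ {k} → Related k (Û (T u v)) (V̂ (T u v)) (Û (T u' v')) (V̂ (T u' v')) → Related k u v u' v'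
    divide (direct  e₁ e₂) = direct  (cancel-3 (Û-T u v) (Û-T u' v') e₁) (cancel-3 (V̂-T u v) (V̂-T u' v') e₂)
    divide (swapped e₁ e₂) = swapped (cancel-3 (V̂-T u v) (Û-T u' v') e₁) (cancel-3 (Û-T u v) (V̂-T u' v') e₂)

  multiple-unique : ∀ {i j c d} → c ≢ 0# → c • u i ≡ d • u j → i ≡ j × c ≡ d
  multiple-unique {i} {j} {c} {d} c≢0 eq = finish i≡j eq
    where
    i≡j : i ≡ j
    i≡j = let c' , cc'≡1 = inverse c c≢0 in K-distinct i j (c' * d ,
      trans (sym (scale-one cc'≡1 (u i))) (trans
        (vsolve (c ∷ c' ∷ []) (u i ∷ []) (λ c c' x → (c ⊠ c') ⊡ x ⊜ c' ⊡ c ⊡ x) refl)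
        (trans (cong (c' •_) eq) (vsolve (c' ∷ d ∷ []) (u j ∷ []) (λ c d x → c ⊡ d ⊡ x ⊜ (c ⊠ d) ⊡ x) refl))))
    finish : ∀ {j} → i ≡ j → c • u i ≡ d • u j → i ≡ j × c ≡ d
    finish refl eq = refl , •-cancelʳ (u≢0 i) eq

  f-scale : ∀ {l x y} α β → L l x → L l y → f l (α • x) (β • y) ≡ (α * β) * f l x y
  f-scale {l} {x} {y} α β x∈ y∈ = trans (f-scaleˡ l α x (β • y) x∈ (span-• β y∈))
    (trans (cong (α *_) (f-scaleʳ l β x y x∈ y∈))
      (ssolve (α ∷ β ∷ f l x y ∷ []) (λ α β z → α ⊠ (β ⊠ z) ⊜ (α ⊠ β) ⊠ z) refl))

  -- The signed vectors U, V and U', V' are compared through their Fourier coefficients. A rotation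
  -- is detected by the normalisation of U on its line, an exchange by the sign of the form value.
  blocks-disjoint : ∀ {i i' a a' b b' s s'} → Block (generator i a) (ω^ b) s → Block (generator i' a') (ω^ b') s'
    → SameSet s s' → i ≡ i' × a ≡ a' × b ≡ b'
  blocks-disjoint {i} {i'} {a} {a'} {b} {b'} {s} {s'} β β' same =
    let k , r = T-related (subst₂ Perm s≡ s≡' (same⇒perm (frame-proper s (block-frame (ω^≢0 b) β))
                  (frame-proper s' (block-frame (ω^≢0 b') β')) same))
    in conclude k r
    where
    open Block β
    open Block β' renaming (l to l'; ε to ε'; v to v'; m to m'; x∈ to x∈'; v∈ to v∈'; fxv to fxv'; s≡ to s≡')
    x  = generator i a
    x' = generator i' a'
    U  = sg ε • x
    V  = sg ε • v
    U' = sg ε' • x'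
    V' = sg ε' • v'
    signs-cancel : ∀ {l x v} ε → L l x → L l v → f l (sg ε • x) (sg ε • v) ≡ f l x v
    signs-cancel {l} {x} {v} ε x∈ v∈ = trans (f-scale (sg ε) (sg ε) x∈ v∈)
      (trans (cong (_* f l x v) (sg-square ε)) (*-identityˡ _))
    fUV : f l U V ≡ pow g (toℕ m) * ω^ b
    fUV = trans (signs-cancel ε x∈ v∈) fxv
    fUV' : f l' U' V' ≡ pow g (toℕ m') * ω^ b'
    fUV' = trans (signs-cancel ε' x∈' v∈') fxv'
    gω≢0 : ∀ (m : Fin t) b → pow g (toℕ m) * ω^ b ≢ 0#
    gω≢0 m b = nonzero-* (pow≢0 (toℕ m)) (ω^≢0 b)
    rotated : ∀ {l x v} k → L l x → L l v → f l (ω^ k • x) (ω^ inv₃ k • v) ≡ f l x v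
    rotated {l} {x} {v} k x∈ v∈ = trans (f-scale (ω^ k) (ω^ inv₃ k) x∈ v∈)
      (trans (cong (_* f l x v) (ω^-inverse k)) (*-identityˡ _))

    same-f : ∀ {c} → L l U' → L l V' → f l U' V' ≡ c → c ≢ 0# → c ≡ pow g (toℕ m') * ω^ b'
    same-f U'∈ V'∈ f≡c c≢0 = trans (sym f≡c) (trans (cong (λ l → f l U' V') l≡l') fUV')
      where
      l≡l' : l ≡ l'
      -- Both blocks have a nonzero form value on the pair U', V', so they lie in the same plane and
      -- use the same form.
      l≡l' = plane-unique U'∈ V'∈ (c≢0 ∘ trans (sym f≡c)) (span-• (sg ε') x∈') (span-• (sg ε') v∈') (gω≢0 m' b' ∘ trans (sym fUV'))

    conclude : ∀ k → Related k U V U' V' → i ≡ i' × a ≡ a' × b ≡ b'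
    conclude k (direct e₁ e₂) =
      let i≡i' , c≡c' = multiple-unique {i} {i'} {ω^ k * (sg ε * pow g (toℕ a))} {sg ε' * pow g (toℕ a')}
            (nonzero-* (ω^≢0 k) (nonzero-* (sg≢0 ε) (pow≢0 (toℕ a))))
            (trans (vsolve (ω^ k ∷ sg ε ∷ pow g (toℕ a) ∷ []) (u i ∷ []) (λ w e p x →
                     (w ⊠ (e ⊠ p)) ⊡ x ⊜ w ⊡ e ⊡ p ⊡ x) refl)
              (trans (sym e₁) (vsolve (sg ε' ∷ pow g (toℕ a') ∷ []) (u i' ∷ []) (λ e p x → e ⊡ p ⊡ x ⊜ (e ⊠ p) ⊡ x) refl)))
          -- The right-hand scalar has exponent zero of ω, so no proper rotation occurs and the
          -- exponents of `g` agree.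
          _ , _ , a≡a' = decompose-unique {ε} {ε'} {k} {0F} {a} {a'} (trans
            (ssolve (sg ε ∷ ω^ k ∷ pow g (toℕ a) ∷ []) (λ e w p → e ⊠ (w ⊠ p) ⊜ w ⊠ (e ⊠ p)) refl)
            (trans c≡c' (ssolve (sg ε' ∷ pow g (toℕ a') ∷ []) (λ e p → e ⊠ p ⊜ e ⊠ (1ₛ ⊠ p)) refl)))
          _ , b≡b' , _ = decompose-unique {false} {false} {b} {b'} {m} {m'} (cong (1# *_) (trans (*-comm _ _) (trans
            (same-f (subst (L l) (sym e₁) (span-• (ω^ k) (span-• (sg ε) x∈))) (subst (L l) (sym e₂) (span-• (ω^ inv₃ k) (span-• (sg ε) v∈)))
              (trans (cong₂ (f l) e₁ e₂) (trans (rotated k (span-• (sg ε) x∈) (span-• (sg ε) v∈)) fUV)) (gω≢0 m b)) (*-comm _ _))))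
      in i≡i' , a≡a' , b≡b'
    -- The exchange would give - gᵐωᵇ = gᵐ'ωᵇ', two decompositions of one scalar with different
    -- signs.
    conclude k (swapped e₁ e₂) = contradiction (proj₁ (decompose-unique {true} {false} {b} {b'} {m} {m'} (trans
      (ssolve (ω^ b ∷ pow g (toℕ m) ∷ []) (λ w p → (⊟ 1ₛ) ⊠ (w ⊠ p) ⊜ ⊟ (p ⊠ w)) refl)
      (trans (same-f (subst (L l) (sym e₁) (span-• (ω^ k) V∈)) (subst (L l) (sym e₂) (span-• (ω^ inv₃ k) U∈))
          (trans (cong₂ (f l) e₁ e₂) (trans (rotated k V∈ U∈) (trans (f-skew l V U V∈ U∈) (cong -_ fUV))))
          (nonzero-* -1≢0 (gω≢0 m b) ∘ trans (ssolve (pow g (toℕ m) * ω^ b ∷ []) (λ z → (⊟ 1ₛ) ⊠ z ⊜ ⊟ z) refl)))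
        (ssolve (ω^ b' ∷ pow g (toℕ m') ∷ []) (λ w p → p ⊠ w ⊜ 1ₛ ⊠ (w ⊠ p)) refl))))) λ ()
      where
      U∈ : L l U
      U∈ = span-• (sg ε) x∈
      V∈ : L l V
      V∈ = span-• (sg ε) v∈

  -- The given LKTS(q + 2) and its images on lines

  Y : Set
  Y = Pt Carrier

  code : Y → Fin (2 +ℕ suc (6 *ℕ t))
  code ∞₁      = zero
  code ∞₂      = suc zero
  code (fin x) = suc (suc (Inverse.from enum x))

  code-injective : ∀ {x y} → code x ≡ code y → x ≡ y
  code-injective {∞₁}    {∞₁}    _  = refl
  code-injective {∞₂}    {∞₂}    _  = refl
  code-injective {fin x} {fin y} eq =
    cong fin (Injection.injective (↔⇒↣ (↔-sym enum)) (suc-injective (suc-injective eq)))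

  _≟ʸ_ : DecidableEquality Y
  _≟ʸ_ = via-injection (mk↣ code-injective) _≟ᶠⁱⁿ_

  _≟ʷ_ : DecidableEquality W
  _≟ʷ_ = Vecₚ.≡-dec _≟ᶠ_

  Level : Set
  Level = Fin (suc (3 *ℕ t))

  D-blocks : Carrier → Coll Y
  D-blocks c = Union (λ (j : Level) → Q c (toℕ j))

  D-STS : ∀ c → IsSTS (D-blocks c)
  D-STS c = proj₁ (Q-KTS c)

  D-∈ᵇ : ∀ {c s} (j : Level) → s ∈ᵇ Q c (toℕ j) → s ∈ᵇ D-blocks c
  D-∈ᵇ j (r , Qr , rs) = r , (j , Qr) , rs

  -- For distinct points a and b the map sending c to the third point of the block of 𝒟_c through a and b
  -- is injective by disjointness; as 3 + q points do not fit into Y, it reaches every point other than a and b.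
  abstract
    D-covers : ∀ s → Proper s → ∃ λ c → s ∈ᵇ D-blocks c
    D-covers ⟨ a , b , z ⟩ (a≢b , a≢z , b≢z) = found (any? (λ i → third (Inverse.to enum i) ≟ʸ z))
      where
      block : ∀ c → ∃ λ s → D-blocks c s × a ∈ₜ s × b ∈ₜ s
      block c = sts-exists (D-STS c) a≢b
      third : Carrier → Y
      third c = let s , _ , a∈ , b∈ = block c in proj₁ (third-point s a≢b a∈ b∈)
      third-perm : ∀ c → Perm (proj₁ (block c)) ⟨ a , b , third c ⟩
      third-perm c = let s , _ , a∈ , b∈ = block c in proj₂ (third-point s a≢b a∈ b∈)
      third-block : ∀ c → ⟨ a , b , third c ⟩ ∈ᵇ D-blocks c
      third-block c = let s , Ds , _ = block c in s , Ds , perm⇒same (third-perm c)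
      third-proper : ∀ c → Proper ⟨ a , b , third c ⟩
      third-proper c = let s , Ds , _ = block c in perm-proper (third-perm c) (proj₁ (D-STS c) s Ds)
      third-injective : ∀ {c c'} → third c ≡ third c' → c ≡ c'
      third-injective {c} {c'} eq = Q-disjoint c c' ⟨ a , b , third c ⟩ (third-block c)
        (subst (λ z → ⟨ a , b , z ⟩ ∈ᵇ D-blocks c') (sym eq) (third-block c'))
      thirds : Fin (suc (6 *ℕ t)) → Y
      thirds = third ∘ Inverse.to enum
      found : Dec (∃ λ i → thirds i ≡ z) → ∃ λ c → ⟨ a , b , z ⟩ ∈ᵇ D-blocks c
      found (yes (i , eq)) = Inverse.to enum i , subst (λ z → ⟨ a , b , z ⟩ ∈ᵇ D-blocks (Inverse.to enum i)) eq (third-block _)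
      found (no none) = ⊥-elim (<⇒notInjective {f = λ i → code (list i)} (ℕₚ.n<1+n _) λ eq → list-injective (code-injective eq))
        where
        list : Fin (3 +ℕ suc (6 *ℕ t)) → Y
        list = a ◂ (b ◂ (z ◂ thirds))
        list-injective : Injective _≡_ _≡_ list
        list-injective = ◂-injective
          (λ { 0F → a≢b ∘ sym ; 1F → a≢z ∘ sym ; (suc (suc i)) → proj₁ (proj₂ (third-proper _)) ∘ sym })
          (◂-injective (λ { 0F → b≢z ∘ sym ; (suc i) → proj₂ (proj₂ (third-proper _)) ∘ sym })
            (◂-injective (λ i eq → none (i , eq))
              (Injection.injective (↔⇒↣ enum) ∘ third-injective)))

  special : ∀ {A : Set} → A → Tri (Pt A)
  special x = ⟨ ∞₁ , ∞₂ , fin x ⟩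

  special-block : ∀ c → special c ∈ᵇ D-blocks c
  special-block c = D-∈ᵇ 0F (Q-∞ c)

  -- The representative in R_i of the coset w + K_i: the origin of the coordinate on this line, in
  -- which w itself has coordinate `p i w`.
  base : Fin N → W → W
  base i w = w ⊖ p i w • u i

  ext : W → Fin N → Y → Pt W
  ext w i = extPt (base i w) (u i)

  ext-p : ∀ w i → ext w i (fin (p i w)) ≡ fin w
  ext-p w i = cong fin (vsolve (p i w ∷ []) (w ∷ u i ∷ []) (λ p w u → (w ⊟ᵥ p ⊡ u) ⊞ᵥ p ⊡ u ⊜ w) refl)

  ext-special : ∀ w i → mapTri (ext w i) (special (p i w)) ≡ special w
  ext-special w i = ⟨⟩-cong refl refl (ext-p w i)

  ⊕-cancelˡ : ∀ {x y z} → x ⊕ y ≡ x ⊕ z → y ≡ z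
  ⊕-cancelˡ {x} {y} {z} eq = trans (vsolve [] (x ∷ y ∷ []) (λ x y → y ⊜ (x ⊞ᵥ y) ⊟ᵥ x) refl)
    (trans (cong (_⊖ x) eq) (vsolve [] (x ∷ z ∷ []) (λ x y → (x ⊞ᵥ y) ⊟ᵥ x ⊜ y) refl))

  extPt-injective : ∀ r i {x y} → extPt r (u i) x ≡ extPt r (u i) y → x ≡ y
  extPt-injective r i {∞₁}    {∞₁}    _  = refl
  extPt-injective r i {∞₂}    {∞₂}    _  = refl
  extPt-injective r i {fin x} {fin y} eq = cong fin (•-cancelʳ (u≢0 i) (⊕-cancelˡ (fin-injective eq)))

  shift : W → W → Pt W
  shift w y = fin (w ⊕ y)

  shift-injective : ∀ w {x y} → shift w x ≡ shift w y → x ≡ y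
  shift-injective w eq = ⊕-cancelˡ (fin-injective eq)

  ext-span : ∀ {w i y} z → ext w i z ≡ shift w y → InSpan1 (u i) y
  ext-span {w} {i} {y} (fin a) eq = a + - p i w , sym (⊕-cancelˡ (trans
    (vsolve (a ∷ p i w ∷ []) (w ∷ u i ∷ []) (λ a p w u → w ⊞ᵥ (a ⊟ p) ⊡ u ⊜ (w ⊟ᵥ p ⊡ u) ⊞ᵥ a ⊡ u) refl) (fin-injective eq)))

  span-ext : ∀ {w i y} → InSpan1 (u i) y → ∃ λ z → ext w i z ≡ shift w y
  span-ext {w} {i} (c , refl) = fin (c + p i w) , cong fin
    (vsolve (c ∷ p i w ∷ []) (w ∷ u i ∷ []) (λ c p w u → (w ⊟ᵥ p ⊡ u) ⊞ᵥ (c ⊞ p) ⊡ u ⊜ w ⊞ᵥ c ⊡ u) refl)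

  -- The points ∞₁, ∞₂ and w lie on every line through w and leave the choice of line open; for any
  -- other point a line through w is recorded together with its nonzero coordinate.
  data Place (w : W) : Pt W → Set where
    central : ∀ {X} → (∀ i → ∃ λ z → ext w i z ≡ X) → Place w X
    generic : ∀ {y} i c → c ≢ 0# → y ≡ c • u i → Place w (shift w y)

  place : ∀ w X → Place w X
  place w ∞₁ = central λ i → ∞₁ , refl
  place w ∞₂ = central λ i → ∞₂ , refl
  place w (fin x) with x ≟ʷ w
  ... | yes refl = central λ i → fin (p i w) , ext-p w i
  ... | no  x≢w  = subst (Place w) (cong fin (vsolve [] (x ∷ w ∷ []) (λ x w → w ⊞ᵥ (x ⊟ᵥ w) ⊜ x) refl))
    (let i , c , eq = K-cover (x ⊖ w) (x≢w ∘ ⊖-≡0)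
     in generic i c (λ c≡0 → x≢w (⊖-≡0 (trans eq (trans (cong (_• u i) c≡0) (0• (u i)))))) eq)

  -- Measured from w, a finite common point of the two lines is a multiple of u_i and of u_j at
  -- once, so it is w.
  central-point : ∀ {w i j} y z → i ≢ j → ext w i y ≡ ext w j z → y ∈ₜ special (p i w)
  central-point ∞₁      z i≢j eq = in-1
  central-point ∞₂      z i≢j eq = in-2
  central-point {w} {i} {j} (fin a) (fin b) i≢j eq with a ≟ᶠ p i w
  ... | yes refl = in-3
  ... | no  a≢p  = contradiction (proj₁ (multiple-unique (a≢p ∘ difference-zero) (⊕-cancelˡ {w} (trans
    (vsolve (a ∷ p i w ∷ []) (w ∷ u i ∷ []) (λ a p w u → w ⊞ᵥ (a ⊟ p) ⊡ u ⊜ (w ⊟ᵥ p ⊡ u) ⊞ᵥ a ⊡ u) refl)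
    (trans (fin-injective eq)
      (vsolve (b ∷ p j w ∷ []) (w ∷ u j ∷ []) (λ a p w u → (w ⊟ᵥ p ⊡ u) ⊞ᵥ a ⊡ u ⊜ w ⊞ᵥ (a ⊟ p) ⊡ u) refl)))))) i≢j

  -- The Kirkman triple system 𝓑_w

  -- How a parallel class of 𝒟 on line i is distributed: class 0 of every line enters the common
  -- class, and class 1 + bt + a enters the class of (i, a, b). As a relation it lets blocks on
  -- lines be treated uniformly.
  data InClass (i : Fin N) : Level → Idx D → Set where
    central-class : InClass i 0F (inj₂ tt)
    other-class   : ∀ a b → InClass i (suc (combine b a)) (inj₁ (i , a , b))

  inClass : ∀ i j → ∃ (InClass i j)
  inClass i 0F      = inj₂ tt , central-class
  inClass i (suc j) = let b , a , eq = combine-surjective {3} {t} j in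
    inj₁ (i , a , b) , subst (λ j → InClass i (suc j) (inj₁ (i , a , b))) eq (other-class a b)

  inClass-unique : ∀ {i j j' idx idx'} → j ≡ j' → InClass i j idx → InClass i j' idx' → idx ≡ idx'
  inClass-unique j≡j' central-class central-class = refl
  inClass-unique {i} j≡j' (other-class a b) (other-class a' b') =
    let b≡b' , a≡a' = combine-injective b a b' a' (suc-injective j≡j')
    in cong₂ (λ a b → inj₁ (i , a , b)) a≡a' b≡b'

  level-number : ∀ a b → toℕ a +ℕ toℕ b *ℕ t +ℕ 1 ≡ toℕ (suc (combine {3} {t} b a))
  level-number a b = trans (ℕₚ.+-comm _ 1) (cong suc (trans (ℕₚ.+-comm (toℕ a) _)
    (trans (cong (_+ℕ toℕ a) (ℕₚ.*-comm (toℕ b) t)) (sym (toℕ-combine {3} {t} b a)))))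

  data View (w : W) : Idx D → Tri (Pt W) → Set where
    oblique  : ∀ i a b {s} → Block (generator i a) (ω^ b) s → View w (inj₁ (i , a , b)) (mapTri (shift w) s)
    straight : ∀ {i idx A} (j : Level) → InClass i j idx → Q (p i w) (toℕ j) A → View w idx (mapTri (ext w i) A)

  view : ∀ {w} idx {s} → BClass D w idx s → View w idx s
  view {w} (inj₁ (i , a , b)) (inj₁ (s , Ps , refl)) = oblique i a b (P⇒Block Ps)
  view {w} (inj₁ (i , a , b)) (inj₂ (A , QA , refl)) =
    straight _ (other-class a b) (subst (λ k → Q (p i w) k A) (level-number a b) QA)
  view (inj₂ tt) (i , A , QA , refl) = straight 0F central-class QA

  unview : ∀ {w idx s} → View w idx s → BClass D w idx s
  unview (oblique i a b {s} β) = inj₁ (s , Block⇒P β , refl)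
  unview (straight _ central-class QA) = _ , _ , QA , refl
  unview {w} (straight {i} {A = A} _ (other-class a b) QA) =
    inj₂ (A , subst (λ k → Q (p i w) k A) (sym (level-number a b)) QA , refl)

  ext-injective : ∀ w i {x y} → ext w i x ≡ ext w i y → x ≡ y
  ext-injective w i = extPt-injective (base i w) i

  D-proper : ∀ {c A} (j : Level) → Q c (toℕ j) A → Proper A
  D-proper {c} {A} j QA = proj₁ (D-STS c) A (j , QA)

  oblique-frame : ∀ {x} b {s} → Block x (ω^ b) s → Frame s
  oblique-frame b = block-frame (ω^≢0 b)

  view-proper : ∀ {w idx s} → View w idx s → Proper s
  view-proper {w} (oblique i a b {s} β) = proper-map (shift w) (shift-injective w) s (frame-proper s (oblique-frame b β))
  view-proper {w} (straight {i} {A = A} j _ QA) = proper-map (ext w i) (ext-injective w i) A (D-proper j QA)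

  -- Seen from w, two points of a zero-sum triple are independent, while two finite points on a line
  -- through w are multiples of one vector.
  oblique-straight-disjoint : ∀ {w i s A a b} → Frame s → a ≢ b
    → a ∈ₜ mapTri (shift w) s → b ∈ₜ mapTri (shift w) s → a ∈ₜ mapTri (ext w i) A → b ∈ₜ mapTri (ext w i) A → ⊥
  oblique-straight-disjoint {w} {i} {s} {A} fr a≢b a∈ b∈ a∈' b∈' =
    let y , y∈ , a≡  = ∈-map⁻ (shift w) s a∈
        z , z∈ , b≡  = ∈-map⁻ (shift w) s b∈
        α , _  , a≡' = ∈-map⁻ (ext w i) A a∈'
        β , _  , b≡' = ∈-map⁻ (ext w i) A b∈'
    in independent⇒not-collinear
         (frame-independent fr (λ y≡z → a≢b (trans a≡ (trans (cong (shift w) y≡z) (sym b≡)))) y∈ z∈)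
         (ext-span {w} {i} α (trans (sym a≡') a≡)) (ext-span {w} {i} β (trans (sym b≡') b≡))

  D-unique : ∀ {c A A' a b} (j j' : Level) → a ≢ b → Q c (toℕ j) A → a ∈ₜ A → b ∈ₜ A → Q c (toℕ j') A' → a ∈ₜ A' → b ∈ₜ A' → SameSet A A'
  D-unique {c} j j' a≢b QA a∈ b∈ QA' a∈' b∈' =
    sts-unique (D-STS c) a≢b (D-∈ᵇ j (∈ᵇ-refl {C = Q c (toℕ j)} QA)) a∈ b∈ (D-∈ᵇ j' (∈ᵇ-refl {C = Q c (toℕ j')} QA')) a∈' b∈'

  D-special : ∀ {c A a b} (j : Level) → a ≢ b → Q c (toℕ j) A → a ∈ₜ A → b ∈ₜ A → a ∈ₜ special c → b ∈ₜ special c → SameSet A (special c)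
  D-special {c} j a≢b QA a∈ b∈ a∈' b∈' =
    sts-unique (D-STS c) a≢b (D-∈ᵇ j (∈ᵇ-refl {C = Q c (toℕ j)} QA)) a∈ b∈ (special-block c) a∈' b∈'

  map-special : ∀ {w i A} → SameSet A (special (p i w)) → SameSet (mapTri (ext w i) A) (special w)
  map-special {w} {i} {A} same = subst (SameSet (mapTri (ext w i) A)) (ext-special w i) (same-map (ext w i) same)

  -- Both common points lie on two lines through w, hence in {∞₁, ∞₂, w}, and two points determine
  -- the block.
  two-lines : ∀ {w i i' A A' a b} (j : Level) → i ≢ i' → a ≢ b → Q (p i w) (toℕ j) A
    → a ∈ₜ mapTri (ext w i) A → b ∈ₜ mapTri (ext w i) A → a ∈ₜ mapTri (ext w i') A' → b ∈ₜ mapTri (ext w i') A'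
    → SameSet A (special (p i w))
  two-lines {w} {i} {i'} {A} {A'} j i≢i' a≢b QA a∈ b∈ a∈' b∈' =
    let α  , α∈ , a≡  = ∈-map⁻ (ext w i) A a∈
        β  , β∈ , b≡  = ∈-map⁻ (ext w i) A b∈
        α' , _  , a≡' = ∈-map⁻ (ext w i') A' a∈'
        β' , _  , b≡' = ∈-map⁻ (ext w i') A' b∈'
    in D-special j (λ α≡β → a≢b (trans a≡ (trans (cong (ext w i) α≡β) (sym b≡)))) QA α∈ β∈
         (central-point {w} α α' i≢i' (trans (sym a≡) a≡')) (central-point {w} β β' i≢i' (trans (sym b≡) b≡'))

  view-unique : ∀ {w idx idx' s s' a b} → a ≢ b → View w idx s → a ∈ₜ s → b ∈ₜ s → View w idx' s' → a ∈ₜ s' → b ∈ₜ s' → SameSet s s'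
  view-unique {w} a≢b (oblique i a b {s} β) a∈ b∈ (oblique i' a' b' {s'} β') a∈' b∈' =
    let y , y∈ , a≡ = ∈-map⁻ (shift w) s a∈
        z , z∈ , b≡ = ∈-map⁻ (shift w) s b∈
        map' = mapTri (shift w) s'
    in same-map (shift w) (frame-unique (oblique-frame b β) (oblique-frame b' β')
         (λ y≡z → a≢b (trans a≡ (trans (cong (shift w) y≡z) (sym b≡)))) y∈ z∈
         (∈-unmap (shift w) (shift-injective w) s' (subst (_∈ₜ map') a≡ a∈')) (∈-unmap (shift w) (shift-injective w) s' (subst (_∈ₜ map') b≡ b∈')))
  view-unique a≢b (oblique _ _ b β) a∈ b∈ (straight {A = A} j _ QA) a∈' b∈' =
    ⊥-elim (oblique-straight-disjoint {A = A} (oblique-frame b β) a≢b a∈ b∈ a∈' b∈')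
  view-unique a≢b (straight {A = A} j _ QA) a∈ b∈ (oblique i a b β) a∈' b∈' =
    ⊥-elim (oblique-straight-disjoint {A = A} (oblique-frame b β) a≢b a∈' b∈' a∈ b∈)
  view-unique {w} a≢b (straight {i} {A = A} j _ QA) a∈ b∈ (straight {i'} {A = A'} j' _ QA') a∈' b∈' with i ≟ᶠⁱⁿ i'
  -- On different lines both blocks turn out to be {∞₁, ∞₂, w}.
  ... | no i≢i' = same-trans (map-special (two-lines {A = A} {A' = A'} j i≢i' a≢b QA a∈ b∈ a∈' b∈'))
    (same-sym (map-special (two-lines {A = A'} {A' = A} j' (i≢i' ∘ sym) a≢b QA' a∈' b∈' a∈ b∈)))
  ... | yes refl =
    let α , α∈ , a≡ = ∈-map⁻ (ext w i) A a∈
        β , β∈ , b≡ = ∈-map⁻ (ext w i) A b∈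
        map' = mapTri (ext w i) A'
    in same-map (ext w i) (D-unique j j' (λ α≡β → a≢b (trans a≡ (trans (cong (ext w i) α≡β) (sym b≡)))) QA α∈ β∈ QA'
         (∈-unmap (ext w i) (ext-injective w i) A' (subst (_∈ₜ map') a≡ a∈')) (∈-unmap (ext w i) (ext-injective w i) A' (subst (_∈ₜ map') b≡ b∈')))

  view-disjoint : ∀ {w idx idx' s s'} → View w idx s → View w idx' s' → SameSet s s' → idx ≡ idx'
  view-disjoint {w} (oblique i a b β) (oblique i' a' b' β') same =
    let i≡ , a≡ , b≡ = blocks-disjoint {i} {i'} {a} {a'} {b} {b'} β β' (same-unmap (shift w) (shift-injective w) same)
    in cong inj₁ (cong₂ _,_ i≡ (cong₂ _,_ a≡ b≡))
  view-disjoint V@(oblique i a b β) (straight {A = A} j _ QA) same =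
    ⊥-elim (oblique-straight-disjoint {A = A} (oblique-frame b β) (proj₁ (view-proper V)) in-1 in-2 (proj₁ (same _) in-1) (proj₁ (same _) in-2))
  view-disjoint (straight {A = A} j _ QA) V@(oblique i a b β) same =
    ⊥-elim (oblique-straight-disjoint {A = A} (oblique-frame b β) (proj₁ (view-proper V)) in-1 in-2 (proj₂ (same _) in-1) (proj₂ (same _) in-2))
  view-disjoint {w} V@(straight {i} {A = A} j c QA) (straight {i'} {A = A'} j' c' QA') same with i ≟ᶠⁱⁿ i'
  ... | yes refl = inClass-unique (proj₂ (proj₂ (Q-KTS (p i w))) j j' A (∈ᵇ-refl {C = Q (p i w) (toℕ j)} QA)
          (A' , QA' , same-sym (same-unmap (ext w i) (ext-injective w i) same))) c c'
  ... | no i≢i' = trans (central-index j c QA (two-lines {A = A} {A' = A'} j i≢i' a≢b QA in-1 in-2 (proj₁ (same _) in-1) (proj₁ (same _) in-2)))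
          (sym (central-index j' c' QA' (two-lines {A = A'} {A' = A} j' (i≢i' ∘ sym) a≢b QA' (proj₁ (same _) in-1) (proj₁ (same _) in-2) in-1 in-2)))
    where
    a≢b = proj₁ (view-proper V)
    -- The special block belongs to class 0 of 𝒟, and the classes of its resolution share no block.
    central-index : ∀ {i idx A} j → InClass i j idx → Q (p i w) (toℕ j) A → SameSet A (special (p i w)) → idx ≡ inj₂ tt
    central-index {i} {A = A} j c QA same = inClass-unique
      (proj₂ (proj₂ (Q-KTS (p i w))) j 0F A (∈ᵇ-refl {C = Q (p i w) (toℕ j)} QA)
        (∈ᵇ-resp {C = Q (p i w) 0} (same-sym same) (Q-∞ (p i w)))) c central-class

  -- Existence of blocks through two points and within a class

  straight-exists : ∀ {w a b} i → ∃ (λ z → ext w i z ≡ a) → ∃ (λ z → ext w i z ≡ b) → a ≢ b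
    → ∃ λ s → B D w s × a ∈ₜ s × b ∈ₜ s
  straight-exists {w} i (α , refl) (β , refl) a≢b =
    let A , (j , QA) , α∈ , β∈ = sts-exists (D-STS (p i w)) {α} {β} (a≢b ∘ cong (ext w i))
        idx , c = inClass i j
    in mapTri (ext w i) A , (idx , unview (straight j c QA)) , ∈-map (ext w i) A α∈ , ∈-map (ext w i) A β∈

  independent-lines : ∀ {i i' c c' y y'} → i ≢ i' → c ≢ 0# → c' ≢ 0# → y ≡ c • u i → y' ≡ c' • u i' → Independent y y'
  independent-lines {i} {i'} {c} {c'} i≢i' c≢0 c'≢0 refl refl α β eq = α≡0 , β≡0
    where
    αc≡0 : α * c ≡ 0#
    αc≡0 with (α * c) ≟ᶠ 0#
    ... | yes e = e
    ... | no αc≢0 = contradiction (proj₁ (multiple-unique {i} {i'} {α * c} {(- β) * c'} αc≢0 (begin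
      (α * c) • u i
        ≡⟨ vsolve (α ∷ β ∷ c ∷ c' ∷ []) (u i ∷ u i' ∷ []) (λ α β c c' x y →
             (α ⊠ c) ⊡ x ⊜ (α ⊡ c ⊡ x ⊞ᵥ β ⊡ c' ⊡ y) ⊞ᵥ ((⊟ β) ⊠ c') ⊡ y) refl ⟩
      (α • c • u i ⊕ β • c' • u i') ⊕ ((- β) * c') • u i'   ≡⟨ cong (_⊕ ((- β) * c') • u i') eq ⟩
      0v ⊕ ((- β) * c') • u i'                              ≡⟨ vsolve [] (((- β) * c') • u i' ∷ []) (λ x → 0ᵥ ⊞ᵥ x ⊜ x) refl ⟩
      ((- β) * c') • u i'                                   ∎))) i≢i'
      where open ≡-Reasoning
    α≡0 : α ≡ 0#
    α≡0 = no-zero-divisors (trans (*-comm c α) αc≡0) c≢0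
    β≡0 : β ≡ 0#
    β≡0 with β ≟ᶠ 0#
    ... | yes e = e
    ... | no β≢0 = contradiction (•-≡0 c'≢0 (•-≡0 β≢0 (trans
      (vsolve (β ∷ c ∷ c' ∷ []) (u i ∷ u i' ∷ []) (λ β c c' x y → β ⊡ c' ⊡ y ⊜ 0ₛ ⊡ c ⊡ x ⊞ᵥ β ⊡ c' ⊡ y) refl)
      (trans (cong (λ a → a • c • u i ⊕ β • c' • u i') (sym α≡0)) eq)))) (u≢0 i')

  frame-exists : ∀ w s → Frame s → ∃ λ s' → B D w s' × SameSet s' (mapTri (shift w) s)
  frame-exists w s fr = let i , a , b , s' , β , same = frame-covered s fr
    in mapTri (shift w) s' , (inj₁ (i , a , b) , unview (oblique i a b β)) , same-map (shift w) same

  view-exists : ∀ w {a b} → Fin N → a ≢ b → ∃ λ s → B D w s × a ∈ₜ s × b ∈ₜ s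
  view-exists w {a} {b} i₀ a≢b = go (place w a) (place w b) a≢b
    where
    go : ∀ {a b} → Place w a → Place w b → a ≢ b → ∃ λ s → B D w s × a ∈ₜ s × b ∈ₜ s
    -- Two points of {∞₁, ∞₂, w} lie together on every line through w, so an arbitrary line serves.
    go (central on) (central on') a≢b = straight-exists i₀ (on i₀) (on' i₀) a≢b
    go (central on) (generic i c c≢0 eq) a≢b = straight-exists i (on i) (span-ext (c , eq)) a≢b
    go (generic i c c≢0 eq) (central on) a≢b = straight-exists i (span-ext (c , eq)) (on i) a≢b
    go (generic {y} i c c≢0 eq) (generic {y'} i' c' c'≢0 eq') a≢b with i ≟ᶠⁱⁿ i'
    ... | yes refl = straight-exists i (span-ext (c , eq)) (span-ext (c' , eq')) a≢b
    ... | no i≢i' =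
      -- The third point is forced by the zero sum.
      let s , Bs , same = frame-exists w ⟨ y , y' , neg (y ⊕ y') ⟩ (frame-sum y y' , independent-lines i≢i' c≢0 c'≢0 eq eq')
      in s , Bs , proj₂ (same _) in-1 , proj₂ (same _) in-2

  on-line-class : ∀ {w i j idx X} → InClass i j idx → ∃ (λ z → ext w i z ≡ X) → ∃ λ s → BClass D w idx s × X ∈ₜ s
  on-line-class {w} {i} {j} c (z , refl) =
    let A , QA , z∈ = parallel-exists (proj₁ (proj₂ (Q-KTS (p i w))) j) z
    in mapTri (ext w i) A , unview (straight j c QA) , ∈-map (ext w i) A z∈

  -- The class of (i, a, b) covers the line w + K_i, with ∞₁ and ∞₂, by a class of 𝒟 and all
  -- remaining points by blocks ± T; the common class covers each line by its own class 0.
  class-exists : ∀ w idx → Fin N → ∀ X → ∃ λ s → BClass D w idx s × X ∈ₜ s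
  class-exists w (inj₂ tt) i₀ X = go (place w X)
    where
    go : ∀ {X} → Place w X → ∃ λ s → BClass D w (inj₂ tt) s × X ∈ₜ s
    go (central on)          = on-line-class central-class (on i₀)
    go (generic i c c≢0 eq)  = on-line-class {i = i} central-class (span-ext (c , eq))
  class-exists w (inj₁ (i , a , b)) i₀ X = go (place w X)
    where
    go : ∀ {X} → Place w X → ∃ λ s → BClass D w (inj₁ (i , a , b)) s × X ∈ₜ s
    go (central on)             = on-line-class (other-class a b) (on i)
    go (generic i' c c≢0 eq) with i ≟ᶠⁱⁿ i'
    ... | yes refl = on-line-class (other-class a b) (span-ext (c , eq))
    ... | no i≢i' = let s , β , y∈ = block-exists (ω^≢0 b) (independent-lines i≢i' (pow≢0 (toℕ a)) c≢0 refl eq)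
      in mapTri (shift w) s , unview (oblique i a b β) , ∈-map (shift w) s y∈

  -- Every point of such a block, seen from w, is independent of the vector gᵃu_i that spans the
  -- line.
  oblique-off-line : ∀ {w i a b s A X} → Block (generator i a) (ω^ b) s → X ∈ₜ mapTri (shift w) s → X ∈ₜ mapTri (ext w i) A → ⊥
  oblique-off-line {w} {i} {a} {b} {s} {A} β X∈ X∈' =
    let y , y∈ , X≡ = ∈-map⁻ (shift w) s X∈
        z , _ , X≡' = ∈-map⁻ (ext w i) A X∈'
    in independent⇒not-collinear (block-independent β (ω^≢0 b) y∈) (pow g (toℕ a) , refl)
         (ext-span {w} {i} z (trans (sym X≡') X≡))

  class-unique : ∀ {w idx s s' X} → View w idx s → X ∈ₜ s → View w idx s' → X ∈ₜ s' → SameSet s s'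
  class-unique {w} (oblique i a b {s} β) X∈ (oblique _ _ _ {s'} β') X∈' =
    let y , y∈ , X≡ = ∈-map⁻ (shift w) s X∈
    in subst (λ s' → SameSet (mapTri (shift w) s) (mapTri (shift w) s'))
         (block-unique (ω^≢0 b) β β' y∈ (∈-unmap (shift w) (shift-injective w) s' (subst (_∈ₜ mapTri (shift w) s') X≡ X∈'))) same-refl
  class-unique (oblique i a b β) X∈ (straight {A = A} _ (other-class _ _) QA) X∈' = ⊥-elim (oblique-off-line {i = i} {a} {b} {A = A} β X∈ X∈')
  class-unique (straight {A = A} _ (other-class _ _) QA) X∈ (oblique i a b β) X∈' = ⊥-elim (oblique-off-line {i = i} {a} {b} {A = A} β X∈' X∈)
  class-unique {w} (straight {i} {A = A} j (other-class a b) QA) X∈ (straight {A = A'} _ (other-class _ _) QA') X∈' =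
    let z , z∈ , X≡ = ∈-map⁻ (ext w i) A X∈
    in same-map (ext w i) (parallel-unique (proj₁ (proj₂ (Q-KTS (p i w))) j) (∈ᵇ-refl {C = Q (p i w) (toℕ j)} QA) z∈
         (∈ᵇ-refl {C = Q (p i w) (toℕ j)} QA') (∈-unmap (ext w i) (ext-injective w i) A' (subst (_∈ₜ mapTri (ext w i) A') X≡ X∈')))
  class-unique {w} (straight {i} {A = A} _ central-class QA) X∈ (straight {i'} {A = A'} _ central-class QA') X∈' with i ≟ᶠⁱⁿ i'
  ... | yes refl =
    let z , z∈ , X≡ = ∈-map⁻ (ext w i) A X∈
    in same-map (ext w i) (parallel-unique (proj₁ (proj₂ (Q-KTS (p i w))) 0F) (∈ᵇ-refl {C = Q (p i w) 0} QA) z∈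
         (∈ᵇ-refl {C = Q (p i w) 0} QA') (∈-unmap (ext w i) (ext-injective w i) A' (subst (_∈ₜ mapTri (ext w i) A') X≡ X∈')))
  ... | no i≢i' = same-trans (map-special (through-center i≢i' QA X∈ X∈')) (same-sym (map-special (through-center (i≢i' ∘ sym) QA' X∈' X∈)))
    where
    -- A point on two lines belongs to {∞₁, ∞₂, w}; in class 0 of 𝒟 the block through such a point
    -- is the special one.
    through-center : ∀ {i i' A A' X} → i ≢ i' → Q (p i w) 0 A → X ∈ₜ mapTri (ext w i) A → X ∈ₜ mapTri (ext w i') A'
      → SameSet A (special (p i w))
    through-center {i} {i'} {A} {A'} i≢i' QA X∈ X∈' =
      let z , z∈ , X≡ = ∈-map⁻ (ext w i) A X∈
          z' , _ , X≡' = ∈-map⁻ (ext w i') A' X∈'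
      in parallel-unique (proj₁ (proj₂ (Q-KTS (p i w))) 0F) (∈ᵇ-refl {C = Q (p i w) 0} QA) z∈ (Q-∞ (p i w))
           (central-point {w} z z' i≢i' (trans (sym X≡) X≡'))

  isResolvedKTS : Fin N → ∀ w → IsResolvedKTS (BClass D w)
  isResolvedKTS i₀ w =
      sts-intro (λ s (idx , Bs) → view-proper (view idx Bs)) (view-exists w i₀)
        (λ a≢b (idx , Bs) a∈ b∈ (idx' , Bs') a∈' b∈' → view-unique a≢b (view idx Bs) a∈ b∈ (view idx' Bs') a∈' b∈')
    , (λ idx → parallel-intro (λ s Bs → view-proper (view idx Bs)) (class-exists w idx i₀)
        (λ Bs a∈ Bs' a∈' → class-unique (view idx Bs) a∈ (view idx Bs') a∈'))
    , λ idx idx' t (s , Bs , st) (s' , Bs' , st') →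
        view-disjoint (view idx Bs) (view idx' Bs') (same-trans st (same-sym st'))

  -- Every triple lies in exactly one 𝓑_w

  total : Tri W → W
  total ⟨ x , y , z ⟩ = x ⊕ y ⊕ z

  total-perm : ∀ {s s'} → Perm s s' → total s ≡ total s'
  total-perm p123 = refl
  total-perm (p231 {x} {y} {z}) = vsolve [] (x ∷ y ∷ z ∷ []) (λ x y z → x ⊞ᵥ y ⊞ᵥ z ⊜ y ⊞ᵥ z ⊞ᵥ x) refl
  total-perm (p312 {x} {y} {z}) = vsolve [] (x ∷ y ∷ z ∷ []) (λ x y z → x ⊞ᵥ y ⊞ᵥ z ⊜ z ⊞ᵥ x ⊞ᵥ y) refl
  total-perm (p132 {x} {y} {z}) = vsolve [] (x ∷ y ∷ z ∷ []) (λ x y z → x ⊞ᵥ y ⊞ᵥ z ⊜ x ⊞ᵥ z ⊞ᵥ y) refl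
  total-perm (p213 {x} {y} {z}) = vsolve [] (x ∷ y ∷ z ∷ []) (λ x y z → x ⊞ᵥ y ⊞ᵥ z ⊜ y ⊞ᵥ x ⊞ᵥ z) refl
  total-perm (p321 {x} {y} {z}) = vsolve [] (x ∷ y ∷ z ∷ []) (λ x y z → x ⊞ᵥ y ⊞ᵥ z ⊜ z ⊞ᵥ y ⊞ᵥ x) refl

  3# : Carrier
  3# = 1# + 1# + 1#

  total-translate : ∀ w s → Frame s → total (mapTri (w ⊕_) s) ≡ 3# • w
  total-translate w ⟨ x , y , z ⟩ (sum , _) = trans
    (vsolve [] (w ∷ x ∷ y ∷ z ∷ []) (λ w x y z →
      (w ⊞ᵥ x) ⊞ᵥ (w ⊞ᵥ y) ⊞ᵥ (w ⊞ᵥ z) ⊜ (1ₛ ⊞ 1ₛ ⊞ 1ₛ) ⊡ w ⊞ᵥ (x ⊞ᵥ y ⊞ᵥ z)) refl)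
    (trans (cong (3# • w ⊕_) sum) (vsolve [] (w ∷ []) (λ w → (1ₛ ⊞ 1ₛ ⊞ 1ₛ) ⊡ w ⊞ᵥ 0ᵥ ⊜ (1ₛ ⊞ 1ₛ ⊞ 1ₛ) ⊡ w) refl))

  frame-center-unique : ∀ {w w' s s'} → Frame s → Frame s' → SameSet (mapTri (shift w) s) (mapTri (shift w') s') → w ≡ w'
  frame-center-unique {w} {w'} {s} {s'} fr fr' same = •-cancelˡ 3≢0 (trans (sym (total-translate w s fr))
    (trans (total-perm (same⇒perm
        (proper-map (w ⊕_) ⊕-cancelˡ s (frame-proper s fr)) (proper-map (w' ⊕_) ⊕-cancelˡ s' (frame-proper s' fr'))
        (same-unmap fin fin-injective {mapTri (w ⊕_) s} {mapTri (w' ⊕_) s'} same)))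
      (total-translate w' s' fr')))

  ext-difference : ∀ {w i x y} α β → ext w i α ≡ fin x → ext w i β ≡ fin y → InSpan1 (u i) (x ⊖ y)
  ext-difference {w} {i} (fin a) (fin b) refl refl = a + - b ,
    vsolve (a ∷ b ∷ []) (base i w ∷ u i ∷ []) (λ a b r u → (r ⊞ᵥ a ⊡ u) ⊟ᵥ (r ⊞ᵥ b ⊡ u) ⊜ (a ⊟ b) ⊡ u) refl

  -- The line passes through w' and possibly not through w, so differences of points are used: x - y
  -- and x - z = 2x + y have determinant 3 over x and y.
  frame-not-collinear : ∀ {w w' i s A} → Frame s → (∀ X → X ∈ₜ mapTri (shift w) s → X ∈ₜ mapTri (ext w' i) A) → ⊥
  frame-not-collinear {w} {w'} {i} {⟨ x , y , z ⟩} {A} (sum , ind) ⊆ =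
    let α , _ , x≡ = ∈-map⁻ (ext w' i) A (⊆ (shift w x) in-1)
        β , _ , y≡ = ∈-map⁻ (ext w' i) A (⊆ (shift w y) in-2)
        γ , _ , z≡ = ∈-map⁻ (ext w' i) A (⊆ (shift w z) in-3)
    in independent⇒not-collinear
         (independent-det {x} {y} 1# (- 1#) (1# + 1#) 1# ind (3≢0 ∘ trans
             (ssolve [] (1ₛ ⊞ 1ₛ ⊞ 1ₛ ⊜ 1ₛ ⊠ 1ₛ ⊟ (⊟ 1ₛ) ⊠ (1ₛ ⊞ 1ₛ)) refl))
           (vsolve [] (w ∷ x ∷ y ∷ []) (λ w x y → (w ⊞ᵥ x) ⊟ᵥ (w ⊞ᵥ y) ⊜ 1ₛ ⊡ x ⊞ᵥ (⊟ 1ₛ) ⊡ y) refl)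
           (trans (cong (λ z → (w ⊕ x) ⊖ (w ⊕ z)) (frame-third sum))
             (vsolve [] (w ∷ x ∷ y ∷ []) (λ w x y → (w ⊞ᵥ x) ⊟ᵥ (w ⊟ᵥ (x ⊞ᵥ y)) ⊜ (1ₛ ⊞ 1ₛ) ⊡ x ⊞ᵥ 1ₛ ⊡ y) refl)))
         (ext-difference {w'} {i} α β (sym x≡) (sym y≡)) (ext-difference {w'} {i} α γ (sym x≡) (sym z≡))

  -- Uniqueness of coset representatives: all centres on a common line use the same origin there,
  -- which makes their copies of the systems 𝒟_c comparable.
  base-coset : ∀ {i w w'} c → w ⊖ w' ≡ c • u i → base i w ≡ base i w'
  base-coset {i} {w} {w'} c eq = R-unique i w (base i w) (base i w') (p-spec i w)
    (p i w , vsolve (p i w ∷ []) (w ∷ u i ∷ []) (λ p w u → w ⊟ᵥ (w ⊟ᵥ p ⊡ u) ⊜ p ⊡ u) refl) (p-spec i w')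
    (c + p i w' , trans
      (vsolve (p i w' ∷ []) (w ∷ w' ∷ u i ∷ []) (λ p w w' u → w ⊟ᵥ (w' ⊟ᵥ p ⊡ u) ⊜ (w ⊟ᵥ w') ⊞ᵥ p ⊡ u) refl)
      (trans (cong (_⊕ p i w' • u i) eq)
        (vsolve (c ∷ p i w' ∷ []) (u i ∷ []) (λ c p u → c ⊡ u ⊞ᵥ p ⊡ u ⊜ (c ⊞ p) ⊡ u) refl)))

  base-p : ∀ i w → w ≡ base i w ⊕ p i w • u i
  base-p i w = vsolve (p i w ∷ []) (w ∷ u i ∷ []) (λ p w u → w ⊜ (w ⊟ᵥ p ⊡ u) ⊞ᵥ p ⊡ u) refl

  -- Two finite points reveal the line of a block; without them a proper triple contains both
  -- infinite points and is identified as a special block.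
  data Shape : Tri Y → Set where
    with-∞     : ∀ {A} → ∞₁ ∈ₜ A → ∞₂ ∈ₜ A → Shape A
    two-finite : ∀ {A a b} → a ≢ b → fin a ∈ₜ A → fin b ∈ₜ A → Shape A

  shape : ∀ A → Proper A → Shape A
  shape ⟨ fin a , fin b , _ ⟩ (a≢b , _) = two-finite (a≢b ∘ cong fin) in-1 in-2
  shape ⟨ fin a , ∞₁ , fin b ⟩ (_ , a≢b , _) = two-finite (a≢b ∘ cong fin) in-1 in-3
  shape ⟨ fin a , ∞₂ , fin b ⟩ (_ , a≢b , _) = two-finite (a≢b ∘ cong fin) in-1 in-3
  shape ⟨ ∞₁ , fin a , fin b ⟩ (_ , _ , a≢b) = two-finite (a≢b ∘ cong fin) in-2 in-3
  shape ⟨ ∞₂ , fin a , fin b ⟩ (_ , _ , a≢b) = two-finite (a≢b ∘ cong fin) in-2 in-3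
  shape ⟨ ∞₁ , ∞₂ , _ ⟩ _ = with-∞ in-1 in-2
  shape ⟨ ∞₂ , ∞₁ , _ ⟩ _ = with-∞ in-2 in-1
  shape ⟨ ∞₁ , fin _ , ∞₂ ⟩ _ = with-∞ in-1 in-3
  shape ⟨ ∞₂ , fin _ , ∞₁ ⟩ _ = with-∞ in-3 in-1
  shape ⟨ fin _ , ∞₁ , ∞₂ ⟩ _ = with-∞ in-2 in-3
  shape ⟨ fin _ , ∞₂ , ∞₁ ⟩ _ = with-∞ in-3 in-2
  shape ⟨ ∞₁ , ∞₁ , _ ⟩ (≢ , _) = contradiction refl ≢
  shape ⟨ ∞₂ , ∞₂ , _ ⟩ (≢ , _) = contradiction refl ≢
  shape ⟨ ∞₁ , fin _ , ∞₁ ⟩ (_ , ≢ , _) = contradiction refl ≢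
  shape ⟨ ∞₂ , fin _ , ∞₂ ⟩ (_ , ≢ , _) = contradiction refl ≢
  shape ⟨ fin _ , ∞₁ , ∞₁ ⟩ (_ , _ , ≢) = contradiction refl ≢
  shape ⟨ fin _ , ∞₂ , ∞₂ ⟩ (_ , _ , ≢) = contradiction refl ≢

  ∞₁∈-unext : ∀ {w i} A → ∞₁ ∈ₜ mapTri (ext w i) A → ∞₁ ∈ₜ A
  ∞₁∈-unext {w} {i} A = ∈-unmap (ext w i) (ext-injective w i) {∞₁} A

  ∞₂∈-unext : ∀ {w i} A → ∞₂ ∈ₜ mapTri (ext w i) A → ∞₂ ∈ₜ A
  ∞₂∈-unext {w} {i} A = ∈-unmap (ext w i) (ext-injective w i) {∞₂} A

  special-through-∞ : ∀ {w i A} (j : Level) → Q (p i w) (toℕ j) A → ∞₁ ∈ₜ A → ∞₂ ∈ₜ A → SameSet (mapTri (ext w i) A) (special w)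
  special-through-∞ {w} {i} j QA ∞₁∈ ∞₂∈ = map-special (D-special j (λ ()) QA ∞₁∈ ∞₂∈ in-1 in-2)

  special-injective : {w w' : W} → SameSet (special w) (special w') → w ≡ w'
  special-injective {w} same with proj₁ (same (fin w)) in-3
  ... | inj₂ (inj₂ eq) = fin-injective eq

  view-center-unique : ∀ {w w' idx idx' s s'} → View w idx s → View w' idx' s' → SameSet s s' → w ≡ w'
  view-center-unique (oblique i a b β) (oblique i' a' b' β') same =
    frame-center-unique (oblique-frame b β) (oblique-frame b' β') same
  view-center-unique (oblique i a b β) (straight {A = A} j _ QA) same =
    ⊥-elim (frame-not-collinear {A = A} (oblique-frame b β) λ X → proj₁ (same X))
  view-center-unique (straight {A = A} j _ QA) (oblique i a b β) same =
    ⊥-elim (frame-not-collinear {A = A} (oblique-frame b β) λ X → proj₂ (same X))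
  view-center-unique {w} {w'} (straight {i} {A = A} j _ QA) (straight {i'} {A = A'} j' _ QA') same = go (shape A (D-proper j QA))
    where
    go : Shape A → w ≡ w'
    go (with-∞ ∞₁∈ ∞₂∈) = special-injective (same-trans (same-sym (special-through-∞ j QA ∞₁∈ ∞₂∈))
      (same-trans same (special-through-∞ j' QA'
        (∞₁∈-unext {w'} {i'} A' (proj₁ (same ∞₁) (∈-map (ext w i) A ∞₁∈)))
        (∞₂∈-unext {w'} {i'} A' (proj₁ (same ∞₂) (∈-map (ext w i) A ∞₂∈))))))
    go (two-finite {a = a} {b} a≢b a∈ b∈) =
      let α , _ , a≡ = ∈-map⁻ (ext w' i') A' (proj₁ (same (ext w i (fin a))) (∈-map (ext w i) A a∈))
          β , _ , b≡ = ∈-map⁻ (ext w' i') A' (proj₁ (same (ext w i (fin b))) (∈-map (ext w i) A b∈))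
      in on-two-points α β a≡ b≡
      where
      same-line : i ≡ i' → base i w ≡ base i w' → w ≡ w'
      same-line refl base≡ = trans (base-p i w) (trans (cong₂ (λ r c → r ⊕ c • u i) base≡ p≡) (sym (base-p i w')))
        where
        p≡ : p i w ≡ p i w'
        -- With the same line and origin, one triple would be a block of two of the given systems
        -- unless their indices agree.
        p≡ = Q-disjoint (p i w) (p i w') A (D-∈ᵇ j (∈ᵇ-refl {C = Q (p i w) (toℕ j)} QA))
          (D-∈ᵇ j' (A' , QA' , same-sym (same-unmap (ext w' i) (ext-injective w' i)
            (subst (λ r → SameSet (mapTri (extPt r (u i)) A) (mapTri (ext w' i) A')) base≡ same))))
      on-two-points : ∀ α β → ext w i (fin a) ≡ ext w' i' α → ext w i (fin b) ≡ ext w' i' β → w ≡ w'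
      -- A common point has coordinate a - p_i(w) when measured from w and c - p_i'(w') when
      -- measured from w'; subtracting expresses w - w' on the line.
      on-two-points (fin c) (fin d) a≡ b≡ = same-line i≡i' (base-coset (p i w + - a + (c + - p i' w')) difference)
        where
        i≡i' : i ≡ i'
        i≡i' = proj₁ (multiple-unique {i} {i'} {a + - b} {c + - d} (a≢b ∘ difference-zero) (trans
          (vsolve (a ∷ b ∷ []) (base i w ∷ u i ∷ []) (λ a b r u → (a ⊟ b) ⊡ u ⊜ (r ⊞ᵥ a ⊡ u) ⊟ᵥ (r ⊞ᵥ b ⊡ u)) refl)
          (trans (cong₂ _⊖_ (fin-injective a≡) (fin-injective b≡))
            (vsolve (c ∷ d ∷ []) (base i' w' ∷ u i' ∷ []) (λ a b r u → (r ⊞ᵥ a ⊡ u) ⊟ᵥ (r ⊞ᵥ b ⊡ u) ⊜ (a ⊟ b) ⊡ u) refl))))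
        difference : w ⊖ w' ≡ (p i w + - a + (c + - p i' w')) • u i
        difference = trans
          (vsolve (a ∷ p i w ∷ []) (w ∷ w' ∷ u i ∷ []) (λ a p w w' u →
            w ⊟ᵥ w' ⊜ (p ⊟ a) ⊡ u ⊞ᵥ ((w ⊟ᵥ p ⊡ u) ⊞ᵥ a ⊡ u) ⊟ᵥ w') refl)
          (trans (cong (λ x → (p i w + - a) • u i ⊕ x ⊖ w') (fin-injective a≡))
            (trans (vsolve (p i w + - a ∷ c ∷ p i' w' ∷ []) (w' ∷ u i ∷ u i' ∷ []) (λ e c p w' u u' →
                  e ⊡ u ⊞ᵥ ((w' ⊟ᵥ p ⊡ u') ⊞ᵥ c ⊡ u') ⊟ᵥ w' ⊜ e ⊡ u ⊞ᵥ (c ⊟ p) ⊡ u') refl)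
              (trans (cong (λ k → (p i w + - a) • u i ⊕ (c + - p i' w') • u k) (sym i≡i'))
                  (vsolve (p i w + - a ∷ c + - p i' w' ∷ []) (u i ∷ []) (λ e f u → e ⊡ u ⊞ᵥ f ⊡ u ⊜ (e ⊞ f) ⊡ u) refl))))

  -- Every triple is covered

  Collinear : Pt W → Pt W → Pt W → Set
  Collinear X Y Z = ∃ λ w → ∃ λ i → ∃ λ α → ∃ λ β → ∃ λ γ → ext w i α ≡ X × ext w i β ≡ Y × ext w i γ ≡ Z

  collinear-covered : ∀ {X Y Z} → Proper ⟨ X , Y , Z ⟩ → Collinear X Y Z → ∃ λ w → ⟨ X , Y , Z ⟩ ∈ᵇ B D w
  collinear-covered proper (w₀ , i , α , β , γ , refl , refl , refl) =
    let c , A , (j , QA) , same = D-covers ⟨ α , β , γ ⟩ (proper-unmap (ext w₀ i) ⟨ α , β , γ ⟩ proper)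
        r = base i w₀
        -- The centre is the point with coordinate c on the line, so that `p i w` is c and 𝓑_w
        -- carries 𝒟_c there.
        w = r ⊕ c • u i
        base≡ : base i w ≡ r
        base≡ = base-coset (c + - p i w₀) (vsolve (c ∷ p i w₀ ∷ []) (w₀ ∷ u i ∷ []) (λ c p w u →
          ((w ⊟ᵥ p ⊡ u) ⊞ᵥ c ⊡ u) ⊟ᵥ w ⊜ (c ⊟ p) ⊡ u) refl)
        p≡c : p i w ≡ c
        p≡c = •-cancelʳ (u≢0 i) (⊕-cancelˡ (trans (cong (_⊕ p i w • u i) (sym base≡)) (sym (base-p i w))))
        idx , cl = inClass i j
    in w , mapTri (ext w i) A , (idx , unview (straight j cl (subst (λ c → Q c (toℕ j) A) (sym p≡c) QA)))
     , subst (λ r' → SameSet (mapTri (extPt r' (u i)) A) (mapTri (extPt r (u i)) ⟨ α , β , γ ⟩)) (sym base≡)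
         (same-map (extPt r (u i)) same)

  line-through : ∀ w → Fin N → ∀ X → ∃ λ i → (∃ λ α → ext w i α ≡ X) × (∃ λ β → ext w i β ≡ fin w)
  line-through w i₀ X = go (place w X)
    where
    go : ∀ {X} → Place w X → ∃ λ i → (∃ λ α → ext w i α ≡ X) × (∃ λ β → ext w i β ≡ fin w)
    go (central on)         = i₀ , on i₀ , (fin (p i₀ w) , ext-p w i₀)
    go (generic i c c≢0 eq) = i , span-ext (c , eq) , (fin (p i w) , ext-p w i)

  -- A finite point may be taken as the centre of the coordinates; an infinite one lies on all
  -- lines, so it suffices to find a line from the zero vector to the other point.
  line-through-two : Fin N → ∀ X Y → ∃ λ w → ∃ λ i → (∃ λ α → ext w i α ≡ X) × (∃ λ β → ext w i β ≡ Y)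
  line-through-two i₀ (fin x) Y = let i , onY , onX = line-through x i₀ Y in x , i , onX , onY
  line-through-two i₀ ∞₁ Y = let i , onY , _ = line-through 0v i₀ Y in 0v , i , (∞₁ , refl) , onY
  line-through-two i₀ ∞₂ Y = let i , onY , _ = line-through 0v i₀ Y in 0v , i , (∞₂ , refl) , onY

  triangle-covered : ∀ {x y z} → Independent (y ⊖ x) (z ⊖ x) → ∃ λ w → ⟨ fin x , fin y , fin z ⟩ ∈ᵇ B D w
  triangle-covered {x} {y} {z} ind =
    let h , 3h≡1 = inverse 3# 3≢0
        h≢0 = unit≢0 (trans (*-comm h _) 3h≡1)
        w = h • (x ⊕ y ⊕ z)
        fr : Frame ⟨ x ⊖ w , y ⊖ w , z ⊖ w ⟩
        fr = trans (vsolve (h ∷ []) (x ∷ y ∷ z ∷ []) (λ h x y z → let w = h ⊡ (x ⊞ᵥ y ⊞ᵥ z) in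
                 (x ⊟ᵥ w) ⊞ᵥ (y ⊟ᵥ w) ⊞ᵥ (z ⊟ᵥ w) ⊜ (1ₛ ⊟ (1ₛ ⊞ 1ₛ ⊞ 1ₛ) ⊠ h) ⊡ (x ⊞ᵥ y ⊞ᵥ z)) refl)
               (trans (cong (λ k → (1# + - k) • (x ⊕ y ⊕ z)) 3h≡1)
                 (vsolve [] (x ∷ y ∷ z ∷ []) (λ x y z → (1ₛ ⊟ 1ₛ) ⊡ (x ⊞ᵥ y ⊞ᵥ z) ⊜ 0ᵥ) refl))
           , independent-det (- h) (- h) (h + h) (- h) ind
               -- Relative to the edge vectors y - x and z - x, the vectors from the centroid to x
               -- and y have determinant 3h², with h the inverse of 3.
               (nonzero-* 3≢0 (nonzero-* h≢0 h≢0) ∘ trans (ssolve (h ∷ []) (λ h →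
                 (1ₛ ⊞ 1ₛ ⊞ 1ₛ) ⊠ (h ⊠ h) ⊜ (⊟ h) ⊠ (⊟ h) ⊟ (⊟ h) ⊠ (h ⊞ h)) refl))
               (trans (cong (_⊖ w) (sym (scale-one 3h≡1 x)))
                 (vsolve (h ∷ []) (x ∷ y ∷ z ∷ []) (λ h x y z →
                   ((1ₛ ⊞ 1ₛ ⊞ 1ₛ) ⊠ h) ⊡ x ⊟ᵥ h ⊡ (x ⊞ᵥ y ⊞ᵥ z) ⊜ (⊟ h) ⊡ (y ⊟ᵥ x) ⊞ᵥ (⊟ h) ⊡ (z ⊟ᵥ x)) refl))
               (trans (cong (_⊖ w) (sym (scale-one 3h≡1 y)))
                 (vsolve (h ∷ []) (x ∷ y ∷ z ∷ []) (λ h x y z →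
                   ((1ₛ ⊞ 1ₛ ⊞ 1ₛ) ⊠ h) ⊡ y ⊟ᵥ h ⊡ (x ⊞ᵥ y ⊞ᵥ z) ⊜ (h ⊞ h) ⊡ (y ⊟ᵥ x) ⊞ᵥ (⊟ h) ⊡ (z ⊟ᵥ x)) refl))
        s , Bs , same = frame-exists w ⟨ x ⊖ w , y ⊖ w , z ⊖ w ⟩ fr
        back : ∀ a → w ⊕ (a ⊖ w) ≡ a
        back a = vsolve [] (a ∷ w ∷ []) (λ a w → w ⊞ᵥ (a ⊟ᵥ w) ⊜ a) refl
    in w , s , Bs , subst (SameSet s) (⟨⟩-cong (cong fin (back x)) (cong fin (back y)) (cong fin (back z))) same

  -- A triple with an infinite point lies on a line. Three finite points are collinear or form a
  -- triangle according to whether the two edges at x have the same direction K_i.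
  covered : Fin N → ∀ s → Proper s → ∃ λ w → s ∈ᵇ B D w
  covered i₀ ⟨ X , Y , ∞₁ ⟩ proper = let w , i , (α , x≡) , (β , y≡) = line-through-two i₀ X Y in
    collinear-covered proper (w , i , α , β , ∞₁ , x≡ , y≡ , refl)
  covered i₀ ⟨ X , Y , ∞₂ ⟩ proper = let w , i , (α , x≡) , (β , y≡) = line-through-two i₀ X Y in
    collinear-covered proper (w , i , α , β , ∞₂ , x≡ , y≡ , refl)
  covered i₀ ⟨ X , ∞₁ , Z@(fin _) ⟩ proper = let w , i , (α , x≡) , (γ , z≡) = line-through-two i₀ X Z in
    collinear-covered proper (w , i , α , ∞₁ , γ , x≡ , refl , z≡)
  covered i₀ ⟨ X , ∞₂ , Z@(fin _) ⟩ proper = let w , i , (α , x≡) , (γ , z≡) = line-through-two i₀ X Z in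
    collinear-covered proper (w , i , α , ∞₂ , γ , x≡ , refl , z≡)
  covered i₀ ⟨ ∞₁ , Y@(fin _) , Z@(fin _) ⟩ proper = let w , i , (β , y≡) , (γ , z≡) = line-through-two i₀ Y Z in
    collinear-covered proper (w , i , ∞₁ , β , γ , refl , y≡ , z≡)
  covered i₀ ⟨ ∞₂ , Y@(fin _) , Z@(fin _) ⟩ proper = let w , i , (β , y≡) , (γ , z≡) = line-through-two i₀ Y Z in
    collinear-covered proper (w , i , ∞₂ , β , γ , refl , y≡ , z≡)
  covered i₀ ⟨ fin x , fin y , fin z ⟩ proper@(x≢y , x≢z , _) =
    go (K-cover (y ⊖ x) (λ e → x≢y (cong fin (sym (⊖-≡0 e))))) (K-cover (z ⊖ x) (λ e → x≢z (cong fin (sym (⊖-≡0 e)))))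
    where
    through : ∀ i v → InSpan1 (u i) (v ⊖ x) → ∃ λ β → ext x i β ≡ fin v
    through i v v∈ = let β , eq = span-ext {x} {i} v∈ in
      β , trans eq (cong fin (vsolve [] (x ∷ v ∷ []) (λ x v → x ⊞ᵥ (v ⊟ᵥ x) ⊜ v) refl))
    go : (∃ λ i → InSpan1 (u i) (y ⊖ x)) → (∃ λ i → InSpan1 (u i) (z ⊖ x)) → ∃ λ w → ⟨ fin x , fin y , fin z ⟩ ∈ᵇ B D w
    go (i , c , y≡) (i' , c' , z≡) with i ≟ᶠⁱⁿ i'
    ... | yes refl = let β , onY = through i y (c , y≡) ; γ , onZ = through i z (c' , z≡) in
      collinear-covered proper (x , i , fin (p i x) , β , γ , ext-p x i , onY , onZ)
    ... | no i≢i' = triangle-covered (independent-lines i≢i'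
      (λ c≡0 → x≢y (cong fin (sym (⊖-≡0 (trans y≡ (trans (cong (_• u i) c≡0) (0• (u i))))))))
      (λ c≡0 → x≢z (cong fin (sym (⊖-≡0 (trans z≡ (trans (cong (_• u i') c≡0) (0• (u i')))))))) y≡ z≡)

  isLKTS : Fin N → IsLKTS D
  isLKTS i₀ =
      (λ s proper → covered i₀ s proper , λ w w' (r , (idx , Br) , rs) (r' , (idx' , Br') , rs') →
        view-center-unique (view idx Br) (view idx' Br') (same-trans rs (same-sym rs')))
    , isResolvedKTS i₀

  -- The all-ones vector is nonzero because it has a coordinate. Its line carries the blocks through
  -- pairs such as ∞₁, ∞₂.
  some-line : 2 ℕ.≤ n → Fin N
  some-line 2≤n = proj₁ (K-cover (replicate n 1#) λ eq → 0≢1 (sym (trans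
    (sym (lookup-replicate i 1#)) (trans (cong (λ v → lookup v i) eq) (lookup-replicate i 0#)))))
    where
    i : Fin n
    i = fromℕ< (ℕₚ.≤-trans (ℕ.s≤s ℕ.z≤n) 2≤n)

-- Here the equation for q has a successor on the right, so matching on `refl` gives the field the
-- literal order that the counting of nonzero elements requires.
theorem-for-order : ∀ {q} (𝔽 : FiniteField q) t n → q ≡ suc (6 *ℕ t) → 2 ℕ.≤ n
  → (D : Construction.ConstructionData 𝔽 n t) → Construction.IsLKTS 𝔽 n D
theorem-for-order 𝔽 t n refl 2≤n D = LargeSet.isLKTS 𝔽 n D (LargeSet.some-line 𝔽 n D 2≤n)

open import Data.Nat using (ℕ; _+_; _*_; _≤_)

theorem4 : ∀ {q} (𝔽 : FiniteField q) (t n : ℕ) → q ≡ 6 * t + 1 → 2 ≤ n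
    → (D : Construction.ConstructionData 𝔽 n t) → Construction.IsLKTS 𝔽 n D
theorem4 𝔽 t n q≡6t+1 = theorem-for-order 𝔽 t n (trans q≡6t+1 (ℕₚ.+-comm (6 * t) 1))
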